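{- Let $\Gamma$ be a finitely generated abelian group and $X$ a finite list of elements of $\Gamma$. Then $M_X(x,y)$ is a polynomial in $x,y$ all of whose coefficients are nonnegative.
   Context: Write $\Gamma=\Lambda\times\Gamma_t$ with $\Lambda$ free abelian of finite rank and $\Gamma_t$ the finite torsion subgroup, and let $\pi:\Gamma\to\Lambda$ be the projection. For a sublist $A\subseteq X$: $\langle A\rangle$ is the subgroup generated by $A$; $r(A)$ is the dimension of the real span of $\pi(A)$ in $\Lambda\otimes\mathbb{R}$; $\Gamma_A=\pi^{ -1}(\Lambda\cap\langle\pi(A)\rangle_{\mathbb{R}})$ (the largest subgroup of $\Gamma$ in which $\langle A\rangle$ has finite index); $m(A)=[\Gamma_A:\langle A\rangle]$. The multiplicity Tutte polynomial is $M_X(x,y)=\sum_{A\subseteq X} m(A)(x-1)^{r(X)-r(A)}(y-1)^{|A|-r(A)}$, summing over all sublists. -}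

module Defs where

open import Algebra.Bundles using (AbelianGroup; RawRing)
open import Algebra.Definitions.RawMonoid as RawMonoidDefs using ()
open import Algebra.Definitions.RawSemiring as RawSemiringDefs using ()
open import Algebra.Construct.DirectProduct as DirectProduct using ()
open import Algebra.Construct.Pointwise as Pointwise using ()
open import Algebra.Morphism.Structures using (module GroupMorphisms)
open import Data.Fin.Base using (Fin)
open import Data.Integer.Base as ℤ using (ℤ)
open import Data.Integer.Properties as ℤₚ using ()
open import Data.List.Base using (List; []; _∷_; _++_; foldr; length; lookup; map)
open import Data.List.Membership.Propositional using (_∈_)
open import Data.Nat.Base as ℕ using (ℕ; zero; suc; _∸_; _⊔_)
open import Data.Nat.Properties as ℕₚ using ()
open import Data.Product.Base using (Σ; ∃; _×_; _,_; proj₁; proj₂)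
open import Data.Rational.Base as ℚ using (ℚ; 0ℚ; 1ℚ)
open import Data.Rational.Properties as ℚₚ using ()
open import Data.Rational.Solver using (module +-*-Solver)
open import Data.Vec.Functional using (Vector)
open import Function.Base using (_∘_)
open import Function.Bundles using (Bijection; _⇔_)
open import Level using (Level; 0ℓ) renaming (suc to lsuc; _⊔_ to _⊔ˡ_)
open import Relation.Binary.PropositionalEquality as ≡ using (_≡_; refl; cong; cong₂; sym; subst)

private
  variable
    a c ℓ p q : Level

-- A real number is a Cauchy sequence of rationals; two of them are equal
-- when their difference tends to 0. Only the operations are needed here, hence
-- the raw ring ℝ below.

Cauchy : (ℕ → ℚ) → Set
Cauchy s = ∀ ε → 0ℚ ℚ.< ε →
  ∃ λ N → ∀ m n → N ℕ.≤ m → N ℕ.≤ n → ℚ.∣ s m ℚ.- s n ∣ ℚ.< ε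

TendsTo0 : (ℕ → ℚ) → Set
TendsTo0 s = ∀ ε → 0ℚ ℚ.< ε → ∃ λ N → ∀ n → N ℕ.≤ n → ℚ.∣ s n ∣ ℚ.< ε

infixl 6 _⟨+⟩_
infixl 7 _⟨*⟩_
_⟨+⟩_ _⟨*⟩_ : (ℕ → ℚ) → (ℕ → ℚ) → ℕ → ℚ
(s ⟨+⟩ t) n = s n ℚ.+ t n
(s ⟨*⟩ t) n = s n ℚ.* t n

const-Cauchy : ∀ q → Cauchy (λ _ → q)
const-Cauchy q ε ε>0 = 0 , λ _ _ _ _ →
  subst (λ z → ℚ.∣ z ∣ ℚ.< ε) (sym (ℚₚ.+-inverseʳ q)) ε>0

neg-Cauchy : ∀ s → Cauchy s → Cauchy (ℚ.-_ ∘ s)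
neg-Cauchy s S ε ε>0 with S ε ε>0
... | N , close = N , λ m n N≤m N≤n → begin-strict
    ℚ.∣ ℚ.- s m ℚ.- ℚ.- s n ∣    ≡⟨ cong ℚ.∣_∣ (ℚₚ.neg-distrib-+ (s m) (ℚ.- s n)) ⟨
    ℚ.∣ ℚ.- (s m ℚ.- s n) ∣      ≡⟨ ℚₚ.∣-p∣≡∣p∣ (s m ℚ.- s n) ⟩
    ℚ.∣ s m ℚ.- s n ∣            <⟨ close m n N≤m N≤n ⟩
    ε                            ∎
  where open ℚₚ.≤-Reasoning

+-Cauchy : ∀ s t → Cauchy s → Cauchy t → Cauchy (s ⟨+⟩ t)
+-Cauchy s t S T ε ε>0 = M ⊔ N , λ m n M⊔N≤m M⊔N≤n → begin-strict
    ℚ.∣ (s m ℚ.+ t m) ℚ.- (s n ℚ.+ t n) ∣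
      ≡⟨ cong ℚ.∣_∣ (rearrange (s m) (t m) (s n) (t n)) ⟩
    ℚ.∣ (s m ℚ.- s n) ℚ.+ (t m ℚ.- t n) ∣
      ≤⟨ ℚₚ.∣p+q∣≤∣p∣+∣q∣ (s m ℚ.- s n) (t m ℚ.- t n) ⟩
    ℚ.∣ s m ℚ.- s n ∣ ℚ.+ ℚ.∣ t m ℚ.- t n ∣
      <⟨ ℚₚ.+-mono-<
           (proj₂ (S δ δ>0) m n (ℕₚ.m⊔n≤o⇒m≤o M N M⊔N≤m) (ℕₚ.m⊔n≤o⇒m≤o M N M⊔N≤n))
           (proj₂ (T δ δ>0) m n (ℕₚ.m⊔n≤o⇒n≤o M N M⊔N≤m) (ℕₚ.m⊔n≤o⇒n≤o M N M⊔N≤n)) ⟩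
    δ ℚ.+ δ
      ≡⟨ ℚₚ.*-distribʳ-+ ε ℚ.½ ℚ.½ ⟨
    1ℚ ℚ.* ε
      ≡⟨ ℚₚ.*-identityˡ ε ⟩
    ε ∎
  where
  open ℚₚ.≤-Reasoning
  δ = ℚ.½ ℚ.* ε
  δ>0 : 0ℚ ℚ.< δ
  δ>0 = subst (ℚ._< δ) (ℚₚ.*-zeroʳ ℚ.½) (ℚₚ.*-monoʳ-<-pos ℚ.½ ε>0)
  M = proj₁ (S δ δ>0)
  N = proj₁ (T δ δ>0)
  rearrange : ∀ u v x y →
    (u ℚ.+ v) ℚ.- (x ℚ.+ y) ≡ (u ℚ.- x) ℚ.+ (v ℚ.- y)
  rearrange = solve 4 (λ u v x y →
    (u :+ v) :- (x :+ y) := (u :- x) :+ (v :- y)) refl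
    where open +-*-Solver

bounded : ∀ s → Cauchy s →
  ∃ λ B → 0ℚ ℚ.< B × ∃ λ N → ∀ n → N ℕ.≤ n → ℚ.∣ s n ∣ ℚ.< B
bounded s S with S 1ℚ (ℚₚ.positive⁻¹ 1ℚ)
... | N , close = 1ℚ ℚ.+ ℚ.∣ s N ∣
    , ℚₚ.+-mono-<-≤ (ℚₚ.positive⁻¹ 1ℚ) (ℚₚ.0≤∣p∣ (s N))
    , N , λ n N≤n → begin-strict
      ℚ.∣ s n ∣                            ≡⟨ cong ℚ.∣_∣ (rearrange (s n) (s N)) ⟩
      ℚ.∣ (s n ℚ.- s N) ℚ.+ s N ∣          ≤⟨ ℚₚ.∣p+q∣≤∣p∣+∣q∣ (s n ℚ.- s N) (s N) ⟩
      ℚ.∣ s n ℚ.- s N ∣ ℚ.+ ℚ.∣ s N ∣      <⟨ ℚₚ.+-monoˡ-< ℚ.∣ s N ∣ (close n N N≤n ℕₚ.≤-refl) ⟩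
      1ℚ ℚ.+ ℚ.∣ s N ∣                     ∎
  where
  open ℚₚ.≤-Reasoning
  rearrange : ∀ u v → u ≡ (u ℚ.- v) ℚ.+ v
  rearrange = solve 2 (λ u v → u := (u :- v) :+ v) refl
    where open +-*-Solver

*-close : ∀ {b c δ} u v x y → 0ℚ ℚ.< b → 0ℚ ℚ.< c → ℚ.∣ u ∣ ℚ.< b → ℚ.∣ y ∣ ℚ.< c →
  ℚ.∣ u ℚ.- x ∣ ℚ.< δ → ℚ.∣ v ℚ.- y ∣ ℚ.< δ →
  ℚ.∣ u ℚ.* v ℚ.- x ℚ.* y ∣ ℚ.< (b ℚ.+ c) ℚ.* δ
*-close {b} {c} {δ} u v x y b>0 c>0 u<b y<c u~x v~y = begin-strict
    ℚ.∣ u ℚ.* v ℚ.- x ℚ.* y ∣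
      ≡⟨ cong ℚ.∣_∣ (rearrange u v x y) ⟩
    ℚ.∣ u ℚ.* (v ℚ.- y) ℚ.+ y ℚ.* (u ℚ.- x) ∣
      ≤⟨ ℚₚ.∣p+q∣≤∣p∣+∣q∣ (u ℚ.* (v ℚ.- y)) (y ℚ.* (u ℚ.- x)) ⟩
    ℚ.∣ u ℚ.* (v ℚ.- y) ∣ ℚ.+ ℚ.∣ y ℚ.* (u ℚ.- x) ∣
      ≡⟨ cong₂ ℚ._+_ (ℚₚ.∣p*q∣≡∣p∣*∣q∣ u (v ℚ.- y)) (ℚₚ.∣p*q∣≡∣p∣*∣q∣ y (u ℚ.- x)) ⟩
    ℚ.∣ u ∣ ℚ.* ℚ.∣ v ℚ.- y ∣ ℚ.+ ℚ.∣ y ∣ ℚ.* ℚ.∣ u ℚ.- x ∣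
      <⟨ ℚₚ.+-mono-< (bound b>0 u<b v~y) (bound c>0 y<c u~x) ⟩
    b ℚ.* δ ℚ.+ c ℚ.* δ
      ≡⟨ ℚₚ.*-distribʳ-+ δ b c ⟨
    (b ℚ.+ c) ℚ.* δ ∎
  where
  open ℚₚ.≤-Reasoning
  bound : ∀ {b p q} → 0ℚ ℚ.< b → ℚ.∣ p ∣ ℚ.< b → ℚ.∣ q ∣ ℚ.< δ →
    ℚ.∣ p ∣ ℚ.* ℚ.∣ q ∣ ℚ.< b ℚ.* δ
  bound {b} {p} {q} b>0 p<b q<δ = begin-strict
    ℚ.∣ p ∣ ℚ.* ℚ.∣ q ∣
      ≤⟨ ℚₚ.*-monoʳ-≤-nonNeg ℚ.∣ q ∣ {{ℚ.nonNegative (ℚₚ.0≤∣p∣ q)}} (ℚₚ.<⇒≤ p<b) ⟩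
    b ℚ.* ℚ.∣ q ∣
      <⟨ ℚₚ.*-monoʳ-<-pos b {{ℚ.positive b>0}} q<δ ⟩
    b ℚ.* δ ∎
  rearrange : ∀ u v x y →
    u ℚ.* v ℚ.- x ℚ.* y ≡ u ℚ.* (v ℚ.- y) ℚ.+ y ℚ.* (u ℚ.- x)
  rearrange = solve 4 (λ u v x y →
    u :* v :- x :* y := u :* (v :- y) :+ y :* (u :- x)) refl
    where open +-*-Solver

shrink : ∀ {d ε} → 0ℚ ℚ.< d → 0ℚ ℚ.< ε → ∃ λ δ → 0ℚ ℚ.< δ × d ℚ.* δ ≡ ε
shrink {d} {ε} d>0 ε>0 = d⁻¹ ℚ.* ε
  , subst (ℚ._< d⁻¹ ℚ.* ε) (ℚₚ.*-zeroʳ d⁻¹)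
      (ℚₚ.*-monoʳ-<-pos d⁻¹ {{ℚₚ.1/pos⇒pos d {{ℚ.positive d>0}}}} ε>0)
  , ≡.trans (sym (ℚₚ.*-assoc d d⁻¹ ε))
      (≡.trans (cong (ℚ._* ε) (ℚₚ.*-inverseʳ d {{d≢0}})) (ℚₚ.*-identityˡ ε))
  where
  d≢0 : ℚ.NonZero d
  d≢0 = ℚₚ.pos⇒nonZero d {{ℚ.positive d>0}}
  d⁻¹ = ℚ.1/_ d {{d≢0}}

*-Cauchy : ∀ s t → Cauchy s → Cauchy t → Cauchy (s ⟨*⟩ t)
*-Cauchy s t S T ε ε>0 = from (bounded s S) (bounded t T)
  where
  from : (∃ λ b → 0ℚ ℚ.< b × ∃ λ K → ∀ n → K ℕ.≤ n → ℚ.∣ s n ∣ ℚ.< b) →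
         (∃ λ c → 0ℚ ℚ.< c × ∃ λ L → ∀ n → L ℕ.≤ n → ℚ.∣ t n ∣ ℚ.< c) →
         ∃ λ N → ∀ m n → N ℕ.≤ m → N ℕ.≤ n →
           ℚ.∣ s m ℚ.* t m ℚ.- s n ℚ.* t n ∣ ℚ.< ε
  from (b , b>0 , K , s<b) (c , c>0 , L , t<c) = choose (shrink (ℚₚ.+-mono-< b>0 c>0) ε>0)
    where
    choose : (∃ λ δ → 0ℚ ℚ.< δ × (b ℚ.+ c) ℚ.* δ ≡ ε) →
             ∃ λ N → ∀ m n → N ℕ.≤ m → N ℕ.≤ n →
               ℚ.∣ s m ℚ.* t m ℚ.- s n ℚ.* t n ∣ ℚ.< ε
    choose (δ , δ>0 , eq) = (K ⊔ L) ⊔ (M ⊔ N) , λ m n h h′ →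
        subst (ℚ.∣ s m ℚ.* t m ℚ.- s n ℚ.* t n ∣ ℚ.<_) eq
          (*-close (s m) (t m) (s n) (t n) b>0 c>0
            (s<b m (ℕₚ.m⊔n≤o⇒m≤o K L (KL≤ h)))
            (t<c n (ℕₚ.m⊔n≤o⇒n≤o K L (KL≤ h′)))
            (proj₂ (S δ δ>0) m n (ℕₚ.m⊔n≤o⇒m≤o M N (MN≤ h)) (ℕₚ.m⊔n≤o⇒m≤o M N (MN≤ h′)))
            (proj₂ (T δ δ>0) m n (ℕₚ.m⊔n≤o⇒n≤o M N (MN≤ h)) (ℕₚ.m⊔n≤o⇒n≤o M N (MN≤ h′))))
      where
      M = proj₁ (S δ δ>0)
      N = proj₁ (T δ δ>0)
      KL≤ : ∀ {k} → (K ⊔ L) ⊔ (M ⊔ N) ℕ.≤ k → K ⊔ L ℕ.≤ k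
      KL≤ = ℕₚ.m⊔n≤o⇒m≤o (K ⊔ L) (M ⊔ N)
      MN≤ : ∀ {k} → (K ⊔ L) ⊔ (M ⊔ N) ℕ.≤ k → M ⊔ N ℕ.≤ k
      MN≤ = ℕₚ.m⊔n≤o⇒n≤o (K ⊔ L) (M ⊔ N)

ℝ : RawRing 0ℓ 0ℓ
ℝ = record
  { Carrier = Σ (ℕ → ℚ) Cauchy
  ; _≈_     = λ (s , _) (t , _) → TendsTo0 (λ n → s n ℚ.- t n)
  ; _+_     = λ (s , S) (t , T) → s ⟨+⟩ t , +-Cauchy s t S T
  ; _*_     = λ (s , S) (t , T) → s ⟨*⟩ t , *-Cauchy s t S T
  ; -_      = λ (s , S) → ℚ.-_ ∘ s , neg-Cauchy s S
  ; 0#      = (λ _ → 0ℚ) , const-Cauchy 0ℚ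
  ; 1#      = (λ _ → 1ℚ) , const-Cauchy 1ℚ
  }

fromℤ : ℤ → RawRing.Carrier ℝ
fromℤ z = (λ _ → z ℚ./ 1) , const-Cauchy (z ℚ./ 1)

module _ where
  open RawRing ℝ
  open RawMonoidDefs +-rawMonoid using (sum)

  ℝ^_ : ℕ → Set
  ℝ^ n = Vector Carrier n

  combination : ∀ {n k} → Vector Carrier k → Vector (ℝ^ n) k → ℝ^ n
  combination λs v j = sum (λ i → λs i * v i j)

  InSpan : ∀ {n k} → Vector (ℝ^ n) k → ℝ^ n → Set
  InSpan v u = ∃ λ λs → ∀ j → u j ≈ combination λs v j

  LinearlyIndependent : ∀ {n k} → Vector (ℝ^ n) k → Set
  LinearlyIndependent v =
    ∀ λs → (∀ j → combination λs v j ≈ 0#) → ∀ i → λs i ≈ 0#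

  SpanHasDimension : ∀ {n k} → Vector (ℝ^ n) k → ℕ → Set
  SpanHasDimension {n} v d = Σ (Vector (ℝ^ n) d) λ b →
    LinearlyIndependent b × (∀ u → InSpan v u ⇔ InSpan b u)

-- Polynomials in one variable, as lists of coefficients, constant term
-- first; trailing zeros are allowed.

module Polynomial (R : RawRing c ℓ) where
  open RawRing R

  coeff : List Carrier → ℕ → Carrier
  coeff []      _       = 0#
  coeff (a ∷ _) zero    = a
  coeff (_ ∷ f) (suc i) = coeff f i

  add : List Carrier → List Carrier → List Carrier
  add []      g       = g
  add (a ∷ f) []      = a ∷ f
  add (a ∷ f) (b ∷ g) = a + b ∷ add f g

  mul : List Carrier → List Carrier → List Carrier
  mul []      g = []
  mul (a ∷ f) g = add (map (a *_) g) (0# ∷ mul f g)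

  rawRing : RawRing c ℓ
  rawRing = record
    { Carrier = List Carrier
    ; _≈_     = λ f g → ∀ i → coeff f i ≈ coeff g i
    ; _+_     = add
    ; _*_     = mul
    ; -_      = map -_
    ; 0#      = []
    ; 1#      = 1# ∷ []
    }

  constant : Carrier → List Carrier
  constant a = a ∷ []

  variable# : List Carrier
  variable# = 0# ∷ 1# ∷ []

ℤ[x] : RawRing 0ℓ 0ℓ
ℤ[x] = Polynomial.rawRing ℤ.+-*-rawRing

-- The polynomials in y over ℤ[x].
ℤ[x,y] : RawRing 0ℓ 0ℓ
ℤ[x,y] = Polynomial.rawRing ℤ[x]

-- The coefficient of xⁱ yʲ.
coefficient : RawRing.Carrier ℤ[x,y] → ℕ → ℕ → ℤ
coefficient f i j = Polynomial.coeff ℤ.+-*-rawRing (Polynomial.coeff ℤ[x] f j) i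

module _ (G : AbelianGroup c ℓ) where
  open AbelianGroup G using (Carrier; _≈_; _∙_; ε; _⁻¹; setoid)

  data Generated (A : List Carrier) : Carrier → Set (c ⊔ˡ ℓ) where
    generator : ∀ {g} → g ∈ A → Generated A g
    identity  : Generated A ε
    product   : ∀ {g h} → Generated A g → Generated A h → Generated A (g ∙ h)
    inverse   : ∀ {g} → Generated A g → Generated A (g ⁻¹)
    respects  : ∀ {g h} → g ≈ h → Generated A g → Generated A h

  FinitelyGenerated : Set (c ⊔ˡ ℓ)
  FinitelyGenerated = ∃ λ A → ∀ g → Generated A g

  Finite : Set (c ⊔ˡ ℓ)
  Finite = ∃ λ k → Bijection (≡.setoid (Fin k)) setoid

  -- [K : H] = k, for subgroups H ⊆ K of G, given by a system of coset
  -- representatives.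
  HasIndex : (K : Carrier → Set p) (H : Carrier → Set q) → ℕ → Set (c ⊔ˡ p ⊔ˡ q)
  HasIndex K H k = Σ (Vector Carrier k) λ t →
    (∀ i → K (t i)) ×
    (∀ i j → H (t i ∙ t j ⁻¹) → i ≡ j) ×
    (∀ g → K g → ∃ λ i → H (g ∙ t i ⁻¹))

ℤ^_ : ℕ → AbelianGroup 0ℓ 0ℓ
ℤ^ n = Pointwise.abelianGroup (Fin n) ℤₚ.+-0-abelianGroup

-- Γ ≅ Λ × Γₜ with Λ = ℤⁿ and Γₜ finite; Γₜ is then the torsion subgroup.
record Splitting (Γ : AbelianGroup c ℓ) : Set (lsuc (c ⊔ˡ ℓ)) where
  field
    n             : ℕ
    Γₜ            : AbelianGroup c ℓ
    Γₜ-finite     : Finite Γₜ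
  Λ×Γₜ : AbelianGroup c ℓ
  Λ×Γₜ = DirectProduct.abelianGroup (ℤ^ n) Γₜ
  open AbelianGroup using (Carrier; rawGroup)
  field
    split         : Carrier Γ → Carrier Λ×Γₜ
    isIsomorphism : GroupMorphisms.IsGroupIsomorphism (rawGroup Γ) (rawGroup Λ×Γₜ) split

  π : Carrier Γ → Vector ℤ n
  π = proj₁ ∘ split

  -- g ↦ π(g) ⊗ 1 ∈ Λ ⊗ ℝ = ℝⁿ
  πℝ : Carrier Γ → ℝ^ n
  πℝ g = fromℤ ∘ π g

  πℝ[_] : (A : List (Carrier Γ)) → Vector (ℝ^ n) (length A)
  πℝ[ A ] i = πℝ (lookup A i)

  HasRank : List (Carrier Γ) → ℕ → Set
  HasRank A = SpanHasDimension πℝ[ A ]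

  -- The subgroup Γ_A = π⁻¹(Λ ∩ ⟨π(A)⟩_ℝ).
  Saturation : List (Carrier Γ) → Carrier Γ → Set
  Saturation A g = InSpan πℝ[ A ] (πℝ g)

  HasMultiplicity : List (Carrier Γ) → ℕ → Set (c ⊔ˡ ℓ)
  HasMultiplicity A = HasIndex Γ (Saturation A) (Generated Γ A)

-- One entry for each set of positions, so a list of length k has 2ᵏ of them.
sublists : {S : Set a} → List S → List (List S)
sublists []       = [] ∷ []
sublists (s ∷ ss) = map (s ∷_) (sublists ss) ++ sublists ss

-- The exponents are the differences r(X) - r(A) and |A| - r(A) only when
-- r A ≤ r X and r A ≤ |A|; ∸ truncates otherwise, so these inequalities have to
-- be claimed alongside anything said about this polynomial.
multiplicityTutte : {S : Set a} (r m : List S → ℕ) → List S → RawRing.Carrier ℤ[x,y]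
multiplicityTutte r m X = foldr _+_ 0# (map term (sublists X))
  where
  open RawRing ℤ[x,y]
  open RawSemiringDefs rawSemiring using (_^_) renaming (_×_ to _·_)
  x y : Carrier
  x = Polynomial.constant ℤ[x] (Polynomial.variable# ℤ.+-*-rawRing)
  y = Polynomial.variable# ℤ[x]
  term : List _ → Carrier
  term A = m A · ((x + - 1#) ^ (r X ∸ r A) * (y + - 1#) ^ (length A ∸ r A))

{-# OPTIONS --safe #-}

-- The positivity is proved by deletion and contraction, in the form of a sum
-- over the sublists of L relative to a contracted list R. An element which is
-- neither a loop nor a coloop splits the sum into the two sums obtained by
-- deleting and by contracting it. When T consists of loops and F of coloops,
-- m(R) m(R ∪ C ∪ A) = m(R ∪ A) m(R ∪ C) for C ⊆ T and A ⊆ F, and the sum is the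
-- product of two factors up to m(R). In the first, m(R ∪ A) counts the classes in
-- Γ_{R ∪ F} / ⟨R ∪ F⟩ which come from Γ_{R ∪ A}. In the second, m(R ∪ C) is
-- m(R ∪ T) times the number of characters of ⟨R ∪ T⟩ / ⟨R⟩ which vanish on C. Each
-- class contributes a power of x or 0, and a character with k zeros on T
-- contributes yᵏ.
--
-- The real rank is compared with elimination over ℤ, and Γ_A consists of the
-- elements with a positive multiple in ⟨A⟩, so that the reals disappear.

module Submission where

open import Defs
open import Algebra.Bundles using (AbelianGroup)
open import Data.Integer.Base as ℤ using (0ℤ)
open import Data.List.Base using (List; length)
open import Data.List.Relation.Binary.Sublist.Propositional using (_⊆_)
open import Data.Nat.Base using (ℕ; _≤_)
open import Data.Product.Base using (_×_)

open import Algebra.Bundles using (CommutativeRing; RawRing)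
import Algebra.Definitions.RawSemiring
open import Algebra.Morphism.Structures using (module GroupMorphisms)
open import Data.Fin.Base using (Fin; zero; suc; toℕ; fromℕ<; combine; remQuot)
import Data.Fin.Properties as Finₚ
open import Data.Integer.Base using (ℤ; 1ℤ; -1ℤ)
import Data.Integer.Properties as ℤₚ
import Data.Integer.Tactic.RingSolver as ℤ-Solver
open import Data.List.Base using ([]; _∷_; _++_; foldr; map; allFin) renaming (lookup to lookupᴸ)
open import Data.List.Membership.Propositional using (_∈_)
open import Data.List.Membership.Propositional.Properties using (∈-lookup)
open import Data.List.Properties using (length-map; length-++; ++-assoc; ++-identityʳ; map-tabulate; tabulate-lookup)
open import Data.List.Relation.Binary.Permutation.Propositional using (_↭_; prep; swap; ↭-refl; ↭-trans; ↭-sym; ↭-reflexive)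
  renaming (refl to ↭-refl′; trans to ↭-trans′)
open import Data.List.Relation.Binary.Permutation.Propositional.Properties using (shift; shifts; ++⁺ˡ; ++⁺ʳ; ↭-length)
open import Data.List.Relation.Binary.Sublist.Propositional using ([]; _∷_; _∷ʳ_; lookup; minimum; ⊆-refl)
import Data.List.Relation.Binary.Sublist.Propositional.Properties as ⊆
open import Data.List.Relation.Binary.Subset.Propositional using () renaming (_⊆_ to _⊑_)
import Data.List.Relation.Binary.Subset.Propositional.Properties as ⊑
open import Data.List.Relation.Unary.Any as Any using (here; there)
open import Data.List.Relation.Unary.Any.Properties using (lookup-index)
open import Data.Nat.Base as ℕ using (zero; suc; NonZero; _∸_; _<_; s<s)
open import Data.Nat.Divisibility
open import Data.Nat.DivMod using (_%_; _/_; m≡m%n+[m/n]*n; m%n<n)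
import Data.Nat.Properties as ℕₚ
open import Data.Nat.Solver using () renaming (module +-*-Solver to ℕ-Solver)
open import Data.Product.Base using (Σ; ∃; ∃₂; _,_; proj₁; proj₂)
open import Data.Rational.Base as ℚ using (ℚ; 0ℚ; 1ℚ)
import Data.Rational.Properties as ℚₚ
open import Data.Rational.Solver using () renaming (module +-*-Solver to ℚ-Solver)
import Data.Rational.Unnormalised.Base as ℚᵘ
import Data.Rational.Unnormalised.Properties as ℚᵘₚ
open import Data.Sum.Base using (_⊎_; inj₁; inj₂)
open import Data.Unit.Polymorphic.Base using (⊤)
open import Data.Vec.Base using (Vec; []; _∷_; zipWith; replicate)
open import Data.Vec.Functional using (Vector)
open import Function.Base using (_∘_)
open import Function.Bundles using (_⇔_; mk⇔; Equivalence)
open import Level using (Level; 0ℓ; _⊔_)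
open import Relation.Binary.PropositionalEquality as ≡ using (_≡_; _≢_; cong; cong₂; subst)
open import Relation.Nullary using (¬_; Dec; yes; no; contradiction; _×-dec_)
open import Relation.Nullary.Decidable using (map′)

-- Real numbers

-- Multiplicities are given for sublists of X only, whereas the recursion reorders lists and joins
-- them freely. It therefore runs over lists of positions in X, and such a list receives the
-- multiplicity of some sublist of X with the same members, hence with the same generated subgroup
-- and the same rank. Contraction by R never forms a quotient of Γ: the multiplicity of A in it is
-- m(R ∪ A), so contracting an element only moves it into R. The recursion must decide whether an
-- element is a loop or a coloop, while neither equality in Γ nor equality of reals is decidable
-- beforehand. Real spans of integer vectors are decided by equations over ℤ, and membership in ⟨A⟩,
-- inside Γ_A, by comparing the numbers of the coset representatives that the index supplies.
-- Duality of finite groups is not invoked: characters are counted by adjoining one generator at a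
-- time, where a generator of order k modulo the previous ones leaves exactly k choices for its
-- value.

TendsTo0-resp : ∀ {s t} → (∀ n → s n ≡ t n) → TendsTo0 s → TendsTo0 t
TendsTo0-resp s≗t s→0 ε ε>0 with s→0 ε ε>0
... | N , small = N , λ n N≤n → subst (λ q → ℚ.∣ q ∣ ℚ.< ε) (s≗t n) (small n N≤n)

TendsTo0-0 : ∀ {s} → (∀ n → s n ≡ 0ℚ) → TendsTo0 s
TendsTo0-0 s≗0 ε ε>0 = 0 , λ n _ → subst (λ q → ℚ.∣ q ∣ ℚ.< ε) (≡.sym (s≗0 n)) ε>0

TendsTo0-neg : ∀ {s} → TendsTo0 s → TendsTo0 (ℚ.-_ ∘ s)
TendsTo0-neg {s} s→0 ε ε>0 with s→0 ε ε>0
... | N , small = N , λ n N≤n →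
  subst (ℚ._< ε) (≡.sym (ℚₚ.∣-p∣≡∣p∣ (s n))) (small n N≤n)

-- A Cauchy sequence is eventually bounded by some b, so `t` only has to fall below ε / b, which
-- `shrink` provides as δ.
TendsTo0-* : ∀ s {t} → Cauchy s → TendsTo0 t → TendsTo0 (s ⟨*⟩ t)
TendsTo0-* s {t} S t→0 ε ε>0 = choose (bounded s S)
  where
  open ℚₚ.≤-Reasoning
  choose : (∃ λ b → 0ℚ ℚ.< b × ∃ λ K → ∀ n → K ℕ.≤ n → ℚ.∣ s n ∣ ℚ.< b) →
           ∃ λ N → ∀ n → N ℕ.≤ n → ℚ.∣ s n ℚ.* t n ∣ ℚ.< ε
  choose (b , b>0 , K , s<b) = scale (shrink b>0 ε>0)
    where
    scale : (∃ λ δ → 0ℚ ℚ.< δ × b ℚ.* δ ≡ ε) →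
            ∃ λ N → ∀ n → N ℕ.≤ n → ℚ.∣ s n ℚ.* t n ∣ ℚ.< ε
    scale (δ , δ>0 , bδ≡ε) = K ℕ.⊔ N , λ n K⊔N≤n → begin-strict
        ℚ.∣ s n ℚ.* t n ∣
          ≡⟨ ℚₚ.∣p*q∣≡∣p∣*∣q∣ (s n) (t n) ⟩
        ℚ.∣ s n ∣ ℚ.* ℚ.∣ t n ∣
          ≤⟨ ℚₚ.*-monoʳ-≤-nonNeg ℚ.∣ t n ∣ {{ℚ.nonNegative (ℚₚ.0≤∣p∣ (t n))}}
               (ℚₚ.<⇒≤ (s<b n (ℕₚ.m⊔n≤o⇒m≤o K N K⊔N≤n))) ⟩
        b ℚ.* ℚ.∣ t n ∣
          <⟨ ℚₚ.*-monoʳ-<-pos b {{ℚ.positive b>0}}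
               (proj₂ (t→0 δ δ>0) n (ℕₚ.m⊔n≤o⇒n≤o K N K⊔N≤n)) ⟩
        b ℚ.* δ
          ≡⟨ bδ≡ε ⟩
        ε ∎
      where N = proj₁ (t→0 δ δ>0)

TendsTo0-+ : ∀ {s t} → TendsTo0 s → TendsTo0 t → TendsTo0 (s ⟨+⟩ t)
TendsTo0-+ {s} {t} s→0 t→0 ε ε>0 = M ℕ.⊔ N , λ n M⊔N≤n → begin-strict
    ℚ.∣ s n ℚ.+ t n ∣            ≤⟨ ℚₚ.∣p+q∣≤∣p∣+∣q∣ (s n) (t n) ⟩
    ℚ.∣ s n ∣ ℚ.+ ℚ.∣ t n ∣      <⟨ ℚₚ.+-mono-< (proj₂ (s→0 δ δ>0) n (ℕₚ.m⊔n≤o⇒m≤o M N M⊔N≤n))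
                                                 (proj₂ (t→0 δ δ>0) n (ℕₚ.m⊔n≤o⇒n≤o M N M⊔N≤n)) ⟩
    δ ℚ.+ δ                      ≡⟨ ℚₚ.*-distribʳ-+ ε ℚ.½ ℚ.½ ⟨
    1ℚ ℚ.* ε                     ≡⟨ ℚₚ.*-identityˡ ε ⟩
    ε                            ∎
  where
  open ℚₚ.≤-Reasoning
  δ = ℚ.½ ℚ.* ε
  δ>0 : 0ℚ ℚ.< δ
  δ>0 = subst (ℚ._< δ) (ℚₚ.*-zeroʳ ℚ.½) (ℚₚ.*-monoʳ-<-pos ℚ.½ ε>0)
  M = proj₁ (s→0 δ δ>0)
  N = proj₁ (t→0 δ δ>0)

-- Equality of reals is convergence of a difference of sequences, so each law becomes a rational
-- identity at every index; transitivity and the congruences also combine convergent differences.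
ℝ-commutativeRing : CommutativeRing 0ℓ 0ℓ
ℝ-commutativeRing = record
  { RawRing ℝ
  ; isCommutativeRing = record
    { isRing = record
      { +-isAbelianGroup = record
        { isGroup = record
          { isMonoid = record
            { isSemigroup = record
              { isMagma = record
                { isEquivalence = record
                  { refl  = λ {(s , _)} → TendsTo0-0 λ n → ℚₚ.+-inverseʳ (s n)
                  ; sym   = λ {(s , _)} {(t , _)} s≈t → TendsTo0-resp
                      (λ n → solve 2 (λ x y → :- (x :- y) := y :- x) ≡.refl (s n) (t n))
                      (TendsTo0-neg s≈t)
                  ; trans = λ {(s , _)} {(t , _)} {(u , _)} s≈t t≈u → TendsTo0-resp
                      (λ n → solve 3 (λ x y z → (x :- y) :+ (y :- z) := x :- z) ≡.refl (s n) (t n) (u n))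
                      (TendsTo0-+ s≈t t≈u)
                  }
                ; ∙-cong = λ {(s , _)} {(t , _)} {(u , _)} {(v , _)} s≈t u≈v → TendsTo0-resp
                    (λ n → solve 4 (λ x y z w → (x :- y) :+ (z :- w) := (x :+ z) :- (y :+ w)) ≡.refl
                             (s n) (t n) (u n) (v n))
                    (TendsTo0-+ s≈t u≈v)
                }
              ; assoc = λ (s , _) (t , _) (u , _) → TendsTo0-0 λ n →
                  solve 3 (λ x y z → (x :+ y) :+ z :- (x :+ (y :+ z)) := con 0ℚ) ≡.refl (s n) (t n) (u n)
              }
            ; identity = (λ (s , _) → TendsTo0-0 λ n →
                            solve 1 (λ x → con 0ℚ :+ x :- x := con 0ℚ) ≡.refl (s n))
                       , (λ (s , _) → TendsTo0-0 λ n →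
                            solve 1 (λ x → x :+ con 0ℚ :- x := con 0ℚ) ≡.refl (s n))
            }
          ; inverse = (λ (s , _) → TendsTo0-0 λ n →
                         solve 1 (λ x → :- x :+ x :- con 0ℚ := con 0ℚ) ≡.refl (s n))
                    , (λ (s , _) → TendsTo0-0 λ n →
                         solve 1 (λ x → x :+ :- x :- con 0ℚ := con 0ℚ) ≡.refl (s n))
          ; ⁻¹-cong = λ {(s , _)} {(t , _)} s≈t → TendsTo0-resp
              (λ n → solve 2 (λ x y → :- (x :- y) := :- x :- (:- y)) ≡.refl (s n) (t n))
              (TendsTo0-neg s≈t)
          }
        ; comm = λ (s , _) (t , _) → TendsTo0-0 λ n →
            solve 2 (λ x y → x :+ y :- (y :+ x) := con 0ℚ) ≡.refl (s n) (t n)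
        }
      ; *-cong = λ {(s , S)} {(t , T)} {(u , U)} {(v , V)} s≈t u≈v → TendsTo0-resp
          (λ n → solve 4 (λ x y z w → x :* (z :- w) :+ w :* (x :- y) := x :* z :- y :* w) ≡.refl
                   (s n) (t n) (u n) (v n))
          (TendsTo0-+ (TendsTo0-* s S u≈v) (TendsTo0-* v V s≈t))
      ; *-assoc = λ (s , _) (t , _) (u , _) → TendsTo0-0 λ n →
          solve 3 (λ x y z → (x :* y) :* z :- (x :* (y :* z)) := con 0ℚ) ≡.refl (s n) (t n) (u n)
      ; *-identity = (λ (s , _) → TendsTo0-0 λ n →
                        solve 1 (λ x → con 1ℚ :* x :- x := con 0ℚ) ≡.refl (s n))
                   , (λ (s , _) → TendsTo0-0 λ n →
                        solve 1 (λ x → x :* con 1ℚ :- x := con 0ℚ) ≡.refl (s n))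
      ; distrib = (λ (s , _) (t , _) (u , _) → TendsTo0-0 λ n →
                     solve 3 (λ x y z → x :* (y :+ z) :- (x :* y :+ x :* z) := con 0ℚ) ≡.refl
                       (s n) (t n) (u n))
                , (λ (s , _) (t , _) (u , _) → TendsTo0-0 λ n →
                     solve 3 (λ x y z → (y :+ z) :* x :- (y :* x :+ z :* x) := con 0ℚ) ≡.refl
                       (s n) (t n) (u n))
      }
    ; *-comm = λ (s , _) (t , _) → TendsTo0-0 λ n →
        solve 2 (λ x y → x :* y :- (y :* x) := con 0ℚ) ≡.refl (s n) (t n)
    }
  }
  where open ℚ-Solver

private module ℝ = CommutativeRing ℝ-commutativeRing

/1-+ : ∀ y z → (y ℤ.+ z) ℚ./ 1 ≡ y ℚ./ 1 ℚ.+ z ℚ./ 1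
/1-+ y z = ℚₚ.toℚᵘ-injective (begin
  ℚ.toℚᵘ ((y ℤ.+ z) ℚ./ 1)                   ≈⟨ ℚₚ.toℚᵘ-fromℚᵘ (ℚᵘ.mkℚᵘ (y ℤ.+ z) 0) ⟩
  ℚᵘ.mkℚᵘ (y ℤ.+ z) 0                        ≈⟨ ℚᵘ.*≡* (cong₂ (λ a b → (a ℤ.+ b) ℤ.* ℤ.1ℤ) (≡.sym (ℤₚ.*-identityʳ y)) (≡.sym (ℤₚ.*-identityʳ z))) ⟩
  ℚᵘ.mkℚᵘ y 0 ℚᵘ.+ ℚᵘ.mkℚᵘ z 0               ≈⟨ ℚᵘₚ.+-cong (ℚₚ.toℚᵘ-fromℚᵘ (ℚᵘ.mkℚᵘ y 0)) (ℚₚ.toℚᵘ-fromℚᵘ (ℚᵘ.mkℚᵘ z 0)) ⟨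
  ℚ.toℚᵘ (y ℚ./ 1) ℚᵘ.+ ℚ.toℚᵘ (z ℚ./ 1)     ≈⟨ ℚₚ.toℚᵘ-homo-+ (y ℚ./ 1) (z ℚ./ 1) ⟨
  ℚ.toℚᵘ (y ℚ./ 1 ℚ.+ z ℚ./ 1)               ∎)
  where open import Relation.Binary.Reasoning.Setoid ℚᵘₚ.≃-setoid

/1-* : ∀ y z → (y ℤ.* z) ℚ./ 1 ≡ (y ℚ./ 1) ℚ.* (z ℚ./ 1)
/1-* y z = ℚₚ.toℚᵘ-injective (begin
  ℚ.toℚᵘ ((y ℤ.* z) ℚ./ 1)                   ≈⟨ ℚₚ.toℚᵘ-fromℚᵘ (ℚᵘ.mkℚᵘ (y ℤ.* z) 0) ⟩
  ℚᵘ.mkℚᵘ y 0 ℚᵘ.* ℚᵘ.mkℚᵘ z 0               ≈⟨ ℚᵘₚ.*-cong (ℚₚ.toℚᵘ-fromℚᵘ (ℚᵘ.mkℚᵘ y 0)) (ℚₚ.toℚᵘ-fromℚᵘ (ℚᵘ.mkℚᵘ z 0)) ⟨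
  ℚ.toℚᵘ (y ℚ./ 1) ℚᵘ.* ℚ.toℚᵘ (z ℚ./ 1)     ≈⟨ ℚₚ.toℚᵘ-homo-* (y ℚ./ 1) (z ℚ./ 1) ⟨
  ℚ.toℚᵘ ((y ℚ./ 1) ℚ.* (z ℚ./ 1))               ∎)
  where open import Relation.Binary.Reasoning.Setoid ℚᵘₚ.≃-setoid

/1-injective : ∀ {y z} → y ℚ./ 1 ≡ z ℚ./ 1 → y ≡ z
/1-injective {y} {z} eq = from (ℚₚ.fromℚᵘ-injective {ℚᵘ.mkℚᵘ y 0} {ℚᵘ.mkℚᵘ z 0} eq)
  where
  from : ℚᵘ.mkℚᵘ y 0 ℚᵘ.≃ ℚᵘ.mkℚᵘ z 0 → y ≡ z
  from (ℚᵘ.*≡* y*1≡z*1) = ℤₚ.*-cancelʳ-≡ y z ℤ.1ℤ y*1≡z*1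

p≡q⇒p-q≡0 : ∀ {p q} → p ≡ q → p ℚ.- q ≡ 0ℚ
p≡q⇒p-q≡0 {p} ≡.refl = ℚₚ.+-inverseʳ p

fromℤ-+ : ∀ y z → fromℤ (y ℤ.+ z) ℝ.≈ fromℤ y ℝ.+ fromℤ z
fromℤ-+ y z = TendsTo0-0 λ _ → p≡q⇒p-q≡0 (/1-+ y z)

fromℤ-* : ∀ y z → fromℤ (y ℤ.* z) ℝ.≈ fromℤ y ℝ.* fromℤ z
fromℤ-* y z = TendsTo0-0 λ _ → p≡q⇒p-q≡0 (/1-* y z)

-- Equality of rationals is decidable, and a nonzero q violates the definition at ε = |q|. Hence
-- equalities of integers that hold in ℝ descend to ℤ.
const-TendsTo0 : ∀ {q} → TendsTo0 (λ _ → q) → q ≡ 0ℚ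
const-TendsTo0 {q} q→0 with q ℚₚ.≟ 0ℚ
... | yes q≡0 = q≡0
... | no  q≢0 with q→0 ℚ.∣ q ∣ (ℚₚ.≰⇒> λ ∣q∣≤0 → q≢0 (ℚₚ.∣p∣≡0⇒p≡0 q (ℚₚ.≤-antisym ∣q∣≤0 (ℚₚ.0≤∣p∣ q))))
...   | N , small = contradiction (small N ℕₚ.≤-refl) (ℚₚ.<-irrefl ≡.refl)

fromℤ-injective : ∀ {y z} → fromℤ y ℝ.≈ fromℤ z → y ≡ z
fromℤ-injective {y} {z} y≈z =
  /1-injective (ℚ-Group.x∙y⁻¹≈ε⇒x≈y (y ℚ./ 1) (z ℚ./ 1) (const-TendsTo0 y≈z))
  where import Algebra.Properties.Group ℚₚ.+-0-group as ℚ-Group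

-- A real number cannot be tested for being 0, so inverses are provided for nonzero integers only,
-- as constant sequences. Nothing else will be inverted.
fromℤ-invertible : ∀ {z} → ¬ z ≡ 0ℤ → ∃ λ r → r ℝ.* fromℤ z ℝ.≈ ℝ.1#
fromℤ-invertible {z} z≢0 = ((λ _ → q⁻¹) , const-Cauchy q⁻¹) ,
  TendsTo0-0 λ _ → cong (ℚ._- 1ℚ) (ℚₚ.*-inverseˡ (z ℚ./ 1) {{z/1≢0}})
  where
  z/1≢0 : ℚ.NonZero (z ℚ./ 1)
  z/1≢0 = ℚ.≢-nonZero (z≢0 ∘ /1-injective)
  q⁻¹ = ℚ.1/_ (z ℚ./ 1) {{z/1≢0}}

-- Linear algebra

-- The ring is a parameter because elimination runs over ℤ while ranks and saturations are defined
-- over ℝ.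
module Combinations {c ℓ} (R : CommutativeRing c ℓ) where
  open CommutativeRing R hiding (zero)
  open import Algebra.Properties.Semiring.Sum semiring
  import Algebra.Properties.AbelianGroup +-abelianGroup as +-Group
  open import Relation.Binary.Reasoning.Setoid setoid

  δ : ∀ {n} → Fin n → Fin n → Carrier
  δ zero    zero    = 1#
  δ zero    (suc _) = 0#
  δ (suc _) zero    = 0#
  δ (suc i) (suc j) = δ i j

  lincomb : ∀ {n k} → Vector Carrier k → Vector (Vector Carrier n) k → Vector Carrier n
  lincomb λs v j = sum (λ i → λs i * v i j)

  lincomb-congˡ : ∀ {n k} {λs μs : Vector Carrier k} (v : Vector (Vector Carrier n) k) j →
    (∀ i → λs i ≈ μs i) → lincomb λs v j ≈ lincomb μs v j
  lincomb-congˡ v j λ≈μ = sum-cong-≋ λ i → *-congʳ (λ≈μ i)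

  lincomb-congʳ : ∀ {n k} (λs : Vector Carrier k) (v w : Vector (Vector Carrier n) k) j →
    (∀ i → v i j ≈ w i j) → lincomb λs v j ≈ lincomb λs w j
  lincomb-congʳ λs v w j v≈w = sum-cong-≋ λ i → *-congˡ (v≈w i)

  lincomb-+ : ∀ {n k} (λs μs : Vector Carrier k) (v : Vector (Vector Carrier n) k) j →
    lincomb (λ i → λs i + μs i) v j ≈ lincomb λs v j + lincomb μs v j
  lincomb-+ λs μs v j = trans (sum-cong-≋ λ i → distribʳ (v i j) (λs i) (μs i))
      (∑-distrib-+ (λ i → λs i * v i j) (λ i → μs i * v i j))

  lincomb-* : ∀ {n k} a (λs : Vector Carrier k) (v : Vector (Vector Carrier n) k) j →
    lincomb (λ i → a * λs i) v j ≈ a * lincomb λs v j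
  lincomb-* a λs v j =
    trans (sum-cong-≋ λ i → *-assoc a (λs i) (v i j)) (sym (*-distribˡ-sum a (λ i → λs i * v i j)))

  lincomb-0 : ∀ {n k} (v : Vector (Vector Carrier n) k) j → lincomb (λ _ → 0#) v j ≈ 0#
  lincomb-0 {k = k} v j = trans (sum-cong-≋ λ i → zeroˡ (v i j)) (sum-replicate-zero k)

  lincomb-neg : ∀ {n k} (λs : Vector Carrier k) (v : Vector (Vector Carrier n) k) j →
    lincomb (λ i → - λs i) v j ≈ - lincomb λs v j
  lincomb-neg λs v j = +-Group.inverseʳ-unique _ _ (begin
    lincomb λs v j + lincomb (λ i → - λs i) v j  ≈⟨ lincomb-+ λs (-_ ∘ λs) v j ⟨
    lincomb (λ i → λs i + - λs i) v j                ≈⟨ lincomb-congˡ v j (λ i → -‿inverseʳ (λs i)) ⟩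
    lincomb (λ _ → 0#) v j                           ≈⟨ lincomb-0 v j ⟩
    0#                                                   ∎)

  lincomb-δ : ∀ {n k} i (v : Vector (Vector Carrier n) k) j → lincomb (δ i) v j ≈ v i j
  lincomb-δ zero    v j = begin
    1# * v zero j + lincomb (λ _ → 0#) (v ∘ suc) j  ≈⟨ +-cong (*-identityˡ _) (lincomb-0 (v ∘ suc) j) ⟩
    v zero j + 0#                                       ≈⟨ +-identityʳ _ ⟩
    v zero j                                            ∎
  lincomb-δ (suc i) v j = begin
    0# * v zero j + lincomb (δ i) (v ∘ suc) j  ≈⟨ +-cong (zeroˡ _) (lincomb-δ i (v ∘ suc) j) ⟩
    0# + v (suc i) j                               ≈⟨ +-identityˡ _ ⟩
    v (suc i) j                                    ∎

  -- Associativity of the matrix product, with `λs` as a row.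
  lincomb-lincomb : ∀ {n k l} (λs : Vector Carrier k) (M : Vector (Vector Carrier l) k)
    (w : Vector (Vector Carrier n) l) j →
    lincomb λs (λ i → lincomb (M i) w) j ≈ lincomb (lincomb λs M) w j
  lincomb-lincomb λs M w j = begin
    sum (λ i → λs i * sum (λ k → M i k * w k j))    ≈⟨ sum-cong-≋ (λ i → *-distribˡ-sum (λs i) (λ k → M i k * w k j)) ⟩
    sum (λ i → sum (λ k → λs i * (M i k * w k j)))  ≈⟨ ∑-comm (λ i k → λs i * (M i k * w k j)) ⟩
    sum (λ k → sum (λ i → λs i * (M i k * w k j)))  ≈⟨ sum-cong-≋ (λ k → sum-cong-≋ λ i → *-assoc (λs i) (M i k) (w k j)) ⟨
    sum (λ k → sum (λ i → λs i * M i k * w k j))    ≈⟨ sum-cong-≋ (λ k → *-distribʳ-sum (w k j) (λ i → λs i * M i k)) ⟨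
    sum (λ k → sum (λ i → λs i * M i k) * w k j)    ∎

  record Spanned {n k} (v : Vector (Vector Carrier n) k) (u : Vector Carrier n) : Set (c ⊔ ℓ) where
    constructor _,_
    field
      coefficients : Vector Carrier k
      expansion    : ∀ j → u j ≈ lincomb coefficients v j
  open Spanned public

  Free : ∀ {n k} → Vector (Vector Carrier n) k → Set (c ⊔ ℓ)
  Free v = ∀ λs → (∀ j → lincomb λs v j ≈ 0#) → ∀ i → λs i ≈ 0#

  record HasDimension {n k} (v : Vector (Vector Carrier n) k) (d : ℕ) : Set (c ⊔ ℓ) where
    field
      basis       : Vector (Vector Carrier n) d
      independent : Free basis
      spans       : ∀ u → Spanned v u ⇔ Spanned basis u

  module _ {n k} {v : Vector (Vector Carrier n) k} where

    span-resp : ∀ {u u′} → (∀ j → u j ≈ u′ j) → Spanned v u → Spanned v u′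
    span-resp u≈u′ (λs , u≈) = λs , λ j → trans (sym (u≈u′ j)) (u≈ j)

    span-member : ∀ i → Spanned v (v i)
    span-member i = δ i , λ j → sym (lincomb-δ i v j)

    span-0 : Spanned v (λ _ → 0#)
    span-0 = (λ _ → 0#) , λ j → sym (lincomb-0 v j)

    span-+ : ∀ {u u′} → Spanned v u → Spanned v u′ → Spanned v (λ j → u j + u′ j)
    span-+ (λs , u≈) (μs , u′≈) = (λ i → λs i + μs i) , λ j →
      trans (+-cong (u≈ j) (u′≈ j)) (sym (lincomb-+ λs μs v j))

    span-neg : ∀ {u} → Spanned v u → Spanned v (λ j → - u j)
    span-neg (λs , u≈) = (-_ ∘ λs) , λ j →
      trans (-‿cong (u≈ j)) (sym (lincomb-neg λs v j))

    span-* : ∀ a {u} → Spanned v u → Spanned v (λ j → a * u j)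
    span-* a (λs , u≈) = (λ i → a * λs i) , λ j →
      trans (*-congˡ (u≈ j)) (sym (lincomb-* a λs v j))

    span-trans : ∀ {l} {w : Vector (Vector Carrier n) l} → (∀ i → Spanned w (v i)) →
      ∀ {u} → Spanned v u → Spanned w u
    span-trans {w = w} v∈w (λs , u≈) = lincomb λs (coefficients ∘ v∈w) , λ j →
      trans (u≈ j) (trans (lincomb-congʳ λs v (λ i → lincomb (coefficients (v∈w i)) w) j λ i → expansion (v∈w i) j)
        (lincomb-lincomb λs (coefficients ∘ v∈w) w j))

  independent-unique : ∀ {n k} {v : Vector (Vector Carrier n) k} → Free v →
    ∀ λs μs → (∀ j → lincomb λs v j ≈ lincomb μs v j) → ∀ i → λs i ≈ μs i
  independent-unique {v = v} indep λs μs λv≈μv i =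
    +-Group.x∙y⁻¹≈ε⇒x≈y (λs i) (μs i) (indep (λ i → λs i - μs i) (λ j → begin
      lincomb (λ i → λs i - μs i) v j                   ≈⟨ lincomb-+ λs (-_ ∘ μs) v j ⟩
      lincomb λs v j + lincomb (-_ ∘ μs) v j        ≈⟨ +-congˡ (lincomb-neg μs v j) ⟩
      lincomb λs v j - lincomb μs v j               ≈⟨ +-Group.x≈y⇒x∙y⁻¹≈ε (λv≈μv j) ⟩
      0#                                                    ∎) i)

  -- The i-th row of PQ and the unit row `δ i` are both coefficients of `b i` over the independent
  -- family b.
  transition-inverse : ∀ {n k l} {b : Vector (Vector Carrier n) k} {b′ : Vector (Vector Carrier n) l} →
    Free b →
    (b∈b′ : ∀ i → Spanned b′ (b i)) (b′∈b : ∀ i → Spanned b (b′ i)) →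
    ∀ i k → lincomb (coefficients (b∈b′ i)) (coefficients ∘ b′∈b) k ≈ δ i k
  transition-inverse {b = b} {b′} indep b∈b′ b′∈b i =
    independent-unique indep (lincomb (P i) Q) (δ i) λ j → begin
      lincomb (lincomb (P i) Q) b j          ≈⟨ lincomb-lincomb (P i) Q b j ⟨
      lincomb (P i) (λ k → lincomb (Q k) b) j ≈⟨ lincomb-congʳ (P i) b′ (λ k → lincomb (Q k) b) j (λ k → expansion (b′∈b k) j) ⟨
      lincomb (P i) b′ j                         ≈⟨ expansion (b∈b′ i) j ⟨
      b i j                                          ≈⟨ lincomb-δ i b j ⟨
      lincomb (δ i) b j                          ∎
    where
    P = coefficients ∘ b∈b′
    Q = coefficients ∘ b′∈b

  δ-diagonal : ∀ {n} (i : Fin n) → δ i i ≈ 1#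
  δ-diagonal zero    = refl
  δ-diagonal (suc i) = δ-diagonal i

  -- With transition matrices P and Q, both PQ and QP are identities, and
  -- tr PQ = tr QP. No coefficient has to be inverted or compared with 0.
  basis-size : ∀ {n k l} {b : Vector (Vector Carrier n) k} {b′ : Vector (Vector Carrier n) l} →
    Free b → Free b′ →
    (∀ i → Spanned b′ (b i)) → (∀ i → Spanned b (b′ i)) →
    sum {k} (λ _ → 1#) ≈ sum {l} (λ _ → 1#)
  basis-size {k = k} {l} indep indep′ b∈b′ b′∈b = begin
    sum {k} (λ _ → 1#)                       ≈⟨ sum-cong-≋ {k} (λ i → trans (transition-inverse indep b∈b′ b′∈b i i) (δ-diagonal i)) ⟨
    sum (λ i → sum (λ m → P i m * Q m i))    ≈⟨ ∑-comm (λ i m → P i m * Q m i) ⟩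
    sum (λ m → sum (λ i → P i m * Q m i))    ≈⟨ sum-cong-≋ (λ m → sum-cong-≋ λ i → *-comm (P i m) (Q m i)) ⟩
    sum (λ m → sum (λ i → Q m i * P i m))    ≈⟨ sum-cong-≋ {l} (λ m → trans (transition-inverse indep′ b′∈b b∈b′ m m) (δ-diagonal m)) ⟩
    sum {l} (λ _ → 1#)                       ∎
    where
    P = coefficients ∘ b∈b′
    Q = coefficients ∘ b′∈b

-- Elimination over ℤ without fractions

module ℤ-Combinations = Combinations ℤₚ.+-*-commutativeRing
open ℤ-Combinations using () renaming (δ to δℤ; lincomb to lincombℤ)

module _ where
  open import Algebra.Properties.Semiring.Sum ℤₚ.+-*-semiring
  open ℤ-Combinations

  infix 8 _•_
  _•_ : ∀ {n} → Vector ℤ n → Vector ℤ n → ℤ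
  φ • x = sum (λ l → φ l ℤ.* x l)

  •-unit : ∀ {n} (j : Fin n) x → δ j • x ≡ x j
  -- A vector is read as a family of vectors of length 1, so that the dot product is an instance of
  -- `lincomb`.
  •-unit j x = lincomb-δ j (λ l (_ : Fin 1) → x l) zero

  •-linear : ∀ {n} a (φ : Vector ℤ n) b ψ x →
    (λ l → a ℤ.* φ l ℤ.- b ℤ.* ψ l) • x ≡ a ℤ.* (φ • x) ℤ.- b ℤ.* (ψ • x)
  •-linear a φ b ψ x = ≡.trans (sum-cong-≋ (λ l → expand a (φ l) b (ψ l) (x l)))
    (≡.trans (∑-distrib-+ (λ l → a ℤ.* (φ l ℤ.* x l)) (λ l → ℤ.- b ℤ.* (ψ l ℤ.* x l)))
    (cong₂ ℤ._+_ (≡.sym (*-distribˡ-sum a (λ l → φ l ℤ.* x l)))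
      (≡.trans (≡.sym (*-distribˡ-sum (ℤ.- b) (λ l → ψ l ℤ.* x l))) (≡.sym (ℤₚ.neg-distribˡ-* b (ψ • x))))))
    where
    expand : ∀ a p b q y → (a ℤ.* p ℤ.- b ℤ.* q) ℤ.* y ≡ a ℤ.* (p ℤ.* y) ℤ.+ ℤ.- b ℤ.* (q ℤ.* y)
    expand = ℤ-Solver.solve-∀

  lincomb-• : ∀ {n k} (cs : Vector ℤ k) (φ : Vector (Vector ℤ n) k) x →
    lincomb cs φ • x ≡ sum (λ i → cs i ℤ.* (φ i • x))
  lincomb-• cs φ x = ≡.sym (lincomb-lincomb cs φ (λ l (_ : Fin 1) → x l) zero)

-- A maximal independent subfamily b of v with a dual family: the φᵢ are linear
-- forms with φᵢ(bⱼ) = D δᵢⱼ, so that D x = Σᵢ φᵢ(x) bᵢ for all x in the span.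
record Frame {n k} (v : Vector (Vector ℤ n) k) : Set where
  field
    dim    : ℕ
    b      : Vector (Vector ℤ n) dim
    φ      : Vector (Vector ℤ n) dim
    D      : ℤ
    D≢0    : D ≢ 0ℤ
    dual   : ∀ i j → φ i • b j ≡ D ℤ.* δℤ i j
    b∈v    : ∀ i → ∃ λ l → b i ≡ v l
  Expands : Vector ℤ n → Set
  Expands x = ∀ j → D ℤ.* x j ≡ lincombℤ (λ i → φ i • x) b j
  field
    expand : ∀ l → Expands (v l)

-- If the defect of `v zero` has a nonzero entry w at j, the form ψ that reads this entry vanishes
-- on the old b and takes the value w at `v zero`. So `v zero` can be added to b, at the price of
-- the denominator D w.
module Extend {n k} {v : Vector (Vector ℤ n) (suc k)} (F : Frame (v ∘ suc)) where
  open Frame F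
  open ℤ-Combinations
  open import Algebra.Properties.Semiring.Sum ℤₚ.+-*-semiring
  open ≡.≡-Reasoning

  expands? : ∀ x → Dec (Expands x)
  expands? x = Finₚ.all? λ j → D ℤ.* x j ℤₚ.≟ lincomb (λ i → φ i • x) b j

  dependent : Expands (v zero) → Frame v
  dependent v₀-expands = record
    { dim = dim; b = b; φ = φ; D = D; D≢0 = D≢0; dual = dual
    ; b∈v = λ i → suc (proj₁ (b∈v i)) , proj₂ (b∈v i)
    ; expand = λ { zero → v₀-expands ; (suc l) → expand l }
    }

  module _ (j : Fin n) where

    w : ℤ
    w = D ℤ.* v zero j ℤ.- lincomb (λ i → φ i • v zero) b j

    -- ψ(x) is the j-th entry of the defect D x - Σᵢ φᵢ(x) bᵢ.
    ψ : Vector ℤ n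
    ψ l = D ℤ.* δ j l ℤ.- 1ℤ ℤ.* lincomb (λ i → b i j) φ l

    ψ• : ∀ x → ψ • x ≡ D ℤ.* x j ℤ.- lincomb (λ i → φ i • x) b j
    ψ• x = begin
      ψ • x
        ≡⟨ •-linear D (δ j) 1ℤ (lincomb (λ i → b i j) φ) x ⟩
      D ℤ.* (δ j • x) ℤ.- 1ℤ ℤ.* (lincomb (λ i → b i j) φ • x)
        ≡⟨ cong₂ (λ p q → D ℤ.* p ℤ.- q) (•-unit j x) (ℤₚ.*-identityˡ _) ⟩
      D ℤ.* x j ℤ.- lincomb (λ i → b i j) φ • x
        ≡⟨ cong (λ q → D ℤ.* x j ℤ.- q) (lincomb-• (λ i → b i j) φ x) ⟩
      D ℤ.* x j ℤ.- sum (λ i → b i j ℤ.* (φ i • x))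
        ≡⟨ cong (λ q → D ℤ.* x j ℤ.- q) (sum-cong-≋ (λ i → ℤₚ.*-comm (b i j) (φ i • x))) ⟩
      D ℤ.* x j ℤ.- lincomb (λ i → φ i • x) b j ∎

    ψ•-expands : ∀ {x} → Expands x → ψ • x ≡ 0ℤ
    ψ•-expands {x} x-expands = ≡.trans (ψ• x) (ℤₚ.i≡j⇒i-j≡0 (x-expands j))

    ψ•b : ∀ i → ψ • b i ≡ 0ℤ
    ψ•b i with b∈v i
    ... | l , bᵢ≡vₗ = ≡.trans (cong (ψ •_) bᵢ≡vₗ) (ψ•-expands (expand l))

    -- The multiples by D and w bring all diagonal values to D w, and the multiple of ψ removes the
    -- value of φᵢ at `v zero`. The vanishing term gives the first form the shape required by
    -- `•-linear`.
    b′ φ′ : Vector (Vector ℤ n) (suc dim)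
    b′ zero    = v zero
    b′ (suc i) = b i
    φ′ zero    l = D ℤ.* ψ l ℤ.- 0ℤ ℤ.* ψ l
    φ′ (suc i) l = w ℤ.* φ i l ℤ.- (φ i • v zero) ℤ.* ψ l

    φ′₀• : ∀ x → φ′ zero • x ≡ D ℤ.* (ψ • x)
    φ′₀• x = ≡.trans (•-linear D ψ 0ℤ ψ x) (ℤₚ.+-identityʳ _)

    φ′ₛ• : ∀ i x → φ′ (suc i) • x ≡ w ℤ.* (φ i • x) ℤ.- (φ i • v zero) ℤ.* (ψ • x)
    φ′ₛ• i x = •-linear w (φ i) (φ i • v zero) ψ x

    kill : ∀ a b → a ℤ.- b ℤ.* 0ℤ ≡ a
    kill a b = ≡.trans (cong (λ z → a ℤ.- z) (ℤₚ.*-zeroʳ b)) (ℤₚ.+-identityʳ a)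

    dual′ : ∀ i l → φ′ i • b′ l ≡ D ℤ.* w ℤ.* δ i l
    dual′ zero    zero    = ≡.trans (φ′₀• (v zero))
      (≡.trans (cong (D ℤ.*_) (ψ• (v zero))) (≡.sym (ℤₚ.*-identityʳ _)))
    dual′ zero    (suc l) = ≡.trans (φ′₀• (b l)) (≡.trans (cong (D ℤ.*_) (ψ•b l))
      (≡.trans (ℤₚ.*-zeroʳ D) (≡.sym (ℤₚ.*-zeroʳ (D ℤ.* w)))))
    dual′ (suc i) zero    = begin
      φ′ (suc i) • v zero                                        ≡⟨ φ′ₛ• i (v zero) ⟩
      w ℤ.* (φ i • v zero) ℤ.- (φ i • v zero) ℤ.* (ψ • v zero)   ≡⟨ cong (λ q → w ℤ.* (φ i • v zero) ℤ.- (φ i • v zero) ℤ.* q) (ψ• (v zero)) ⟩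
      w ℤ.* (φ i • v zero) ℤ.- (φ i • v zero) ℤ.* w              ≡⟨ ℤₚ.i≡j⇒i-j≡0 (ℤₚ.*-comm w (φ i • v zero)) ⟩
      0ℤ                                                         ≡⟨ ℤₚ.*-zeroʳ (D ℤ.* w) ⟨
      D ℤ.* w ℤ.* 0ℤ                                             ∎
    dual′ (suc i) (suc l) = begin
      φ′ (suc i) • b l                                        ≡⟨ φ′ₛ• i (b l) ⟩
      w ℤ.* (φ i • b l) ℤ.- (φ i • v zero) ℤ.* (ψ • b l)      ≡⟨ cong₂ (λ p q → w ℤ.* p ℤ.- (φ i • v zero) ℤ.* q) (dual i l) (ψ•b l) ⟩
      w ℤ.* (D ℤ.* δ i l) ℤ.- (φ i • v zero) ℤ.* 0ℤ           ≡⟨ kill _ (φ i • v zero) ⟩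
      w ℤ.* (D ℤ.* δ i l)                                     ≡⟨ rearrange w D (δ i l) ⟩
      D ℤ.* w ℤ.* δ i l                                       ∎
      where
      rearrange : ∀ x y z → x ℤ.* (y ℤ.* z) ≡ y ℤ.* x ℤ.* z
      rearrange = ℤ-Solver.solve-∀

    -- `v zero` is itself the first member of b′, so its expansion is a column of `dual′`; on the
    -- other vectors ψ vanishes, and the old expansion is multiplied by w.
    expand′ : ∀ l j′ → D ℤ.* w ℤ.* v l j′ ≡ lincomb (λ i → φ′ i • v l) b′ j′
    expand′ zero j′ = begin
      D ℤ.* w ℤ.* v zero j′
        ≡⟨ ℤₚ.+-identityʳ _ ⟨
      D ℤ.* w ℤ.* v zero j′ ℤ.+ 0ℤ
        ≡⟨ cong₂ (λ p q → p ℤ.* v zero j′ ℤ.+ q)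
             (≡.trans (dual′ zero zero) (ℤₚ.*-identityʳ (D ℤ.* w)))
             (≡.trans (lincomb-congˡ b j′ (λ i → ≡.trans (dual′ (suc i) zero) (ℤₚ.*-zeroʳ (D ℤ.* w)))) (lincomb-0 b j′)) ⟨
      lincomb (λ i → φ′ i • v zero) b′ j′ ∎
    expand′ (suc l) j′ = begin
      D ℤ.* w ℤ.* v (suc l) j′
        ≡⟨ rearrange D w (v (suc l) j′) ⟩
      w ℤ.* (D ℤ.* v (suc l) j′)
        ≡⟨ cong (w ℤ.*_) (expand l j′) ⟩
      w ℤ.* lincomb (λ i → φ i • v (suc l)) b j′
        ≡⟨ lincomb-* w (λ i → φ i • v (suc l)) b j′ ⟨
      lincomb (λ i → w ℤ.* (φ i • v (suc l))) b j′
        ≡⟨ lincomb-congˡ b j′ (λ i → ≡.trans (φ′ₛ• i (v (suc l)))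
             (≡.trans (cong (λ q → w ℤ.* (φ i • v (suc l)) ℤ.- (φ i • v zero) ℤ.* q) (ψ•-expands (expand l)))
                      (kill (w ℤ.* (φ i • v (suc l))) (φ i • v zero)))) ⟨
      lincomb (λ i → φ′ (suc i) • v (suc l)) b j′
        ≡⟨ ℤₚ.+-identityˡ _ ⟨
      0ℤ ℤ.* v zero j′ ℤ.+ lincomb (λ i → φ′ (suc i) • v (suc l)) b j′
        ≡⟨ cong (λ p → p ℤ.* v zero j′ ℤ.+ lincomb (λ i → φ′ (suc i) • v (suc l)) b j′)
             (≡.trans (φ′₀• (v (suc l))) (≡.trans (cong (D ℤ.*_) (ψ•-expands (expand l))) (ℤₚ.*-zeroʳ D))) ⟨
      lincomb (λ i → φ′ i • v (suc l)) b′ j′ ∎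
      where
      rearrange : ∀ x y z → x ℤ.* y ℤ.* z ≡ y ℤ.* (x ℤ.* z)
      rearrange = ℤ-Solver.solve-∀

    independent : w ≢ 0ℤ → Frame v
    independent w≢0 = record
      { dim = suc dim; b = b′; φ = φ′; D = D ℤ.* w
      ; D≢0 = λ Dw≡0 → nonzero (ℤₚ.i*j≡0⇒i≡0∨j≡0 D Dw≡0)
      ; dual = dual′
      ; b∈v = λ { zero → zero , ≡.refl ; (suc i) → suc (proj₁ (b∈v i)) , proj₂ (b∈v i) }
      ; expand = expand′
      }
      where
      nonzero : ¬ (D ≡ 0ℤ ⊎ w ≡ 0ℤ)
      nonzero (inj₁ D≡0) = D≢0 D≡0
      nonzero (inj₂ w≡0) = w≢0 w≡0

  -- The alternative is kept beside the new frame because it tells `dim-step` whether the rank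
  -- grows.
  extend : Σ (Frame v) λ F′ →
    (Expands (v zero) × Frame.dim F′ ≡ dim) ⊎ (¬ Expands (v zero) × Frame.dim F′ ≡ suc dim)
  extend with expands? (v zero)
  ... | yes v₀-expands = dependent v₀-expands , inj₁ (v₀-expands , ≡.refl)
  -- Equality in ℤ is decidable and there are finitely many entries, so the failure of the expansion
  -- yields an explicit entry.
  ... | no  ¬expands with Finₚ.¬∀⟶∃¬ n _ (λ j → D ℤ.* v zero j ℤₚ.≟ lincomb (λ i → φ i • v zero) b j) ¬expands
  ...   | j , neq = independent j (neq ∘ ℤₚ.i-j≡0⇒i≡j _ _) , inj₂ (¬expands , ≡.refl)

frame : ∀ {n k} (v : Vector (Vector ℤ n) k) → Frame v
frame {k = zero}  v = record
  { dim = 0; b = λ (); φ = λ (); D = 1ℤ; D≢0 = λ (); dual = λ (); b∈v = λ (); expand = λ () }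
frame {k = suc k} v = proj₁ (Extend.extend {v = v} (frame (v ∘ suc)))

-- Rank of integer vectors over a ring containing ℚ

module _ {c ℓ} (K : CommutativeRing c ℓ) where
  open CommutativeRing K hiding (zero)

  -- These properties are all that is used of ℝ. No equality in K is decided; decisions are taken in
  -- ℤ and carried over by `ι`.
  module Rank
    (ι : ℤ → Carrier)
    (ι-1 : ι 1ℤ ≈ 1#)
    (ι-+ : ∀ y z → ι (y ℤ.+ z) ≈ ι y + ι z)
    (ι-* : ∀ y z → ι (y ℤ.* z) ≈ ι y * ι z)
    (ι-injective : ∀ {y z} → ι y ≈ ι z → y ≡ z)
    (ι-invertible : ∀ {z} → z ≢ 0ℤ → ∃ λ r → r * ι z ≈ 1#)
    where
    open Combinations K
    open import Algebra.Properties.Semiring.Sum semiring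
    import Algebra.Properties.Semiring.Sum ℤₚ.+-*-semiring as ℤ-Sum
    open import Algebra.Properties.Group +-group using (identityʳ-unique)
    import Algebra.Properties.AbelianGroup +-abelianGroup as +-Group
    open import Relation.Binary.Reasoning.Setoid setoid

    ι-0 : ι 0ℤ ≈ 0#
    ι-0 = identityʳ-unique (ι 0ℤ) (ι 0ℤ) (sym (ι-+ 0ℤ 0ℤ))

    ι-sum : ∀ {n} (x : Vector ℤ n) → ι (ℤ-Sum.sum x) ≈ sum (ι ∘ x)
    ι-sum {zero}  x = ι-0
    ι-sum {suc n} x = trans (ι-+ _ _) (+-congˡ (ι-sum (x ∘ suc)))

    ι-lincomb : ∀ {n k} (cs : Vector ℤ k) (v : Vector (Vector ℤ n) k) j →
      ι (lincombℤ cs v j) ≈ lincomb (ι ∘ cs) (λ i → ι ∘ v i) j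
    ι-lincomb cs v j = trans (ι-sum (λ i → cs i ℤ.* v i j)) (sum-cong-≋ λ i → ι-* (cs i) (v i j))

    ι-δ : ∀ {n} (i j : Fin n) → ι (δℤ i j) ≈ δ i j
    ι-δ zero    zero    = ι-1
    ι-δ zero    (suc j) = ι-0
    ι-δ (suc i) zero    = ι-0
    ι-δ (suc i) (suc j) = ι-δ i j

    -- K has characteristic 0. This turns the trace identity of `basis-size` into an equality of
    -- natural numbers.
    sum-1-injective : ∀ k l → sum {k} (λ _ → 1#) ≈ sum {l} (λ _ → 1#) → k ≡ l
    sum-1-injective k l eq = ℤₚ.+-injective (ι-injective (trans (sym (ι-ℕ k)) (trans eq (ι-ℕ l))))
      where
      ι-ℕ : ∀ k → sum {k} (λ _ → 1#) ≈ ι (ℤ.+ k)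
      ι-ℕ zero    = sym ι-0
      ι-ℕ (suc k) = sym (trans (ι-+ 1ℤ (ℤ.+ k)) (+-cong ι-1 (sym (ι-ℕ k))))

    dimension-unique : ∀ {n k l d e} {v : Vector (Vector Carrier n) k} {w : Vector (Vector Carrier n) l} →
      (∀ i → Spanned w (v i)) → (∀ i → Spanned v (w i)) →
      HasDimension v d → HasDimension w e → d ≡ e
    dimension-unique {d = d} {e} v∈w w∈v V W =
      sum-1-injective d e (basis-size V.independent W.independent
        (λ i → Equivalence.to (W.spans _) (span-trans v∈w (Equivalence.from (V.spans _) (span-member i))))
        (λ i → Equivalence.to (V.spans _) (span-trans w∈v (Equivalence.from (W.spans _) (span-member i)))))
      where
      module V = HasDimension V
      module W = HasDimension W

    module _ {n k} {v : Vector (Vector ℤ n) k} (F : Frame v) where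
      open Frame F

      -- Up to the factor D, the dual forms read off coefficients even when these lie in K. As D is
      -- invertible in K, the family b stays independent there.
      coordinate : ∀ λs i →
        sum (λ l → ι (φ i l) * lincomb λs (λ m → ι ∘ b m) l) ≈ ι D * λs i
      coordinate λs i = begin
        sum (λ l → ι (φ i l) * lincomb λs (λ m → ι ∘ b m) l)
          ≈⟨ sum-cong-≋ (λ l → *-congˡ (sum-cong-≋ λ m → *-comm (λs m) (ι (b m l)))) ⟩
        lincomb (ι ∘ φ i) (λ l → lincomb (λ m → ι (b m l)) (λ m (_ : Fin 1) → λs m)) zero
          ≈⟨ lincomb-lincomb (ι ∘ φ i) (λ l m → ι (b m l)) (λ m (_ : Fin 1) → λs m) zero ⟩
        lincomb (λ m → sum (λ l → ι (φ i l) * ι (b m l))) (λ m (_ : Fin 1) → λs m) zero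
          ≈⟨ lincomb-congˡ (λ m (_ : Fin 1) → λs m) zero (λ m → trans (sym (ι-dot (φ i) (b m)))
               (trans (reflexive (cong ι (dual i m))) (trans (ι-* D _) (*-congˡ (ι-δ i m))))) ⟩
        lincomb (λ m → ι D * δ i m) (λ m (_ : Fin 1) → λs m) zero
          ≈⟨ lincomb-* (ι D) (δ i) (λ m (_ : Fin 1) → λs m) zero ⟩
        ι D * lincomb (δ i) (λ m (_ : Fin 1) → λs m) zero
          ≈⟨ *-congˡ (lincomb-δ i (λ m (_ : Fin 1) → λs m) zero) ⟩
        ι D * λs i ∎
        where
        ι-dot : ∀ x y → ι (x • y) ≈ sum (λ l → ι (x l) * ι (y l))
        ι-dot x y = trans (ι-sum (λ l → x l ℤ.* y l)) (sum-cong-≋ λ l → ι-* (x l) (y l))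

      frame-independent : Free (λ i → ι ∘ b i)
      frame-independent λs λb≈0 i with ι-invertible D≢0
      ... | r , rD≈1 = begin
        λs i              ≈⟨ *-identityˡ _ ⟨
        1# * λs i         ≈⟨ *-congʳ rD≈1 ⟨
        r * ι D * λs i    ≈⟨ *-assoc r (ι D) (λs i) ⟩
        r * (ι D * λs i)  ≈⟨ *-congˡ (coordinate λs i) ⟨
        r * sum (λ l → ι (φ i l) * lincomb λs (λ m → ι ∘ b m) l)
                          ≈⟨ *-congˡ (trans (sum-cong-≋ λ l → trans (*-congˡ (λb≈0 l)) (zeroʳ _)) (sum-replicate-zero n)) ⟩
        r * 0#            ≈⟨ zeroʳ r ⟩
        0#                ∎

      expands⇒span : ∀ {x} → Expands x → Spanned (λ i → ι ∘ b i) (ι ∘ x)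
      expands⇒span {x} x-expands with ι-invertible D≢0
      ... | r , rD≈1 = span-resp (λ j → begin
          r * ι (lincombℤ (λ i → φ i • x) b j)  ≈⟨ *-congˡ (reflexive (cong ι (x-expands j))) ⟨
          r * ι (D ℤ.* x j)                         ≈⟨ *-congˡ (ι-* D (x j)) ⟩
          r * (ι D * ι (x j))                       ≈⟨ *-assoc r (ι D) (ι (x j)) ⟨
          r * ι D * ι (x j)                         ≈⟨ *-congʳ rD≈1 ⟩
          1# * ι (x j)                              ≈⟨ *-identityˡ _ ⟩
          ι (x j)                                   ∎)
        (span-* r ((λ i → ι (φ i • x)) , λ j → ι-lincomb (λ i → φ i • x) b j))

      -- Multiplied by D, the coefficients in K of an integer vector are forced to be the integers
      -- φᵢ(x). The expansion is then an equation between images of integers and can be brought back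
      -- to ℤ.
      span⇒expands : ∀ {x} → Spanned (λ i → ι ∘ b i) (ι ∘ x) → Expands x
      span⇒expands {x} (λs , x≈) j = ι-injective (begin
        ι (D ℤ.* x j)
          ≈⟨ ι-* D (x j) ⟩
        ι D * ι (x j)
          ≈⟨ *-congˡ (x≈ j) ⟩
        ι D * lincomb λs (λ i → ι ∘ b i) j
          ≈⟨ lincomb-* (ι D) λs (λ i → ι ∘ b i) j ⟨
        lincomb (λ i → ι D * λs i) (λ i → ι ∘ b i) j
          ≈⟨ lincomb-congˡ (λ i → ι ∘ b i) j (λ i → trans (sym (coordinate λs i)) (sym (ι-φ i))) ⟩
        lincomb (λ i → ι (φ i • x)) (λ i → ι ∘ b i) j
          ≈⟨ ι-lincomb (λ i → φ i • x) b j ⟨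
        ι (lincombℤ (λ i → φ i • x) b j) ∎)
        where
        ι-φ : ∀ i → ι (φ i • x) ≈ sum (λ l → ι (φ i l) * lincomb λs (λ m → ι ∘ b m) l)
        ι-φ i = trans (ι-sum (λ l → φ i l ℤ.* x l))
          (sum-cong-≋ λ l → trans (ι-* (φ i l) (x l)) (*-congˡ (x≈ l)))

      b∈span : ∀ i → Spanned (λ l → ι ∘ v l) (ι ∘ b i)
      b∈span i with b∈v i
      ... | l , bᵢ≡vₗ = span-resp (λ j → reflexive (cong (λ x → ι (x j)) (≡.sym bᵢ≡vₗ))) (span-member l)

      span⇔frame-span : ∀ u → Spanned (λ l → ι ∘ v l) u ⇔ Spanned (λ i → ι ∘ b i) u
      span⇔frame-span u = mk⇔ (span-trans (λ l → expands⇒span (expand l))) (span-trans b∈span)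

      frame-dimension : HasDimension (λ l → ι ∘ v l) dim
      frame-dimension = record
        { basis = λ i → ι ∘ b i; independent = frame-independent; spans = span⇔frame-span }

    module _ {n k} {v : Vector (Vector Carrier n) k} where

      span-ι-+ : ∀ {x y z : Vector ℤ n} → (∀ j → z j ≡ x j ℤ.+ y j) →
        Spanned v (ι ∘ x) → Spanned v (ι ∘ y) → Spanned v (ι ∘ z)
      span-ι-+ {x} {y} z≡x+y x∈ y∈ = span-resp (λ j → sym (trans (reflexive (cong ι (z≡x+y j))) (ι-+ (x j) (y j)))) (span-+ x∈ y∈)

      span-ι-0 : ∀ {x : Vector ℤ n} → (∀ j → x j ≡ 0ℤ) → Spanned v (ι ∘ x)
      span-ι-0 x≡0 = span-resp (λ j → sym (trans (reflexive (cong ι (x≡0 j))) ι-0)) span-0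

      span-ι-resp : ∀ {x y : Vector ℤ n} → (∀ j → x j ≡ y j) → Spanned v (ι ∘ x) → Spanned v (ι ∘ y)
      span-ι-resp x≡y = span-resp λ j → reflexive (cong ι (x≡y j))

      span-ι-neg : ∀ {x y : Vector ℤ n} → (∀ j → y j ≡ ℤ.- x j) → Spanned v (ι ∘ x) → Spanned v (ι ∘ y)
      span-ι-neg {x} {y} y≡-x x∈ = span-resp
        (λ j → sym (+-Group.inverseʳ-unique (ι (x j)) (ι (y j)) (trans (sym (ι-+ (x j) (y j)))
          (trans (reflexive (cong ι (≡.trans (cong (λ z → x j ℤ.+ z) (y≡-x j)) (ℤₚ.+-inverseʳ (x j))))) ι-0))))
        (span-neg x∈)

      span-ι-divide : ∀ {z} {x y : Vector ℤ n} → z ≢ 0ℤ → (∀ j → y j ≡ z ℤ.* x j) →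
        Spanned v (ι ∘ y) → Spanned v (ι ∘ x)
      span-ι-divide {z} {x} {y} z≢0 y≡zx y∈ with ι-invertible z≢0
      ... | r , rz≈1 = span-resp (λ j → begin
        r * ι (y j)          ≈⟨ *-congˡ (reflexive (cong ι (y≡zx j))) ⟩
        r * ι (z ℤ.* x j)    ≈⟨ *-congˡ (ι-* z (x j)) ⟩
        r * (ι z * ι (x j))  ≈⟨ *-assoc r (ι z) (ι (x j)) ⟨
        r * ι z * ι (x j)    ≈⟨ *-congʳ rz≈1 ⟩
        1# * ι (x j)         ≈⟨ *-identityˡ _ ⟩
        ι (x j)              ∎) (span-* r y∈)

    -- The alternative of `extend` is decided by equations in ℤ; expansions and spans over K
    -- correspond, so it also decides membership in the span over K.
    dim-step : ∀ {n k} (v : Vector (Vector ℤ n) (suc k)) →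
      let u = λ l → ι ∘ v (suc l); d = Frame.dim (frame (v ∘ suc)) in
      (Spanned u (ι ∘ v zero) × Frame.dim (frame v) ≡ d) ⊎
      (¬ Spanned u (ι ∘ v zero) × Frame.dim (frame v) ≡ suc d)
    dim-step v with frame (v ∘ suc)
    ... | F with proj₂ (Extend.extend {v = v} F)
    ...   | inj₁ (v₀-expands , eq) =
      inj₁ (Equivalence.from (span⇔frame-span F _) (expands⇒span F v₀-expands) , eq)
    ...   | inj₂ (¬expands , eq) =
      inj₂ (¬expands ∘ span⇒expands F ∘ Equivalence.to (span⇔frame-span F _) , eq)

private
  variable
    a b p q : Level
    A B : Set a
    P : Set p
    Q : Set q

-- Sums over sublists

sumSub : List A → (List A → ℤ) → ℤ
sumSub []       f = f []
sumSub (x ∷ xs) f = sumSub xs (f ∘ (x ∷_)) ℤ.+ sumSub xs f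

sumSub-cong : ∀ (xs : List A) {f g : List A → ℤ} → (∀ ys → ys ⊆ xs → f ys ≡ g ys) →
  sumSub xs f ≡ sumSub xs g
sumSub-cong []       f≡g = f≡g [] []
sumSub-cong (x ∷ xs) f≡g = cong₂ ℤ._+_
  (sumSub-cong xs λ ys ys⊆xs → f≡g (x ∷ ys) (≡.refl ∷ ys⊆xs))
  (sumSub-cong xs λ ys ys⊆xs → f≡g ys (x ∷ʳ ys⊆xs))

+-interchange : ∀ p q r s → (p ℤ.+ q) ℤ.+ (r ℤ.+ s) ≡ (p ℤ.+ r) ℤ.+ (q ℤ.+ s)
+-interchange = ℤ-Solver.solve-∀

sumSub-+ : ∀ (xs : List A) f g → sumSub xs (λ ys → f ys ℤ.+ g ys) ≡ sumSub xs f ℤ.+ sumSub xs g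
sumSub-+ []       f g = ≡.refl
sumSub-+ (x ∷ xs) f g = ≡.trans
  (cong₂ ℤ._+_ (sumSub-+ xs (f ∘ (x ∷_)) (g ∘ (x ∷_))) (sumSub-+ xs f g))
  (+-interchange (sumSub xs (f ∘ (x ∷_))) (sumSub xs (g ∘ (x ∷_))) (sumSub xs f) (sumSub xs g))

sumSub-*ˡ : ∀ (xs : List A) c f → sumSub xs (λ ys → c ℤ.* f ys) ≡ c ℤ.* sumSub xs f
sumSub-*ˡ []       c f = ≡.refl
sumSub-*ˡ (x ∷ xs) c f = ≡.trans
  (cong₂ ℤ._+_ (sumSub-*ˡ xs c (f ∘ (x ∷_))) (sumSub-*ˡ xs c f))
  (≡.sym (ℤₚ.*-distribˡ-+ c (sumSub xs (f ∘ (x ∷_))) (sumSub xs f)))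

sumSub-*ʳ : ∀ (xs : List A) c f → sumSub xs (λ ys → f ys ℤ.* c) ≡ sumSub xs f ℤ.* c
sumSub-*ʳ xs c f = ≡.trans (sumSub-cong xs λ ys _ → ℤₚ.*-comm (f ys) c)
  (≡.trans (sumSub-*ˡ xs c f) (ℤₚ.*-comm c (sumSub xs f)))

sumSub-++ : ∀ (xs ys : List A) f → sumSub (xs ++ ys) f ≡ sumSub xs (λ us → sumSub ys (λ vs → f (us ++ vs)))
sumSub-++ []       ys f = ≡.refl
sumSub-++ (x ∷ xs) ys f = cong₂ ℤ._+_ (sumSub-++ xs ys (f ∘ (x ∷_))) (sumSub-++ xs ys f)

sumSub-map : ∀ (h : A → B) xs f → sumSub (map h xs) f ≡ sumSub xs (f ∘ map h)
sumSub-map h []       f = ≡.refl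
sumSub-map h (x ∷ xs) f = cong₂ ℤ._+_ (sumSub-map h xs (f ∘ (h x ∷_))) (sumSub-map h xs f)

-- Permuting the list permutes its sublists but also reorders each of them, hence the assumption
-- that f ignores order.
sumSub-↭ : ∀ {xs ys : List A} f → (∀ {us vs} → us ↭ vs → f us ≡ f vs) → xs ↭ ys →
  sumSub xs f ≡ sumSub ys f
sumSub-↭ f f-resp ↭-refl′ = ≡.refl
sumSub-↭ f f-resp (prep x xs↭ys) =
  cong₂ ℤ._+_ (sumSub-↭ (f ∘ (x ∷_)) (f-resp ∘ prep x) xs↭ys) (sumSub-↭ f f-resp xs↭ys)
sumSub-↭ {xs = x ∷ y ∷ xs} {ys = y ∷ x ∷ ys} f f-resp (swap x y xs↭ys) = begin
  (sumSub xs (f ∘ (λ zs → x ∷ y ∷ zs)) ℤ.+ sumSub xs (f ∘ (x ∷_))) ℤ.+ (sumSub xs (f ∘ (y ∷_)) ℤ.+ sumSub xs f)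
    ≡⟨ +-interchange (sumSub xs (f ∘ (λ zs → x ∷ y ∷ zs))) (sumSub xs (f ∘ (x ∷_))) (sumSub xs (f ∘ (y ∷_))) (sumSub xs f) ⟩
  (sumSub xs (f ∘ (λ zs → x ∷ y ∷ zs)) ℤ.+ sumSub xs (f ∘ (y ∷_))) ℤ.+ (sumSub xs (f ∘ (x ∷_)) ℤ.+ sumSub xs f)
    ≡⟨ cong₂ ℤ._+_
         (cong₂ ℤ._+_ (≡.trans (sumSub-cong xs λ zs _ → f-resp (swap x y ↭-refl))
                             (sumSub-↭ (f ∘ (λ zs → y ∷ x ∷ zs)) (f-resp ∘ prep y ∘ prep x) xs↭ys))
                      (sumSub-↭ (f ∘ (y ∷_)) (f-resp ∘ prep y) xs↭ys))
         (cong₂ ℤ._+_ (sumSub-↭ (f ∘ (x ∷_)) (f-resp ∘ prep x) xs↭ys) (sumSub-↭ f f-resp xs↭ys)) ⟩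
  (sumSub ys (f ∘ (λ zs → y ∷ x ∷ zs)) ℤ.+ sumSub ys (f ∘ (y ∷_))) ℤ.+ (sumSub ys (f ∘ (x ∷_)) ℤ.+ sumSub ys f) ∎
  where open ≡.≡-Reasoning
sumSub-↭ f f-resp (↭-trans′ xs↭ys ys↭zs) = ≡.trans (sumSub-↭ f f-resp xs↭ys) (sumSub-↭ f f-resp ys↭zs)

sumSub-0 : ∀ (xs : List A) → sumSub xs (λ _ → 0ℤ) ≡ 0ℤ
sumSub-0 []       = ≡.refl
sumSub-0 (x ∷ xs) = cong₂ ℤ._+_ (sumSub-0 xs) (sumSub-0 xs)

sumOver : List A → (A → ℤ) → ℤ
sumOver xs f = foldr (λ x s → f x ℤ.+ s) 0ℤ xs

sumOver-++ : ∀ (xs ys : List A) f → sumOver (xs ++ ys) f ≡ sumOver xs f ℤ.+ sumOver ys f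
sumOver-++ []       ys f = ≡.sym (ℤₚ.+-identityˡ _)
sumOver-++ (x ∷ xs) ys f = ≡.trans (cong (λ z → f x ℤ.+ z) (sumOver-++ xs ys f))
  (≡.sym (ℤₚ.+-assoc (f x) (sumOver xs f) (sumOver ys f)))

sumOver-map : ∀ (h : A → B) xs f → sumOver (map h xs) f ≡ sumOver xs (f ∘ h)
sumOver-map h []       f = ≡.refl
sumOver-map h (x ∷ xs) f = cong (λ z → f (h x) ℤ.+ z) (sumOver-map h xs f)

sumOver-sublists : ∀ (xs : List A) f → sumOver (sublists xs) f ≡ sumSub xs f
sumOver-sublists []       f = ℤₚ.+-identityʳ (f [])
sumOver-sublists (x ∷ xs) f = ≡.trans (sumOver-++ (map (x ∷_) (sublists xs)) (sublists xs) f)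
  (cong₂ ℤ._+_ (≡.trans (sumOver-map (x ∷_) (sublists xs) f) (sumOver-sublists xs (f ∘ (x ∷_))))
               (sumOver-sublists xs f))

-- Coefficients of the multiplicity Tutte polynomial

-- e k i is the coefficient of xⁱ in (x - 1)ᵏ.
e : ℕ → ℕ → ℤ
e zero    zero    = 1ℤ
e zero    (suc i) = 0ℤ
e (suc k) zero    = ℤ.- e k zero
e (suc k) (suc i) = e k i ℤ.- e k (suc i)

shiftℤ : (ℕ → ℤ) → ℕ → ℤ
shiftℤ f zero    = 0ℤ
shiftℤ f (suc i) = f i

e-suc : ∀ k i → e (suc k) i ≡ shiftℤ (e k) i ℤ.- e k i
e-suc k zero    = ≡.sym (ℤₚ.+-identityˡ _)
e-suc k (suc i) = ≡.refl

module _ where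
  private
    module P¹ = Polynomial ℤ.+-*-rawRing
    module P² = Polynomial ℤ[x]

  coeff-add : ∀ f g i → P¹.coeff (P¹.add f g) i ≡ P¹.coeff f i ℤ.+ P¹.coeff g i
  coeff-add []      g       i       = ≡.sym (ℤₚ.+-identityˡ _)
  coeff-add (a ∷ f) []      i       = ≡.sym (ℤₚ.+-identityʳ _)
  coeff-add (a ∷ f) (b ∷ g) zero    = ≡.refl
  coeff-add (a ∷ f) (b ∷ g) (suc i) = coeff-add f g i

  coeff-map : ∀ c g i → P¹.coeff (map (c ℤ.*_) g) i ≡ c ℤ.* P¹.coeff g i
  coeff-map c []      i       = ≡.sym (ℤₚ.*-zeroʳ c)
  coeff-map c (a ∷ g) zero    = ≡.refl
  coeff-map c (a ∷ g) (suc i) = coeff-map c g i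

  coeff-0∷[] : ∀ i → P¹.coeff (0ℤ ∷ []) i ≡ 0ℤ
  coeff-0∷[] zero    = ≡.refl
  coeff-0∷[] (suc i) = ≡.refl

  coeff-mul-∷ : ∀ c f g i → P¹.coeff (P¹.mul (c ∷ f) g) i ≡
    c ℤ.* P¹.coeff g i ℤ.+ shiftℤ (P¹.coeff (P¹.mul f g)) i
  coeff-mul-∷ c f g i = ≡.trans (coeff-add (map (c ℤ.*_) g) (0ℤ ∷ P¹.mul f g) i)
    (cong₂ ℤ._+_ (coeff-map c g i) (shifted i))
    where
    shifted : ∀ i → P¹.coeff (0ℤ ∷ P¹.mul f g) i ≡ shiftℤ (P¹.coeff (P¹.mul f g)) i
    shifted zero    = ≡.refl
    shifted (suc i) = ≡.refl

  shiftℤ-cong : ∀ {f g} → (∀ i → f i ≡ g i) → ∀ i → shiftℤ f i ≡ shiftℤ g i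
  shiftℤ-cong f≗g zero    = ≡.refl
  shiftℤ-cong f≗g (suc i) = f≗g i

  shiftℤ-0 : ∀ i → shiftℤ (λ _ → 0ℤ) i ≡ 0ℤ
  shiftℤ-0 zero    = ≡.refl
  shiftℤ-0 (suc i) = ≡.refl

  -- `e 0` is the coefficient sequence of 1, so the assumption says that g is the constant s up to
  -- trailing zeros. The coefficients in y of a power of y - 1 are known only in this sense.
  coeff-mul-constant : ∀ f {g s} → (∀ i → P¹.coeff g i ≡ s ℤ.* e 0 i) →
    ∀ i → P¹.coeff (P¹.mul f g) i ≡ P¹.coeff f i ℤ.* s
  coeff-mul-constant []      {g} {s} g≡s i = ≡.sym (ℤₚ.*-zeroˡ s)
  coeff-mul-constant (c ∷ f) {g} {s} g≡s i = ≡.trans (coeff-mul-∷ c f g i) (split i)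
    where
    split : ∀ i → c ℤ.* P¹.coeff g i ℤ.+ shiftℤ (P¹.coeff (P¹.mul f g)) i ≡ P¹.coeff (c ∷ f) i ℤ.* s
    split zero    = ≡.trans (ℤₚ.+-identityʳ _) (cong (c ℤ.*_) (≡.trans (g≡s 0) (ℤₚ.*-identityʳ s)))
    split (suc i) = ≡.trans (cong₂ ℤ._+_
      (≡.trans (cong (c ℤ.*_) (≡.trans (g≡s (suc i)) (ℤₚ.*-zeroʳ s))) (ℤₚ.*-zeroʳ c))
      (coeff-mul-constant f g≡s i)) (ℤₚ.+-identityˡ _)

  coeff-constant* : ∀ c p i → P¹.coeff (P¹.mul (c ∷ []) p) i ≡ c ℤ.* P¹.coeff p i
  coeff-constant* c p i = ≡.trans (coeff-mul-∷ c [] p i)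
    (≡.trans (cong (λ z → c ℤ.* P¹.coeff p i ℤ.+ z) (shiftℤ-0 i)) (ℤₚ.+-identityʳ _))

  add-[] : ∀ f → P¹.add f [] ≡ f
  add-[] []      = ≡.refl
  add-[] (a ∷ f) = ≡.refl

  coefficient-add : ∀ f g i j → coefficient (P².add f g) i j ≡ coefficient f i j ℤ.+ coefficient g i j
  coefficient-add f g i j = ≡.trans (cong (λ h → P¹.coeff h i) (outer f g j)) (coeff-add (P².coeff f j) (P².coeff g j) i)
    where
    outer : ∀ f g j → P².coeff (P².add f g) j ≡ P¹.add (P².coeff f j) (P².coeff g j)
    outer []      g       j       = ≡.refl
    outer (a ∷ f) []      j       = ≡.sym (add-[] _)
    outer (a ∷ f) (b ∷ g) zero    = ≡.refl
    outer (a ∷ f) (b ∷ g) (suc j) = outer f g j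

  coefficient-map : ∀ p g i j → coefficient (map (P¹.mul p) g) i j ≡ P¹.coeff (P¹.mul p (P².coeff g j)) i
  coefficient-map p []      i j       = ≡.sym (≡.trans (coeff-mul-constant p {[]} {0ℤ} (λ _ → ≡.refl) i) (ℤₚ.*-zeroʳ (P¹.coeff p i)))
  coefficient-map p (a ∷ g) i zero    = ≡.refl
  coefficient-map p (a ∷ g) i (suc j) = coefficient-map p g i j

  open RawRing ℤ[x,y] using () renaming (Carrier to ℤ[x,y]-Carrier; rawSemiring to ℤ[x,y]-rawSemiring)
  open Algebra.Definitions.RawSemiring ℤ[x,y]-rawSemiring using (_^_) renaming (_×_ to _·_)

  x-1 y-1 : ℤ[x,y]-Carrier
  x-1 = (-1ℤ ∷ 1ℤ ∷ []) ∷ []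
  y-1 = (-1ℤ ∷ []) ∷ (1ℤ ∷ []) ∷ []

  coefficient-· : ∀ k f i j → coefficient (k · f) i j ≡ ℤ.+ k ℤ.* coefficient f i j
  coefficient-· zero    f i j = ≡.refl
  coefficient-· (suc k) f i j = ≡.trans (coefficient-add f (k · f) i j)
    (≡.trans (cong (λ z → coefficient f i j ℤ.+ z) (coefficient-· k f i j))
           (≡.sym (ℤₚ.suc-* (ℤ.+ k) (coefficient f i j))))

  -- x - 1 is constant in y, and a product of one-entry lists has one entry. Knowing the power as a
  -- list allows multiplication by it to be computed with `coefficient-constant*`.
  [x-1]^ : ∀ k → ∃ λ p → x-1 ^ k ≡ p ∷ [] × (∀ i → P¹.coeff p i ≡ e k i)
  [x-1]^ zero    = 1ℤ ∷ [] , ≡.refl , λ { zero → ≡.refl ; (suc i) → ≡.refl }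
  [x-1]^ (suc k) with [x-1]^ k
  ... | p , eq , p≡ = P¹.mul (-1ℤ ∷ 1ℤ ∷ []) p
    , ≡.trans (cong (P².mul x-1) eq) (cong (_∷ []) (add-[] _))
    , λ i → begin
      P¹.coeff (P¹.mul (-1ℤ ∷ 1ℤ ∷ []) p) i
        ≡⟨ coeff-mul-∷ -1ℤ (1ℤ ∷ []) p i ⟩
      -1ℤ ℤ.* P¹.coeff p i ℤ.+ shiftℤ (P¹.coeff (P¹.mul (1ℤ ∷ []) p)) i
        ≡⟨ cong₂ ℤ._+_ (ℤₚ.-1*i≡-i (P¹.coeff p i)) (shiftℤ-cong one i) ⟩
      ℤ.- P¹.coeff p i ℤ.+ shiftℤ (P¹.coeff p) i
        ≡⟨ ℤₚ.+-comm (ℤ.- P¹.coeff p i) _ ⟩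
      shiftℤ (P¹.coeff p) i ℤ.- P¹.coeff p i
        ≡⟨ cong₂ ℤ._-_ (shiftℤ-cong p≡ i) (p≡ i) ⟩
      shiftℤ (e k) i ℤ.- e k i
        ≡⟨ e-suc k i ⟨
      e (suc k) i ∎
    where
    open ≡.≡-Reasoning
    one : ∀ i → P¹.coeff (P¹.mul (1ℤ ∷ []) p) i ≡ P¹.coeff p i
    one i = ≡.trans (coeff-constant* 1ℤ p i) (ℤₚ.*-identityˡ (P¹.coeff p i))

  coefficient-[]∷[] : ∀ i j → coefficient ([] ∷ []) i j ≡ 0ℤ
  coefficient-[]∷[] i zero    = ≡.refl
  coefficient-[]∷[] i (suc j) = ≡.refl

  coefficient-mul-∷ : ∀ p f g i j → coefficient (P².mul (p ∷ f) g) i j ≡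
    P¹.coeff (P¹.mul p (P².coeff g j)) i ℤ.+ shiftℤ (coefficient (P².mul f g) i) j
  coefficient-mul-∷ p f g i j = ≡.trans (coefficient-add (map (P¹.mul p) g) ([] ∷ P².mul f g) i j)
    (cong₂ ℤ._+_ (coefficient-map p g i j) (shifted j))
    where
    shifted : ∀ j → coefficient ([] ∷ P².mul f g) i j ≡ shiftℤ (coefficient (P².mul f g) i) j
    shifted zero    = ≡.refl
    shifted (suc j) = ≡.refl

  coefficient-constant* : ∀ p g i j → coefficient (P².mul (p ∷ []) g) i j ≡ P¹.coeff (P¹.mul p (P².coeff g j)) i
  coefficient-constant* p g i j = ≡.trans (coefficient-mul-∷ p [] g i j)
    (≡.trans (cong (λ z → P¹.coeff (P¹.mul p (P².coeff g j)) i ℤ.+ z) (shiftℤ-0 j)) (ℤₚ.+-identityʳ _))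

  -- The factor `e 0 i` expresses that each coefficient in y is constant in x.
  [y-1]^ : ∀ k i j → coefficient (y-1 ^ k) i j ≡ e k j ℤ.* e 0 i
  [y-1]^ zero    zero    zero    = ≡.refl
  [y-1]^ zero    (suc i) zero    = ≡.refl
  [y-1]^ zero    i       (suc j) = ≡.refl
  [y-1]^ (suc k) i j = begin
    coefficient (y-1 ^ suc k) i j
      ≡⟨ coefficient-mul-∷ (-1ℤ ∷ []) ((1ℤ ∷ []) ∷ []) (y-1 ^ k) i j ⟩
    P¹.coeff (P¹.mul (-1ℤ ∷ []) (P².coeff (y-1 ^ k) j)) i ℤ.+ shiftℤ (coefficient (P².mul ((1ℤ ∷ []) ∷ []) (y-1 ^ k)) i) j
      ≡⟨ cong₂ ℤ._+_ (≡.trans (coeff-constant* -1ℤ (P².coeff (y-1 ^ k) j) i) (cong (-1ℤ ℤ.*_) ([y-1]^ k i j)))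
           (shiftℤ-cong (λ j → ≡.trans (coefficient-constant* (1ℤ ∷ []) (y-1 ^ k) i j)
             (≡.trans (coeff-constant* 1ℤ (P².coeff (y-1 ^ k) j) i)
               (≡.trans (ℤₚ.*-identityˡ _) ([y-1]^ k i j)))) j) ⟩
    -1ℤ ℤ.* (e k j ℤ.* e 0 i) ℤ.+ shiftℤ (λ j → e k j ℤ.* e 0 i) j
      ≡⟨ cong (λ z → -1ℤ ℤ.* (e k j ℤ.* e 0 i) ℤ.+ z) (shift-* j) ⟩
    -1ℤ ℤ.* (e k j ℤ.* e 0 i) ℤ.+ shiftℤ (e k) j ℤ.* e 0 i
      ≡⟨ rearrange (e k j) (e 0 i) (shiftℤ (e k) j) ⟩
    (shiftℤ (e k) j ℤ.- e k j) ℤ.* e 0 i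
      ≡⟨ cong (ℤ._* e 0 i) (e-suc k j) ⟨
    e (suc k) j ℤ.* e 0 i ∎
    where
    open ≡.≡-Reasoning
    shift-* : ∀ j → shiftℤ (λ j → e k j ℤ.* e 0 i) j ≡ shiftℤ (e k) j ℤ.* e 0 i
    shift-* zero    = ≡.refl
    shift-* (suc j) = ≡.refl
    rearrange : ∀ u v w → -1ℤ ℤ.* (u ℤ.* v) ℤ.+ w ℤ.* v ≡ (w ℤ.- u) ℤ.* v
    rearrange = ℤ-Solver.solve-∀

  coefficient-term : ∀ k a b i j →
    coefficient (k · P².mul (x-1 ^ a) (y-1 ^ b)) i j ≡ ℤ.+ k ℤ.* (e a i ℤ.* e b j)
  coefficient-term k a b i j = ≡.trans (coefficient-· k (P².mul (x-1 ^ a) (y-1 ^ b)) i j)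
    (cong (ℤ.+ k ℤ.*_) (from ([x-1]^ a)))
    where
    from : (∃ λ p → x-1 ^ a ≡ p ∷ [] × (∀ i → P¹.coeff p i ≡ e a i)) →
           coefficient (P².mul (x-1 ^ a) (y-1 ^ b)) i j ≡ e a i ℤ.* e b j
    from (p , eq , p≡) = ≡.trans (cong (λ f → coefficient (P².mul f (y-1 ^ b)) i j) eq)
      (≡.trans (coefficient-constant* p (y-1 ^ b) i j)
        (≡.trans (coeff-mul-constant p (λ i → [y-1]^ b i j) i) (cong (ℤ._* e b j) (p≡ i))))

  coefficient-sum : ∀ (f : A → ℤ[x,y]-Carrier) xs i j →
    coefficient (foldr P².add [] (map f xs)) i j ≡ sumOver xs (λ x → coefficient (f x) i j)
  coefficient-sum f []       i j = ≡.refl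
  coefficient-sum f (x ∷ xs) i j = ≡.trans (coefficient-add (f x) _ i j)
    (cong (λ z → coefficient (f x) i j ℤ.+ z) (coefficient-sum f xs i j))

  coefficient-Tutte : ∀ (r m : List A → ℕ) X i j →
    coefficient (multiplicityTutte r m X) i j ≡
    sumSub X (λ Y → ℤ.+ m Y ℤ.* (e (r X ∸ r Y) i ℤ.* e (length Y ∸ r Y) j))
  coefficient-Tutte r m X i j = ≡.trans (coefficient-sum _ (sublists X) i j)
    (≡.trans (sumOver-sublists X _)
      (sumSub-cong X λ Y _ → coefficient-term (m Y) (r X ∸ r Y) (length Y ∸ r Y) i j))

-- Generated subgroups, saturations and indices

least : ∀ {p} {P : ℕ → Set p} → (∀ n → Dec (P n)) → ∀ n → P n →
  ∃ λ m → P m × (∀ {l} → l < m → ¬ P l)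
least P? zero    P0 = 0 , P0 , λ ()
least P? (suc n) Pn with P? 0
... | yes P0 = 0 , P0 , λ ()
... | no ¬P0 with least (P? ∘ suc) n Pn
...   | m , Pm , minimal = suc m , Pm , λ { {zero} _ → ¬P0 ; {suc _} (s<s l<m) → minimal l<m }

module GeneratedSubgroups {c ℓ} (G : AbelianGroup c ℓ) where
  open AbelianGroup G hiding (identity; inverse)
  open import Algebra.Properties.CommutativeMonoid.Mult commutativeMonoid public
    using (×-congʳ; ×-homo-+; ×-assocˡ; ×-distrib-+) renaming (_×_ to _·_)
  open import Algebra.Properties.AbelianGroup G
    using (⁻¹-∙-comm; ⁻¹-anti-homo‿-; ε⁻¹≈ε; ∙-cancelˡ)
  open import Algebra.Properties.CommutativeSemigroup commutativeSemigroup using (interchange)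

  ⟨_⟩ : List Carrier → Carrier → Set (c ⊔ ℓ)
  ⟨_⟩ = Generated G

  ⟨⟩-mono : ∀ {A B} → (∀ {g} → g ∈ A → ⟨ B ⟩ g) → ∀ {g} → ⟨ A ⟩ g → ⟨ B ⟩ g
  ⟨⟩-mono A⊆B (generator g∈A)  = A⊆B g∈A
  ⟨⟩-mono A⊆B identity         = identity
  ⟨⟩-mono A⊆B (product p q)    = product (⟨⟩-mono A⊆B p) (⟨⟩-mono A⊆B q)
  ⟨⟩-mono A⊆B (inverse p)      = inverse (⟨⟩-mono A⊆B p)
  ⟨⟩-mono A⊆B (respects eq p)  = respects eq (⟨⟩-mono A⊆B p)

  ⟨⟩-⊑ : ∀ {A B} → A ⊑ B → ∀ {g} → ⟨ A ⟩ g → ⟨ B ⟩ g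
  ⟨⟩-⊑ A⊑B = ⟨⟩-mono (generator ∘ A⊑B)

  -- The quotient keeps the carrier and coarsens the equality, so elements need no transport and
  -- congruences modulo `A` can be chained.
  _/⟨_⟩ : List Carrier → AbelianGroup c (c ⊔ ℓ)
  _/⟨_⟩ A = record
    { Carrier = Carrier
    ; _≈_ = λ g h → ⟨ A ⟩ (g ∙ h ⁻¹)
    ; _∙_ = _∙_
    ; ε = ε
    ; _⁻¹ = _⁻¹
    ; isAbelianGroup = record
      { isGroup = record
        { isMonoid = record
          { isSemigroup = record
            { isMagma = record
              { isEquivalence = record
                { refl  = ≈⇒~ refl
                ; sym   = λ {g} {h} p → respects (⁻¹-anti-homo‿- g h) (inverse p)
                ; trans = λ {g} {h} {k} p q → respects (telescope g h k) (product p q)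
                }
              ; ∙-cong = λ {g} {g′} {h} {h′} p q → respects
                  (trans (interchange g (g′ ⁻¹) h (h′ ⁻¹)) (∙-congˡ (⁻¹-∙-comm g′ h′)))
                  (product p q)
              }
            ; assoc = λ g h k → ≈⇒~ (assoc g h k)
            }
          ; identity = (λ g → ≈⇒~ (identityˡ g)) , (λ g → ≈⇒~ (identityʳ g))
          }
        ; inverse = (λ g → ≈⇒~ (inverseˡ g)) , (λ g → ≈⇒~ (inverseʳ g))
        ; ⁻¹-cong = λ {g} {h} p → respects (sym (⁻¹-∙-comm g (h ⁻¹))) (inverse p)
        }
      ; comm = λ g h → ≈⇒~ (comm g h)
      }
    }
    where
    ≈⇒~ : ∀ {g h} → g ≈ h → ⟨ A ⟩ (g ∙ h ⁻¹)
    ≈⇒~ {g} {h} g≈h = respects (sym (trans (∙-congʳ g≈h) (inverseʳ h))) identity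
    open import Relation.Binary.Reasoning.Setoid setoid
    telescope : ∀ g h k → (g ∙ h ⁻¹) ∙ (h ∙ k ⁻¹) ≈ g ∙ k ⁻¹
    telescope g h k = begin
      (g ∙ h ⁻¹) ∙ (h ∙ k ⁻¹)  ≈⟨ assoc g (h ⁻¹) (h ∙ k ⁻¹) ⟩
      g ∙ (h ⁻¹ ∙ (h ∙ k ⁻¹))  ≈⟨ ∙-congˡ (assoc (h ⁻¹) h (k ⁻¹)) ⟨
      g ∙ (h ⁻¹ ∙ h ∙ k ⁻¹)    ≈⟨ ∙-congˡ (∙-congʳ (inverseˡ h)) ⟩
      g ∙ (ε ∙ k ⁻¹)           ≈⟨ ∙-congˡ (identityˡ (k ⁻¹)) ⟩
      g ∙ k ⁻¹                 ∎

  module Mod (A : List Carrier) where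
    open AbelianGroup (_/⟨_⟩ A) public using ()
      renaming (_≈_ to _~_; refl to ~-refl; sym to ~-sym; trans to ~-trans; setoid to ~-setoid;
                ∙-cong to ~-∙-cong; ∙-congˡ to ~-∙-congˡ; ∙-congʳ to ~-∙-congʳ;
                identityˡ to ~-identityˡ; identityʳ to ~-identityʳ)
    open import Algebra.Properties.AbelianGroup (_/⟨_⟩ A) public using ()
      renaming (∙-cancelˡ to ~-cancelˡ; ∙-cancelʳ to ~-cancelʳ)

    ≈⇒~ : ∀ {g h} → g ≈ h → g ~ h
    ≈⇒~ {g} {h} g≈h = respects (sym (trans (∙-congʳ g≈h) (inverseʳ h))) identity

    ∈⇒~ε : ∀ {g} → ⟨ A ⟩ g → g ~ ε
    ∈⇒~ε {g} p = respects (sym (trans (∙-congˡ ε⁻¹≈ε) (identityʳ g))) p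

    ~ε⇒∈ : ∀ {g} → g ~ ε → ⟨ A ⟩ g
    ~ε⇒∈ {g} p = respects (trans (∙-congˡ ε⁻¹≈ε) (identityʳ g)) p

    ·-~ε : ∀ n {g} → g ~ ε → n · g ~ ε
    ·-~ε zero    p = ~-refl
    ·-~ε (suc n) p = ~-trans (~-∙-cong p (·-~ε n p)) (≈⇒~ (identityʳ ε))

    module ~-Reasoning where
      open import Relation.Binary.Reasoning.Setoid ~-setoid public

  √⟨_⟩ : List Carrier → Carrier → Set (c ⊔ ℓ)
  √⟨ A ⟩ g = ∃ λ k → ⟨ A ⟩ (suc k · g)

  module _ {A : List Carrier} where
    open Mod A

    ∈⇒√ : ∀ {g} → ⟨ A ⟩ g → √⟨ A ⟩ g
    ∈⇒√ {g} p = 0 , respects (sym (identityʳ g)) p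

    √-resp : ∀ {g h} → g ≈ h → √⟨ A ⟩ g → √⟨ A ⟩ h
    √-resp g≈h (k , p) = k , respects (×-congʳ (suc k) g≈h) p

    √-divide : ∀ m {g} → √⟨ A ⟩ (suc m · g) → √⟨ A ⟩ g
    √-divide m {g} (k , p) = m ℕ.+ k ℕ.* suc m , respects (×-assocˡ g (suc k) (suc m)) p

    private
      ·-multiple : ∀ k m {g} → ⟨ A ⟩ (k · g) → ⟨ A ⟩ ((m ℕ.* k) · g)
      ·-multiple k m {g} p = ~ε⇒∈ (~-trans (~-sym (≈⇒~ (×-assocˡ g m k))) (·-~ε m (∈⇒~ε p)))

    √-∙ : ∀ {g h} → √⟨ A ⟩ g → √⟨ A ⟩ h → √⟨ A ⟩ (g ∙ h)
    √-∙ {g} {h} (k , p) (l , q) = l ℕ.+ k ℕ.* suc l ,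
      respects (sym (×-distrib-+ g h (suc k ℕ.* suc l)))
        (product (subst (λ n → ⟨ A ⟩ (n · g)) (ℕₚ.*-comm (suc l) (suc k)) (·-multiple (suc k) (suc l) p))
                 (·-multiple (suc l) (suc k) q))

    √-⁻¹ : ∀ {g} → √⟨ A ⟩ g → √⟨ A ⟩ (g ⁻¹)
    √-⁻¹ {g} (k , p) = k , respects (sym (inverse-· (suc k))) (inverse p)
      where
      inverse-· : ∀ n → n · (g ⁻¹) ≈ (n · g) ⁻¹
      inverse-· zero    = sym ε⁻¹≈ε
      inverse-· (suc n) = trans (∙-congˡ (inverse-· n)) (⁻¹-∙-comm g (n · g))

    √-· : ∀ n {g} → √⟨ A ⟩ g → √⟨ A ⟩ (n · g)
    √-· zero    p = ∈⇒√ identity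
    √-· (suc n) p = √-∙ p (√-· n p)

    √-cancelʳ : ∀ {g h} → √⟨ A ⟩ (g ∙ h) → √⟨ A ⟩ h → √⟨ A ⟩ g
    √-cancelʳ {g} {h} gh∈ h∈ = √-resp (trans (assoc g h (h ⁻¹)) (trans (∙-congˡ (inverseʳ h)) (identityʳ g)))
      (√-∙ gh∈ (√-⁻¹ h∈))

    √-resp-~ : ∀ {g h} → g ~ h → √⟨ A ⟩ h → √⟨ A ⟩ g
    √-resp-~ {g} {h} g~h h∈ = √-cancelʳ {g} {h ⁻¹} (∈⇒√ g~h) (√-⁻¹ h∈)

    -- Multiples are natural here, so the integer multiple of t contained in g appears as a
    -- difference of p and q.
    split : ∀ {t g} → ⟨ t ∷ A ⟩ g → ∃₂ λ p q → g ∙ q · t ~ p · t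
    split (generator (here ≡.refl)) = 1 , 0 , ~-refl
    split (generator (there g∈A))   = 0 , 0 , ~-trans (~-identityʳ _) (∈⇒~ε (generator g∈A))
    split identity                  = 0 , 0 , ~-identityʳ ε
    split {t} (product {g} {h} x y) with split x | split y
    ... | p , q , eq | p′ , q′ , eq′ = p ℕ.+ p′ , q ℕ.+ q′ , (begin
      (g ∙ h) ∙ (q ℕ.+ q′) · t        ≈⟨ ≈⇒~ (∙-congˡ (×-homo-+ t q q′)) ⟩
      (g ∙ h) ∙ (q · t ∙ q′ · t)      ≈⟨ ≈⇒~ (interchange g h (q · t) (q′ · t)) ⟩
      (g ∙ q · t) ∙ (h ∙ q′ · t)      ≈⟨ ~-∙-cong eq eq′ ⟩
      p · t ∙ p′ · t                  ≈⟨ ≈⇒~ (×-homo-+ t p p′) ⟨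
      (p ℕ.+ p′) · t                  ∎)
      where open ~-Reasoning
    split {t} (inverse {g} x) with split x
    ... | p , q , eq = q , p , (begin
      g ⁻¹ ∙ p · t            ≈⟨ ~-∙-congˡ {g ⁻¹} eq ⟨
      g ⁻¹ ∙ (g ∙ q · t)      ≈⟨ ≈⇒~ (assoc (g ⁻¹) g (q · t)) ⟨
      g ⁻¹ ∙ g ∙ q · t        ≈⟨ ≈⇒~ (∙-congʳ (inverseˡ g)) ⟩
      ε ∙ q · t               ≈⟨ ≈⇒~ (identityˡ (q · t)) ⟩
      q · t                   ∎)
      where open ~-Reasoning
    split {t} (respects g≈h x) with split x
    ... | p , q , eq = p , q , ~-trans (≈⇒~ (∙-congʳ (sym g≈h))) eq

    split-√ : ∀ {t g} → √⟨ A ⟩ t → ⟨ t ∷ A ⟩ g → ∃ λ n → g ~ n · t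
    split-√ {t} {g} (k , kt∈) x with split x
    -- Since (k + 1) t vanishes modulo `A`, the negative multiple -q t can be replaced by q k t.
    ... | p , q , eq = p ℕ.+ q ℕ.* k , (begin
      g                             ≈⟨ ≈⇒~ (identityʳ g) ⟨
      g ∙ ε                         ≈⟨ ~-∙-congˡ {g} (∈⇒~ε (·-multiple (suc k) q kt∈)) ⟨
      g ∙ (q ℕ.* suc k) · t         ≡⟨ cong (λ n → g ∙ n · t) (ℕₚ.*-suc q k) ⟩
      g ∙ (q ℕ.+ q ℕ.* k) · t       ≈⟨ ≈⇒~ (∙-congˡ (×-homo-+ t q (q ℕ.* k))) ⟩
      g ∙ (q · t ∙ (q ℕ.* k) · t)   ≈⟨ ≈⇒~ (assoc g (q · t) ((q ℕ.* k) · t)) ⟨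
      (g ∙ q · t) ∙ (q ℕ.* k) · t   ≈⟨ ~-∙-congʳ eq ⟩
      p · t ∙ (q ℕ.* k) · t         ≈⟨ ≈⇒~ (×-homo-+ t p (q ℕ.* k)) ⟨
      (p ℕ.+ q ℕ.* k) · t           ∎)
      where open ~-Reasoning

    √-absorb : ∀ {t g} → √⟨ A ⟩ t → √⟨ t ∷ A ⟩ g → √⟨ A ⟩ g
    √-absorb {t} {g} t∈ (k , x) with split-√ t∈ x
    ... | n , kg~nt = √-divide k (√-resp-~ kg~nt (√-· n t∈))

    excess : ∀ f m d → (suc d ℕ.+ m) · f ∙ (m · f) ⁻¹ ≈ suc d · f
    excess f m d = begin
      (suc d ℕ.+ m) · f ∙ (m · f) ⁻¹      ≈⟨ ∙-congʳ (×-homo-+ f (suc d) m) ⟩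
      suc d · f ∙ m · f ∙ (m · f) ⁻¹      ≈⟨ assoc (suc d · f) (m · f) ((m · f) ⁻¹) ⟩
      suc d · f ∙ (m · f ∙ (m · f) ⁻¹)    ≈⟨ ∙-congˡ (inverseʳ (m · f)) ⟩
      suc d · f ∙ ε                       ≈⟨ identityʳ (suc d · f) ⟩
      suc d · f                           ∎
      where open import Relation.Binary.Reasoning.Setoid setoid

    free-multiples : ∀ {f} → ¬ √⟨ A ⟩ f → ∀ m n → √⟨ A ⟩ (m · f ∙ (n · f) ⁻¹) → m ≡ n
    free-multiples {f} f∉ m n x = from (ℕₚ.≤-total m n)
      where
      no-excess : ∀ {m n} → m ≤ n → √⟨ A ⟩ (n · f ∙ (m · f) ⁻¹) → m ≡ n
      no-excess {m} {n} m≤n y with n ∸ m in eq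
      ... | zero  = ℕₚ.≤-antisym m≤n (ℕₚ.m∸n≡0⇒m≤n eq)
      ... | suc d = contradiction (√-divide d (√-resp (excess f m d)
              (subst (λ k → √⟨ A ⟩ (k · f ∙ (m · f) ⁻¹)) n≡ y))) f∉
        where
        n≡ : n ≡ suc d ℕ.+ m
        n≡ = ≡.trans (≡.sym (ℕₚ.m∸n+n≡m m≤n)) (cong (ℕ._+ m) eq)
      from : m ≤ n ⊎ n ≤ m → m ≡ n
      from (inj₁ m≤n) = no-excess m≤n (√-resp (⁻¹-anti-homo‿- (m · f) (n · f)) (√-⁻¹ x))
      from (inj₂ n≤m) = ≡.sym (no-excess n≤m x)

    split-unique : ∀ {f g} → ¬ √⟨ A ⟩ f → ∀ p q → √⟨ A ⟩ g → g ∙ q · f ~ p · f → p ≡ q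
    split-unique {f} {g} f∉ p q g∈ eq = free-multiples f∉ p q (√-resp-~ (begin
      p · f ∙ (q · f) ⁻¹           ≈⟨ ~-∙-congʳ {(q · f) ⁻¹} eq ⟨
      g ∙ q · f ∙ (q · f) ⁻¹       ≈⟨ ≈⇒~ (assoc g (q · f) ((q · f) ⁻¹)) ⟩
      g ∙ (q · f ∙ (q · f) ⁻¹)     ≈⟨ ≈⇒~ (∙-congˡ (inverseʳ (q · f))) ⟩
      g ∙ ε                        ≈⟨ ≈⇒~ (identityʳ g) ⟩
      g                            ∎) g∈)
      where open ~-Reasoning

  √-⊑ : ∀ {A B} → A ⊑ B → ∀ {g} → √⟨ A ⟩ g → √⟨ B ⟩ g
  √-⊑ A⊑B (k , p) = k , ⟨⟩-⊑ A⊑B p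

  -- Modulo `A`, g is p f - q f. As g lies in √⟨ B ⟩ and f has infinite order modulo √⟨ B ⟩, p and q
  -- agree. The larger list B lets several elements be dropped in turn.
  free-drop : ∀ {A B f} → A ⊑ B → ¬ √⟨ B ⟩ f → ∀ {g} → √⟨ B ⟩ g → ⟨ f ∷ A ⟩ g → ⟨ A ⟩ g
  free-drop {A} {B} {f} A⊑B f∉ {g} g∈√B x with split x
  ... | p , q , eq = ~ε⇒∈ (~-cancelʳ (p · f) g ε (begin
    g ∙ p · f  ≡⟨ cong (λ n → g ∙ n · f) (split-unique f∉ p q g∈√B (⟨⟩-⊑ A⊑B eq)) ⟩
    g ∙ q · f  ≈⟨ eq ⟩
    p · f      ≈⟨ ≈⇒~ (identityˡ (p · f)) ⟨
    ε ∙ p · f  ∎))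
    where
    open Mod A
    open ~-Reasoning

  √-free-drop : ∀ {A B f} → A ⊑ B → ¬ √⟨ B ⟩ f → ∀ {g} → √⟨ B ⟩ g → √⟨ f ∷ A ⟩ g → √⟨ A ⟩ g
  √-free-drop A⊑B f∉ g∈√B (k , x) = k , free-drop A⊑B f∉ (√-· (suc k) g∈√B) x

  module _ {p} {K : Carrier → Set p} {A : List Carrier} where
    open Mod A

    -- Sending each representative for K′ to the number of its class in K is injective by the second
    -- assumption.
    index-≤ : ∀ {q} {H : Carrier → Set q} {K′ : Carrier → Set p} {k k′} →
      (∀ {g} → K′ g → K g) → (∀ {g h} → K′ g → K′ h → g ~ h → H (g ∙ h ⁻¹)) →
      HasIndex G K′ H k′ → HasIndex G K ⟨ A ⟩ k → k′ ≤ k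
    index-≤ {H = H} {k = k} K′⊆K ~⇒H (t′ , t′∈ , t′-distinct , _) (t , _ , _ , t-cover) =
      Finₚ.injective⇒≤ {f = class} λ {i} {j} eq → t′-distinct i j
        (~⇒H (t′∈ i) (t′∈ j) (~-trans (proj₂ (t-cover (t′ i) (K′⊆K (t′∈ i))))
          (subst (λ l → t l ~ t′ j) (≡.sym eq) (~-sym (proj₂ (t-cover (t′ j) (K′⊆K (t′∈ j))))))))
      where
      class : Fin _ → Fin k
      class i = proj₁ (t-cover (t′ i) (K′⊆K (t′∈ i)))

    -- Two of the k + 1 multiples 0 g, ..., k g share one of the k classes, and their difference is
    -- a positive multiple of g in ⟨ A ⟩. Applied to the real saturation, this removes the reals.
    finite-index⇒√ : ∀ {k} → HasIndex G K ⟨ A ⟩ k → ∀ {g} → (∀ n → K (n · g)) → √⟨ A ⟩ g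
    finite-index⇒√ {k} (t , _ , _ , cover) {g} multiples
      with Finₚ.pigeonhole (ℕₚ.n<1+n k) (λ i → proj₁ (cover (toℕ i · g) (multiples (toℕ i))))
    ... | i , j , i<j , eq = toℕ j ∸ suc (toℕ i) , ~ε⇒∈ (~-cancelˡ (toℕ i · g) (suc (toℕ j ∸ suc (toℕ i)) · g) ε (begin
      toℕ i · g ∙ suc (toℕ j ∸ suc (toℕ i)) · g  ≈⟨ ≈⇒~ (×-homo-+ g (toℕ i) (suc (toℕ j ∸ suc (toℕ i)))) ⟨
      (toℕ i ℕ.+ suc (toℕ j ∸ suc (toℕ i))) · g  ≡⟨ cong (_· g) (≡.trans (ℕₚ.+-suc (toℕ i) _) (ℕₚ.m+[n∸m]≡n i<j)) ⟩
      toℕ j · g                                  ≈⟨ proj₂ (cover (toℕ j · g) (multiples (toℕ j))) ⟩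
      t (proj₁ (cover (toℕ j · g) (multiples (toℕ j)))) ≡⟨ cong t eq ⟨
      t (proj₁ (cover (toℕ i · g) (multiples (toℕ i)))) ≈⟨ proj₂ (cover (toℕ i · g) (multiples (toℕ i))) ⟨
      toℕ i · g                                  ≈⟨ ≈⇒~ (identityʳ (toℕ i · g)) ⟨
      toℕ i · g ∙ ε                              ∎))
      where open ~-Reasoning

  index-transport : ∀ {p p′ q q′} {K : Carrier → Set p} {K′ : Carrier → Set p′}
    {H : Carrier → Set q} {H′ : Carrier → Set q′} {k} →
    (∀ {g} → K g → K′ g) → (∀ {g} → K′ g → K g) → (∀ {g} → H g → H′ g) → (∀ {g} → H′ g → H g) →
    HasIndex G K H k → HasIndex G K′ H′ k
  index-transport K⊆K′ K′⊆K H⊆H′ H′⊆H (t , t∈ , t-distinct , t-cover) =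
    t , (λ i → K⊆K′ (t∈ i)) , (λ i j → t-distinct i j ∘ H′⊆H)
    , λ g g∈ → proj₁ (t-cover g (K′⊆K g∈)) , H⊆H′ (proj₂ (t-cover g (K′⊆K g∈)))

  index-unique : ∀ {p} {K : Carrier → Set p} {A k k′} →
    HasIndex G K ⟨ A ⟩ k → HasIndex G K ⟨ A ⟩ k′ → k ≡ k′
  index-unique {K = K} {A} h h′ = ℕₚ.≤-antisym
    (index-≤ {K = K} {A} {H = ⟨ A ⟩} (λ x → x) (λ _ _ x → x) h h′)
    (index-≤ {K = K} {A} {H = ⟨ A ⟩} (λ x → x) (λ _ _ x → x) h′ h)

  module _ {A : List Carrier} {k} (index : HasIndex G √⟨ A ⟩ ⟨ A ⟩ k) where
    open Mod A

    -- An element of √⟨ A ⟩ lies in ⟨ A ⟩ exactly when its class has the same number as the class of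
    -- ε, and numbers can be compared.
    member? : ∀ {g} → √⟨ A ⟩ g → Dec (⟨ A ⟩ g)
    member? {g} g∈√ = from index
      where
      from : HasIndex G √⟨ A ⟩ ⟨ A ⟩ k → Dec (⟨ A ⟩ g)
      from (t , _ , distinct , cover) with cover g g∈√ | cover ε (∈⇒√ identity)
      ... | i , g~tᵢ | i₀ , ε~t₀ with i Finₚ.≟ i₀
      ...   | yes ≡.refl = yes (~ε⇒∈ (~-trans g~tᵢ (~-sym ε~t₀)))
      ...   | no i≢i₀ = no λ g∈ → i≢i₀ (distinct i i₀
              (~-trans (~-sym g~tᵢ) (~-trans (∈⇒~ε g∈) ε~t₀)))

    index-positive : 0 < k
    index-positive = from index
      where
      from : HasIndex G √⟨ A ⟩ ⟨ A ⟩ k → 0 < k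
      from (_ , _ , _ , cover) with cover ε (∈⇒√ identity)
      ... | i , _ = ℕₚ.≤-<-trans ℕ.z≤n (Finₚ.toℕ<n i)

    -- The least positive multiple of t in ⟨ A ⟩ divides all others: the remainder of n would give a
    -- smaller one.
    order : ∀ {t} → √⟨ A ⟩ t → ∃ λ K → ⟨ A ⟩ (suc K · t) × (∀ n → ⟨ A ⟩ (n · t) → suc K ∣ n)
    order {t} t∈√ with least (λ n → member? (√-· (suc n) t∈√)) (proj₁ t∈√) (proj₂ t∈√)
    ... | K , Kt∈ , minimal = K , Kt∈ , λ n nt∈ → m%n≡0⇒n∣m n (suc K) (remainder-0 n nt∈)
      where
      open ~-Reasoning
      remainder∈ : ∀ n → ⟨ A ⟩ (n · t) → ⟨ A ⟩ ((n % suc K) · t)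
      remainder∈ n nt∈ = ~ε⇒∈ (begin
        (n % suc K) · t                                   ≈⟨ ≈⇒~ (identityʳ ((n % suc K) · t)) ⟨
        (n % suc K) · t ∙ ε                               ≈⟨ ~-∙-congˡ {(n % suc K) · t} (·-~ε (n / suc K) (∈⇒~ε Kt∈)) ⟨
        (n % suc K) · t ∙ (n / suc K) · (suc K · t)       ≈⟨ ≈⇒~ (∙-congˡ (×-assocˡ t (n / suc K) (suc K))) ⟩
        (n % suc K) · t ∙ (n / suc K ℕ.* suc K) · t       ≈⟨ ≈⇒~ (×-homo-+ t (n % suc K) (n / suc K ℕ.* suc K)) ⟨
        (n % suc K ℕ.+ n / suc K ℕ.* suc K) · t           ≡⟨ cong (_· t) (m≡m%n+[m/n]*n n (suc K)) ⟨
        n · t                                             ≈⟨ ∈⇒~ε nt∈ ⟩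
        ε                                                 ∎)
      remainder-0 : ∀ n → ⟨ A ⟩ (n · t) → n % suc K ≡ 0
      remainder-0 n nt∈ with n % suc K in eq | remainder∈ n nt∈ | m%n<n n (suc K)
      ... | zero  | _  | _ = ≡.refl
      ... | suc r | x  | s<s r<K = contradiction x (minimal r<K)

  module _ {A : List Carrier} {t K} (Kt∈ : ⟨ A ⟩ (suc K · t)) (order∣ : ∀ n → ⟨ A ⟩ (n · t) → suc K ∣ n) where
    open Mod A
    open ~-Reasoning

    private
      t∈√ : √⟨ A ⟩ t
      t∈√ = K , Kt∈

    reduce : ∀ n → n · t ~ toℕ (fromℕ< (m%n<n n (suc K))) · t
    reduce n = begin
      n · t                                         ≡⟨ cong (_· t) (m≡m%n+[m/n]*n n (suc K)) ⟩
      (n % suc K ℕ.+ n / suc K ℕ.* suc K) · t       ≈⟨ ≈⇒~ (×-homo-+ t (n % suc K) (n / suc K ℕ.* suc K)) ⟩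
      (n % suc K) · t ∙ (n / suc K ℕ.* suc K) · t   ≈⟨ ≈⇒~ (∙-congˡ (×-assocˡ t (n / suc K) (suc K))) ⟨
      (n % suc K) · t ∙ (n / suc K) · (suc K · t)   ≈⟨ ~-∙-congˡ {(n % suc K) · t} (·-~ε (n / suc K) (∈⇒~ε Kt∈)) ⟩
      (n % suc K) · t ∙ ε                           ≈⟨ ≈⇒~ (identityʳ ((n % suc K) · t)) ⟩
      (n % suc K) · t                               ≡⟨ cong (_· t) (Finₚ.toℕ-fromℕ< (m%n<n n (suc K))) ⟨
      toℕ (fromℕ< (m%n<n n (suc K))) · t            ∎

    small-multiples : ∀ {i j} → i ≤ j → j < suc K → i · t ~ j · t → i ≡ j
    small-multiples {i} {j} i≤j j<K it~jt = ℕₚ.≤-antisym i≤j (ℕₚ.m∸n≡0⇒m≤n difference-0)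
      where
      difference∈ : ⟨ A ⟩ ((j ∸ i) · t)
      difference∈ = ~ε⇒∈ (~-cancelʳ (i · t) ((j ∸ i) · t) ε (begin
        (j ∸ i) · t ∙ i · t   ≈⟨ ≈⇒~ (×-homo-+ t (j ∸ i) i) ⟨
        (j ∸ i ℕ.+ i) · t     ≡⟨ cong (_· t) (ℕₚ.m∸n+n≡m i≤j) ⟩
        j · t                 ≈⟨ it~jt ⟨
        i · t                 ≈⟨ ≈⇒~ (identityˡ (i · t)) ⟨
        ε ∙ i · t             ∎))
      difference-0 : j ∸ i ≡ 0
      difference-0 with j ∸ i in eq | order∣ (j ∸ i) difference∈
      ... | zero  | _ = ≡.refl
      ... | suc d | K∣d = contradiction (ℕₚ.≤-<-trans (∣⇒≤ K∣d)
              (ℕₚ.≤-<-trans (subst (_≤ j) eq (ℕₚ.m∸n≤m j i)) j<K)) (ℕₚ.<-irrefl ≡.refl)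

    -- As t lies in √⟨ A ⟩, both saturations agree, and ⟨ t ∷ A ⟩ / ⟨ A ⟩ is cyclic of order K + 1.
    -- Representatives are the sᵢ + j t with j ≤ K.
    index-step : ∀ {d} → HasIndex G √⟨ t ∷ A ⟩ ⟨ t ∷ A ⟩ d → HasIndex G √⟨ A ⟩ ⟨ A ⟩ (d ℕ.* suc K)
    index-step {d} (s , s∈ , s-distinct , s-cover) = rep , rep∈ , distinct , cover
      where
      pick : Fin d × Fin (suc K) → Carrier
      pick (i , j) = s i ∙ toℕ j · t
      rep : Fin (d ℕ.* suc K) → Carrier
      rep = pick ∘ remQuot {d} (suc K)
      rep∈ : ∀ x → √⟨ A ⟩ (rep x)
      rep∈ x = √-∙ (√-absorb t∈√ (s∈ i)) (√-· (toℕ j) t∈√)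
        where
        i = proj₁ (remQuot {d} (suc K) x)
        j = proj₂ (remQuot {d} (suc K) x)
      pick-distinct : ∀ x y → pick x ~ pick y → x ≡ y
      pick-distinct (i , j) (i′ , j′) eq with s-distinct i i′ sᵢ~sᵢ′
        where
        module tA = Mod (t ∷ A)
        multiple : ∀ g n → g tA.~ g ∙ n · t
        multiple g n = tA.~-trans (tA.~-sym (tA.≈⇒~ (identityʳ g)))
          (tA.~-∙-congˡ {g} (tA.~-sym (tA.·-~ε n (tA.∈⇒~ε (generator (here ≡.refl))))))
        sᵢ~sᵢ′ : s i tA.~ s i′
        sᵢ~sᵢ′ = tA.~-trans (multiple (s i) (toℕ j))
          (tA.~-trans (⟨⟩-⊑ there eq) (tA.~-sym (multiple (s i′) (toℕ j′))))
      ... | ≡.refl = cong (i ,_) (Finₚ.toℕ-injective (same (ℕₚ.≤-total (toℕ j) (toℕ j′))))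
        where
        jt~j′t : toℕ j · t ~ toℕ j′ · t
        jt~j′t = ~-cancelˡ (s i) (toℕ j · t) (toℕ j′ · t) eq
        same : toℕ j ≤ toℕ j′ ⊎ toℕ j′ ≤ toℕ j → toℕ j ≡ toℕ j′
        same (inj₁ j≤j′) = small-multiples j≤j′ (Finₚ.toℕ<n j′) jt~j′t
        same (inj₂ j′≤j) = ≡.sym (small-multiples j′≤j (Finₚ.toℕ<n j) (~-sym jt~j′t))
      distinct : ∀ x y → rep x ~ rep y → x ≡ y
      distinct x y eq = ≡.trans (≡.sym (Finₚ.combine-remQuot {d} (suc K) x))
        (≡.trans (cong (λ (i , j) → combine i j) (pick-distinct (remQuot (suc K) x) (remQuot (suc K) y) eq))
                 (Finₚ.combine-remQuot {d} (suc K) y))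
      cover : ∀ g → √⟨ A ⟩ g → ∃ λ x → g ~ rep x
      cover g g∈ with s-cover g (√-⊑ there g∈)
      ... | i , x with split-√ t∈√ x
      ...   | n , gs⁻¹~nt = combine i j , (begin
        g                          ≈⟨ ≈⇒~ (identityʳ g) ⟨
        g ∙ ε                      ≈⟨ ≈⇒~ (∙-congˡ (inverseˡ (s i))) ⟨
        g ∙ (s i ⁻¹ ∙ s i)         ≈⟨ ≈⇒~ (assoc g (s i ⁻¹) (s i)) ⟨
        g ∙ s i ⁻¹ ∙ s i           ≈⟨ ~-∙-congʳ {s i} gs⁻¹~nt ⟩
        n · t ∙ s i                ≈⟨ ≈⇒~ (comm (n · t) (s i)) ⟩
        s i ∙ n · t                ≈⟨ ~-∙-congˡ {s i} (reduce n) ⟩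
        pick (i , j)               ≡⟨ cong pick (Finₚ.remQuot-combine i j) ⟨
        rep (combine i j)          ∎)
        where j = fromℕ< (m%n<n n (suc K))

-- Counting

open import Algebra.Properties.Semiring.Sum ℕₚ.+-*-semiring

𝟙 : Dec P → ℕ
𝟙 (yes _) = 1
𝟙 (no  _) = 0

𝟙-⇔ : (P → Q) → (Q → P) → (p? : Dec P) (q? : Dec Q) → 𝟙 p? ≡ 𝟙 q?
𝟙-⇔ P→Q Q→P (yes _) (yes _)  = ≡.refl
𝟙-⇔ P→Q Q→P (yes x) (no ¬y)  = contradiction (P→Q x) ¬y
𝟙-⇔ P→Q Q→P (no ¬x) (yes y)  = contradiction (Q→P y) ¬x
𝟙-⇔ P→Q Q→P (no _)  (no _)   = ≡.refl

𝟙-yes : P → (p? : Dec P) → 𝟙 p? ≡ 1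
𝟙-yes x p? = 𝟙-⇔ (λ y → y) (λ y → y) p? (yes x)

𝟙-no : ¬ P → (p? : Dec P) → 𝟙 p? ≡ 0
𝟙-no ¬x p? = 𝟙-⇔ (λ y → y) (λ y → y) p? (no ¬x)

sum-1 : ∀ n → sum {n} (λ _ → 1) ≡ n
sum-1 zero    = ≡.refl
sum-1 (suc n) = cong suc (sum-1 n)

sum-0 : ∀ {n} {f : Fin n → ℕ} → (∀ i → f i ≡ 0) → sum f ≡ 0
sum-0 {n} f≡0 = ≡.trans (sum-cong-≋ f≡0) (sum-replicate-zero n)

sum-𝟙-≟ : ∀ {n} (i : Fin n) → sum (λ x → 𝟙 (i Finₚ.≟ x)) ≡ 1
sum-𝟙-≟ {suc n} zero    = cong suc (sum-0 {n} λ x → 𝟙-no (λ ()) (zero Finₚ.≟ suc x))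
sum-𝟙-≟ {suc n} (suc i) = ≡.trans
  (sum-cong-≋ λ x → 𝟙-⇔ Finₚ.suc-injective (cong suc) (suc i Finₚ.≟ suc x) (i Finₚ.≟ x))
  (sum-𝟙-≟ i)

-- Double counting of the pairs (i, x) with f i ≡ x: over each x there is one pair if P x holds and
-- none otherwise.
count-image : ∀ {k n} {P : Fin n → Set p} (P? : ∀ x → Dec (P x)) (f : Fin k → Fin n) →
  (∀ {i j} → f i ≡ f j → i ≡ j) → (∀ i → P (f i)) → (∀ x → P x → ∃ λ i → f i ≡ x) →
  sum (λ x → 𝟙 (P? x)) ≡ k
count-image {k = k} {n} P? f f-injective P∘f surjective = begin
  sum (λ x → 𝟙 (P? x))                        ≡⟨ sum-cong-≋ fibre ⟩
  sum (λ x → sum (λ i → 𝟙 (f i Finₚ.≟ x)))    ≡⟨ ∑-comm (λ x i → 𝟙 (f i Finₚ.≟ x)) ⟩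
  sum (λ i → sum (λ x → 𝟙 (f i Finₚ.≟ x)))    ≡⟨ sum-cong-≋ {k} (λ i → sum-𝟙-≟ (f i)) ⟩
  sum {k} (λ _ → 1)                           ≡⟨ sum-1 k ⟩
  k                                           ∎
  where
  open ≡.≡-Reasoning
  fibre : ∀ x → 𝟙 (P? x) ≡ sum (λ i → 𝟙 (f i Finₚ.≟ x))
  fibre x with P? x
  ... | no ¬Px = ≡.sym (sum-0 {k} λ i → 𝟙-no (λ eq → ¬Px (subst _ eq (P∘f i))) (f i Finₚ.≟ x))
  ... | yes Px with surjective x Px
  ...   | i₀ , ≡.refl = ≡.sym (≡.trans
    (sum-cong-≋ {k} λ i → 𝟙-⇔ (≡.sym ∘ f-injective) (λ i₀≡i → cong f (≡.sym i₀≡i)) (f i Finₚ.≟ f i₀) (i₀ Finₚ.≟ i))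
    (sum-𝟙-≟ i₀))

-- The solutions of K x + s ≡ 0 modulo N = K L are the x ≡ - s / K modulo L.
count-solutions : ∀ {N} K L .{{_ : NonZero K}} s → N ≡ K ℕ.* suc L → K ∣ s →
  sum {N} (λ x → 𝟙 (N ∣? K ℕ.* toℕ x ℕ.+ s)) ≡ K
count-solutions K L _ ≡.refl (divides s ≡.refl) =
  count-image (λ x → K ℕ.* suc L ∣? K ℕ.* toℕ x ℕ.+ s ℕ.* K) solution
    (λ {i} {j} → Finₚ.combine-injectiveˡ i r j r)
    solves unique
  where
  open ℕ-Solver
  -- L is -1 modulo L + 1, so the residue r of L s represents -s; m is the quotient of this
  -- division.
  m = (L ℕ.* s) / suc L
  r : Fin (suc L)
  r = fromℕ< (m%n<n (L ℕ.* s) (suc L))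

  L∣r+s : suc L ∣ toℕ r ℕ.+ s
  L∣r+s = ∣m+n∣m⇒∣n (subst (suc L ∣_) total (m∣m*n s)) (n∣m*n m)
    where
    total : suc L ℕ.* s ≡ m ℕ.* suc L ℕ.+ (toℕ r ℕ.+ s)
    total = begin
      s ℕ.+ L ℕ.* s                                  ≡⟨ cong (s ℕ.+_) (m≡m%n+[m/n]*n (L ℕ.* s) (suc L)) ⟩
      s ℕ.+ ((L ℕ.* s) % suc L ℕ.+ m ℕ.* suc L)      ≡⟨ cong (λ z → s ℕ.+ (z ℕ.+ m ℕ.* suc L)) (Finₚ.toℕ-fromℕ< (m%n<n (L ℕ.* s) (suc L))) ⟨
      s ℕ.+ (toℕ r ℕ.+ m ℕ.* suc L)                  ≡⟨ solve 3 (λ a b c → a :+ (b :+ c) := c :+ (b :+ a)) ≡.refl s (toℕ r) (m ℕ.* suc L) ⟩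
      m ℕ.* suc L ℕ.+ (toℕ r ℕ.+ s)                  ∎
      where open ≡.≡-Reasoning

  solution : Fin K → Fin (K ℕ.* suc L)
  solution j = combine j r

  factor : ∀ x → K ℕ.* x ℕ.+ s ℕ.* K ≡ K ℕ.* (x ℕ.+ s)
  factor x = solve 3 (λ k x s → k :* x :+ s :* k := k :* (x :+ s)) ≡.refl K x s

  solves : ∀ j → K ℕ.* suc L ∣ K ℕ.* toℕ (solution j) ℕ.+ s ℕ.* K
  solves j = subst (K ℕ.* suc L ∣_) (≡.sym (factor (toℕ (combine j r))))
    (*-monoʳ-∣ K (subst (λ x → suc L ∣ x ℕ.+ s) (≡.sym (Finₚ.toℕ-combine j r))
      (subst (suc L ∣_) (≡.sym (ℕₚ.+-assoc (suc L ℕ.* toℕ j) (toℕ r) s)) (∣m∣n⇒∣m+n (m∣m*n (toℕ j)) L∣r+s))))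

  unique : ∀ x → K ℕ.* suc L ∣ K ℕ.* toℕ x ℕ.+ s ℕ.* K → ∃ λ j → solution j ≡ x
  unique x N∣ with Finₚ.combine-surjective {K} {suc L} x
  ... | j , r′ , ≡.refl = j , cong (combine j) (Finₚ.toℕ-injective (residue-unique L∣r+s L∣r′+s))
    where
    L∣r′+s : suc L ∣ toℕ r′ ℕ.+ s
    L∣r′+s = ∣m+n∣m⇒∣n (subst (suc L ∣_)
      (≡.trans (cong (ℕ._+ s) (Finₚ.toℕ-combine j r′)) (ℕₚ.+-assoc (suc L ℕ.* toℕ j) (toℕ r′) s))
      (*-cancelˡ-∣ K (subst (K ℕ.* suc L ∣_) (factor (toℕ (combine j r′))) N∣))) (m∣m*n (toℕ j))
    residue-≤ : ∀ {x y : Fin (suc L)} → suc L ∣ toℕ x ℕ.+ s → suc L ∣ toℕ y ℕ.+ s →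
      toℕ x ℕ.≤ toℕ y → toℕ x ≡ toℕ y
    residue-≤ {x} {y} x+s y+s x≤y = ℕₚ.≤-antisym x≤y (ℕₚ.m∸n≡0⇒m≤n difference-0)
      where
      difference : suc L ∣ toℕ y ℕ.∸ toℕ x
      difference = ∣m+n∣m⇒∣n (subst (suc L ∣_) (≡.trans
        (cong (ℕ._+ s) (≡.sym (ℕₚ.m+[n∸m]≡n x≤y)))
        (solve 3 (λ a b c → a :+ b :+ c := a :+ c :+ b) ≡.refl (toℕ x) (toℕ y ℕ.∸ toℕ x) s)) y+s) x+s
      difference-0 : toℕ y ℕ.∸ toℕ x ≡ 0
      difference-0 with toℕ y ℕ.∸ toℕ x in eq | difference
      ... | zero  | _ = ≡.refl
      ... | suc d | L∣d = contradiction
        (ℕₚ.≤-<-trans (∣⇒≤ L∣d) (ℕₚ.≤-<-trans (subst (ℕ._≤ toℕ y) eq (ℕₚ.m∸n≤m (toℕ y) (toℕ x))) (Finₚ.toℕ<n y)))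
        (ℕₚ.<-irrefl ≡.refl)
    residue-unique : suc L ∣ toℕ r ℕ.+ s → suc L ∣ toℕ r′ ℕ.+ s → toℕ r ≡ toℕ r′
    residue-unique h h′ with ℕₚ.≤-total (toℕ r) (toℕ r′)
    ... | inj₁ r≤r′ = residue-≤ {r} {r′} h h′ r≤r′
    ... | inj₂ r′≤r = ≡.sym (residue-≤ {r′} {r} h′ h r′≤r)

-- Multiplicities of lists of labels

module _ {c ℓ} (G : AbelianGroup c ℓ) where
  open AbelianGroup G hiding (identity; inverse)
  open GeneratedSubgroups G

  module IndexedFamily
    {a} {E : Set a} (el : E → Carrier) (μ : List E → ℕ)
    (index : ∀ A → HasIndex G √⟨ map el A ⟩ ⟨ map el A ⟩ (μ A))
    (√? : ∀ A g → Dec (√⟨ map el A ⟩ g))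
    where
    open import Algebra.Properties.CommutativeSemigroup commutativeSemigroup using (interchange)

    ⟪_⟫ √⟪_⟫ : List E → Carrier → Set (c ⊔ ℓ)
    ⟪ A ⟫ = ⟨ map el A ⟩
    √⟪ A ⟫ = √⟨ map el A ⟩

    module ⟪Mod⟫ (A : List E) = Mod (map el A)

    ⟪⟫-⊑ : ∀ {A B} → A ⊑ B → ∀ {g} → ⟪ A ⟫ g → ⟪ B ⟫ g
    ⟪⟫-⊑ A⊑B = ⟨⟩-⊑ (⊑.map⁺ el A⊑B)

    √⟪⟫-⊑ : ∀ {A B} → A ⊑ B → ∀ {g} → √⟪ A ⟫ g → √⟪ B ⟫ g
    √⟪⟫-⊑ A⊑B = √-⊑ (⊑.map⁺ el A⊑B)

    ⟪⟫-· : ∀ {A g} n → ⟪ A ⟫ g → ⟪ A ⟫ (n · g)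
    ⟪⟫-· {A} n p = ~ε⇒∈ (·-~ε n (∈⇒~ε p))
      where open ⟪Mod⟫ A

    √⟪⟫-absorb : ∀ {A} T → (∀ {t} → t ∈ T → √⟪ A ⟫ (el t)) → ∀ {g} → √⟪ T ++ A ⟫ g → √⟪ A ⟫ g
    √⟪⟫-absorb []      T⊆ x = x
    √⟪⟫-absorb {A} (t ∷ T) T⊆ x = √⟪⟫-absorb T (T⊆ ∘ there)
      (√-absorb (√⟪⟫-⊑ (⊑.xs⊆ys++xs A T) (T⊆ (here ≡.refl))) x)

    ∈? : ∀ A g → Dec (⟪ A ⟫ g)
    ∈? A g with √? A g
    ... | yes g∈√ = member? (index A) g∈√
    ... | no  g∉√ = no (g∉√ ∘ ∈⇒√)

    μ-⊑ : ∀ {A B} → A ⊑ B → B ⊑ A → μ A ≡ μ B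
    μ-⊑ {A} {B} A⊑B B⊑A = index-unique (index A)
      (index-transport {K = √⟪ B ⟫} {√⟪ A ⟫} {⟪ B ⟫} {⟪ A ⟫} (√⟪⟫-⊑ B⊑A) (√⟪⟫-⊑ A⊑B) (⟪⟫-⊑ B⊑A) (⟪⟫-⊑ A⊑B) (index B))

    μ-↭ : ∀ {A B} → A ↭ B → μ A ≡ μ B
    μ-↭ A↭B = μ-⊑ (⊑.⊆-reflexive-↭ A↭B) (⊑.⊆-reflexive-↭ (↭-sym A↭B))

    μ-step : ∀ {A t K} → ⟪ A ⟫ (suc K · el t) → (∀ n → ⟪ A ⟫ (n · el t) → suc K ∣ n) →
      μ A ≡ μ (t ∷ A) ℕ.* suc K
    μ-step {A} {t} Kt∈ order∣ = index-unique (index A) (index-step Kt∈ order∣ (index (t ∷ A)))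

    Independent : List E → List E → Set (c ⊔ ℓ)
    Independent R []      = ⊤
    Independent R (f ∷ F) = ¬ √⟪ F ++ R ⟫ (el f) × Independent R F

    -- Loops do not enlarge √⟪ R ⟫, so A stays independent over T ++ R and its members are peeled
    -- off one at a time by `free-drop`.
    independent-drop : ∀ {R} A T → Independent R A → (∀ {t} → t ∈ T → √⟪ R ⟫ (el t)) →
      ∀ {g} → √⟪ R ⟫ g → ⟪ A ++ T ++ R ⟫ g → ⟪ T ++ R ⟫ g
    independent-drop {R} []      T _ T⊆ g∈√ x = x
    independent-drop {R} (f ∷ A) T (f∉ , indep) T⊆ {g} g∈√ x =
      independent-drop A T indep T⊆ g∈√ (free-drop (λ y → y) f∉′ g∈√′ x)
      where
      R⊑ : R ⊑ A ++ T ++ R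
      R⊑ = ⊑.⊆-trans (⊑.xs⊆ys++xs R T) (⊑.xs⊆ys++xs (T ++ R) A)
      g∈√′ : √⟪ A ++ T ++ R ⟫ g
      g∈√′ = √⟪⟫-⊑ R⊑ g∈√
      f∉′ : ¬ √⟪ A ++ T ++ R ⟫ (el f)
      f∉′ y = f∉ (√⟪⟫-absorb T (√⟪⟫-⊑ (⊑.xs⊆ys++xs R A) ∘ T⊆)
        (√⟪⟫-⊑ (⊑.⊆-reflexive-↭ (shifts A T)) y))

    -- Adding t ∈ T divides both μ (T ++ A ++ R) and μ (T ++ R) by the order of t,
    -- which is the same modulo either subgroup.
    μ-modular : ∀ {R} A T → Independent R A → (∀ {t} → t ∈ T → √⟪ R ⟫ (el t)) →
      μ (T ++ A ++ R) ℕ.* μ R ≡ μ (A ++ R) ℕ.* μ (T ++ R)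
    μ-modular A []      indep T⊆ = ≡.refl
    μ-modular {R} A (t ∷ T) indep T⊆ = from (order (index (T ++ R)) t∈√)
      where
      open ≡.≡-Reasoning
      t∈√ : √⟪ T ++ R ⟫ (el t)
      t∈√ = √⟪⟫-⊑ (⊑.xs⊆ys++xs R T) (T⊆ (here ≡.refl))
      TR⊑ : T ++ R ⊑ T ++ A ++ R
      TR⊑ = ⊑.++⁺ʳ T (⊑.xs⊆ys++xs R A)
      drop : ∀ n → ⟪ T ++ A ++ R ⟫ (n · el t) → ⟪ T ++ R ⟫ (n · el t)
      drop n x = independent-drop A T indep (T⊆ ∘ there) (√-· n (T⊆ (here ≡.refl)))
        (⟪⟫-⊑ (⊑.⊆-reflexive-↭ (shifts T A)) x)
      from : (∃ λ K → ⟪ T ++ R ⟫ (suc K · el t) × (∀ n → ⟪ T ++ R ⟫ (n · el t) → suc K ∣ n)) →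
        μ (t ∷ T ++ A ++ R) ℕ.* μ R ≡ μ (A ++ R) ℕ.* μ (t ∷ T ++ R)
      from (K , Kt∈ , order∣) = ℕₚ.*-cancelʳ-≡ (μ (t ∷ T ++ A ++ R) ℕ.* μ R) (μ (A ++ R) ℕ.* μ (t ∷ T ++ R)) (suc K) (begin
        μ (t ∷ T ++ A ++ R) ℕ.* μ R ℕ.* suc K      ≡⟨ *-swapʳ (μ (t ∷ T ++ A ++ R)) (μ R) (suc K) ⟩
        μ (t ∷ T ++ A ++ R) ℕ.* suc K ℕ.* μ R      ≡⟨ cong (ℕ._* μ R) (μ-step {T ++ A ++ R} {t} {K} (⟪⟫-⊑ TR⊑ Kt∈) (λ n → order∣ n ∘ drop n)) ⟨
        μ (T ++ A ++ R) ℕ.* μ R                    ≡⟨ μ-modular A T indep (T⊆ ∘ there) ⟩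
        μ (A ++ R) ℕ.* μ (T ++ R)                  ≡⟨ cong (μ (A ++ R) ℕ.*_) (μ-step {T ++ R} {t} {K} Kt∈ order∣) ⟩
        μ (A ++ R) ℕ.* (μ (t ∷ T ++ R) ℕ.* suc K)  ≡⟨ ℕₚ.*-assoc (μ (A ++ R)) (μ (t ∷ T ++ R)) (suc K) ⟨
        μ (A ++ R) ℕ.* μ (t ∷ T ++ R) ℕ.* suc K    ∎)
        where
        *-swapʳ : ∀ x y z → x ℕ.* y ℕ.* z ≡ x ℕ.* z ℕ.* y
        *-swapʳ = solve 3 (λ x y z → x :* y :* z := x :* z :* y) ≡.refl
          where open ℕ-Solver

    -- Natural coefficients suffice because T will have finite order modulo the subgroup in
    -- question; see `comb-complete`.
    comb : (T : List E) → Vec ℕ (length T) → Carrier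
    comb []      []      = ε
    comb (t ∷ T) (n ∷ c) = n · el t ∙ comb T c

    axpy : ∀ {k} → ℕ → Vec ℕ k → Vec ℕ k → Vec ℕ k
    axpy k = zipWith λ m n → m ℕ.+ k ℕ.* n

    comb-axpy : ∀ T k c d → comb T (axpy k c d) ≈ comb T c ∙ k · comb T d
    comb-axpy []      k []      []      = trans (sym (k·ε k)) (sym (identityˡ _))
      where
      k·ε : ∀ k → k · ε ≈ ε
      k·ε zero    = refl
      k·ε (suc k) = trans (identityˡ _) (k·ε k)
    comb-axpy (t ∷ T) k (m ∷ c) (n ∷ d) = begin
      (m ℕ.+ k ℕ.* n) · el t ∙ comb T (axpy k c d)
        ≈⟨ ∙-cong (×-homo-+ (el t) m (k ℕ.* n)) (comb-axpy T k c d) ⟩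
      (m · el t ∙ (k ℕ.* n) · el t) ∙ (comb T c ∙ k · comb T d)
        ≈⟨ interchange _ _ _ _ ⟩
      (m · el t ∙ comb T c) ∙ ((k ℕ.* n) · el t ∙ k · comb T d)
        ≈⟨ ∙-congˡ (∙-congʳ (×-assocˡ (el t) k n)) ⟨
      (m · el t ∙ comb T c) ∙ (k · (n · el t) ∙ k · comb T d)
        ≈⟨ ∙-congˡ (×-distrib-+ (n · el t) (comb T d) k) ⟨
      (m · el t ∙ comb T c) ∙ k · (n · el t ∙ comb T d) ∎
      where open import Relation.Binary.Reasoning.Setoid setoid

    comb-0 : ∀ T → comb T (replicate (length T) 0) ≈ ε
    comb-0 []      = refl
    comb-0 (t ∷ T) = trans (identityˡ _) (comb-0 T)

    comb∈ : ∀ {A} T c → ⟪ T ++ A ⟫ (comb T c)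
    comb∈ []      []      = identity
    comb∈ (t ∷ T) (n ∷ c) = product (⟪⟫-· n (generator (here ≡.refl))) (⟪⟫-⊑ there (comb∈ T c))

    comb-complete : ∀ {A} T → (∀ {t} → t ∈ T → √⟪ A ⟫ (el t)) → ∀ {g} → ⟪ T ++ A ⟫ g →
      ∃ λ c → ⟪Mod⟫._~_ A g (comb T c)
    comb-complete {A} []      T⊆ x = [] , ⟪Mod⟫.∈⇒~ε A x
    comb-complete {A} (t ∷ T) T⊆ {g} x with split-√ (√⟪⟫-⊑ (⊑.xs⊆ys++xs A T) (T⊆ (here ≡.refl))) x
    ... | n , g-nt∈ with comb-complete T (T⊆ ∘ there) g-nt∈
    ...   | c , g-nt~c = n ∷ c , (begin
      g                                   ≈⟨ ≈⇒~ (identityʳ g) ⟨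
      g ∙ ε                               ≈⟨ ≈⇒~ (∙-congˡ (inverseˡ (n · el t))) ⟨
      g ∙ ((n · el t) ⁻¹ ∙ n · el t)      ≈⟨ ≈⇒~ (assoc g ((n · el t) ⁻¹) (n · el t)) ⟨
      g ∙ (n · el t) ⁻¹ ∙ n · el t        ≈⟨ ~-∙-congʳ {n · el t} g-nt~c ⟩
      comb T c ∙ n · el t                 ≈⟨ ≈⇒~ (comm (comb T c) (n · el t)) ⟩
      n · el t ∙ comb T c                 ∎)
      where
      open ⟪Mod⟫ A
      open ~-Reasoning

    -- Characters of ⟪ T ++ A ⟫ / ⟪ A ⟫, given by their values on T in ℤ/N

    -- N will be a common exponent of the classes of T modulo A, so ℤ/N can hold every character.
    -- Written as a successor it provides `zero : Fin N`, and M serves as -1.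
    module Characters (M : ℕ) where

      N : ℕ
      N = suc M

      Annihilated : List E → List E → Set _
      Annihilated A T = ∀ {t} → t ∈ T → ⟪ A ⟫ (N · el t)

      Values : List E → Set
      Values T = Vec (Fin N) (length T)

      dot : ∀ {k} → Vec ℕ k → Vec (Fin N) k → ℕ
      dot []      []      = 0
      dot (n ∷ c) (x ∷ v) = n ℕ.* toℕ x ℕ.+ dot c v

      dot-axpy : ∀ {j} k (c d : Vec ℕ j) v → dot (axpy k c d) v ≡ dot c v ℕ.+ k ℕ.* dot d v
      dot-axpy k []      []      []      = ≡.sym (ℕₚ.*-zeroʳ k)
      dot-axpy k (m ∷ c) (n ∷ d) (x ∷ v) = ≡.trans (cong ((m ℕ.+ k ℕ.* n) ℕ.* toℕ x ℕ.+_) (dot-axpy k c d v))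
        (solve 6 (λ k m n x p q → (m :+ k :* n) :* x :+ (p :+ k :* q) := m :* x :+ p :+ k :* (n :* x :+ q))
          ≡.refl k m n (toℕ x) (dot c v) (dot d v))
        where open ℕ-Solver

      dot-0 : ∀ {k} (v : Vec (Fin N) k) → dot (replicate k 0) v ≡ 0
      dot-0 []      = ≡.refl
      dot-0 (x ∷ v) = dot-0 v

      -- Values on generators define a homomorphism on ⟪ T ++ A ⟫ / ⟪ A ⟫ exactly when they respect
      -- every relation among these generators modulo A.
      Character : (A T : List E) → Values T → Set _
      Character A T v = ∀ c → ⟪ A ⟫ (comb T c) → N ∣ dot c v

      ann⇒√ : ∀ {A T} → Annihilated A T → ∀ {t} → t ∈ T → √⟪ A ⟫ (el t)
      ann⇒√ ann t∈T = M , ann t∈T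

      character-0∷⁻ : ∀ {A t T v} → Character A (t ∷ T) (zero ∷ v) → ⟪ A ⟫ (N · el t) → Character (t ∷ A) T v
      character-0∷⁻ {A} {t} {T} {v} χ Nt∈ c x with split-√ {A = map el A} (M , Nt∈) x
      -- `M ℕ.* n` stands for -n, as N t vanishes modulo A. The value 0 at t makes this entry
      -- contribute nothing.
      ... | n , c~nt = ∣m+n∣m⇒∣n (χ (M ℕ.* n ∷ c) (~ε⇒∈ (begin
        (M ℕ.* n) · el t ∙ comb T c     ≈⟨ ~-∙-congˡ {(M ℕ.* n) · el t} c~nt ⟩
        (M ℕ.* n) · el t ∙ n · el t     ≈⟨ ≈⇒~ (×-homo-+ (el t) (M ℕ.* n) n) ⟨
        (M ℕ.* n ℕ.+ n) · el t          ≡⟨ cong (_· el t) (solve 2 (λ m n → m :* n :+ n := n :* (con 1 :+ m)) ≡.refl M n) ⟩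
        (n ℕ.* N) · el t                ≈⟨ ≈⇒~ (×-assocˡ (el t) n N) ⟨
        n · (N · el t)                  ≈⟨ ·-~ε n (∈⇒~ε Nt∈) ⟩
        ε                               ∎)))
        (subst (N ∣_) (≡.sym (ℕₚ.*-zeroʳ (M ℕ.* n))) (N ∣0))
        where
        open ⟪Mod⟫ A
        open ~-Reasoning
        open ℕ-Solver

      character-0∷⁺ : ∀ {A t T v} → Character (t ∷ A) T v → Character A (t ∷ T) (zero ∷ v)
      character-0∷⁺ {A} {t} {T} {v} χ (n ∷ c) x =
        subst (N ∣_) (cong (ℕ._+ dot c v) (≡.sym (ℕₚ.*-zeroʳ n))) (χ c (~ε⇒∈ (begin
          comb T c                  ≈⟨ ≈⇒~ (identityˡ (comb T c)) ⟨
          ε ∙ comb T c              ≈⟨ ~-∙-congʳ {comb T c} (·-~ε n (∈⇒~ε (generator (here ≡.refl)))) ⟨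
          n · el t ∙ comb T c       ≈⟨ ∈⇒~ε (⟪⟫-⊑ there x) ⟩
          ε                         ∎)))
        where
        open ⟪Mod⟫ (t ∷ A)
        open ~-Reasoning

      -- The relation K t + Σ c₀ᵢ tᵢ = 0 of minimal K decides which values extend
      -- a character from T to t.
      record Relation (A : List E) (t : E) (T : List E) : Set (c ⊔ ℓ) where
        field
          K        : ℕ
          Kt∈      : ⟪ T ++ A ⟫ (suc K · el t)
          order∣   : ∀ n → ⟪ T ++ A ⟫ (n · el t) → suc K ∣ n
          c₀       : Vec ℕ (length T)
          relation : ⟪ A ⟫ (suc K · el t ∙ comb T c₀)

      minimal-relation : ∀ {A t T} → Annihilated A (t ∷ T) → Relation A t T
      minimal-relation {A} {t} {T} ann =
        from (order (index (T ++ A)) (√⟪⟫-⊑ (⊑.xs⊆ys++xs A T) (ann⇒√ ann (here ≡.refl))))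
        where
        open ⟪Mod⟫ A
        from : (∃ λ K → ⟪ T ++ A ⟫ (suc K · el t) × (∀ n → ⟪ T ++ A ⟫ (n · el t) → suc K ∣ n)) → Relation A t T
        from (K , Kt∈ , order∣) = relate (comb-complete T (ann⇒√ (ann ∘ there)) (inverse Kt∈))
          where
          relate : (∃ λ c → (suc K · el t) ⁻¹ ~ comb T c) → Relation A t T
          relate (c₀ , -Kt~c₀) = record
            { K = K; Kt∈ = Kt∈; order∣ = order∣; c₀ = c₀
            ; relation = ~ε⇒∈ (~-trans (~-∙-congˡ {suc K · el t} (~-sym -Kt~c₀)) (≈⇒~ (inverseʳ (suc K · el t)))) }

      module Extensions {A : List E} {t : E} {T : List E} (Nt∈ : ⟪ A ⟫ (N · el t)) (X : Relation A t T) where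
        open Relation X
        open ⟪Mod⟫ A
        open ~-Reasoning
        open ℕ-Solver

        N·~ε : ∀ n → (n ℕ.* N) · el t ~ ε
        N·~ε n = ~-trans (~-sym (≈⇒~ (×-assocˡ (el t) n N))) (·-~ε n (∈⇒~ε Nt∈))

        character-∷⁻ : ∀ {x v} → Character A (t ∷ T) (x ∷ v) →
          Character A T v × N ∣ suc K ℕ.* toℕ x ℕ.+ dot c₀ v
        character-∷⁻ χ = (λ c y → χ (0 ∷ c) (respects (sym (identityˡ (comb T c))) y)) , χ (suc K ∷ c₀) relation

        -- K + 1 divides the coefficient of t in any relation, so every relation is a multiple of
        -- the minimal one plus a relation among T alone.
        character-∷⁺ : ∀ {x v} → Character A T v → N ∣ suc K ℕ.* toℕ x ℕ.+ dot c₀ v →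
          Character A (t ∷ T) (x ∷ v)
        character-∷⁺ {x} {v} χ N∣ (n ∷ c) y = from (order∣ n nt∈)
          where
          nt∈ : ⟪ T ++ A ⟫ (n · el t)
          nt∈ = TA.~ε⇒∈ (TA.~-cancelʳ (comb T c) (n · el t) ε (TA.~-trans
            (TA.∈⇒~ε (⟪⟫-⊑ (⊑.xs⊆ys++xs A T) y))
            (TA.~-sym (TA.~-trans (TA.≈⇒~ (identityˡ (comb T c))) (TA.∈⇒~ε (comb∈ T c))))))
            where module TA = ⟪Mod⟫ (T ++ A)
          from : suc K ∣ n → N ∣ n ℕ.* toℕ x ℕ.+ dot c v
          from (divides q ≡.refl) = ∣m+n∣m⇒∣n
            (subst (N ∣_) total (∣m∣n⇒∣m+n (∣n⇒∣m*n q N∣) (χ c′ c′∈)))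
            (∣m⇒∣m*n (q ℕ.* dot c₀ v) (n∣n {N}))
            where
            -- This is c - q c₀ with -1 replaced by M: q times the minimal relation is subtracted,
            -- which removes t.
            c′ = axpy (M ℕ.* q) c c₀
            c′∈ : ⟪ A ⟫ (comb T c′)
            c′∈ = ~ε⇒∈ (begin
              comb T c′
                ≈⟨ ≈⇒~ (comb-axpy T (M ℕ.* q) c c₀) ⟩
              comb T c ∙ (M ℕ.* q) · comb T c₀
                ≈⟨ ≈⇒~ (identityˡ _) ⟨
              ε ∙ (comb T c ∙ (M ℕ.* q) · comb T c₀)
                ≈⟨ ~-∙-congʳ {comb T c ∙ (M ℕ.* q) · comb T c₀} (N·~ε (q ℕ.* suc K)) ⟨
              (q ℕ.* suc K ℕ.* N) · el t ∙ (comb T c ∙ (M ℕ.* q) · comb T c₀)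
                ≡⟨ cong (λ m → m · el t ∙ (comb T c ∙ (M ℕ.* q) · comb T c₀))
                     (solve 3 (λ q k m → q :* k :* (con 1 :+ m) := q :* k :+ m :* q :* k) ≡.refl q (suc K) M) ⟩
              (q ℕ.* suc K ℕ.+ M ℕ.* q ℕ.* suc K) · el t ∙ (comb T c ∙ (M ℕ.* q) · comb T c₀)
                ≈⟨ ≈⇒~ (∙-congʳ (×-homo-+ (el t) (q ℕ.* suc K) (M ℕ.* q ℕ.* suc K))) ⟩
              ((q ℕ.* suc K) · el t ∙ (M ℕ.* q ℕ.* suc K) · el t) ∙ (comb T c ∙ (M ℕ.* q) · comb T c₀)
                ≈⟨ ≈⇒~ (interchange _ _ _ _) ⟩
              ((q ℕ.* suc K) · el t ∙ comb T c) ∙ ((M ℕ.* q ℕ.* suc K) · el t ∙ (M ℕ.* q) · comb T c₀)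
                ≈⟨ ≈⇒~ (∙-congˡ (∙-congʳ (×-assocˡ (el t) (M ℕ.* q) (suc K)))) ⟨
              ((q ℕ.* suc K) · el t ∙ comb T c) ∙ ((M ℕ.* q) · (suc K · el t) ∙ (M ℕ.* q) · comb T c₀)
                ≈⟨ ≈⇒~ (∙-congˡ (×-distrib-+ (suc K · el t) (comb T c₀) (M ℕ.* q))) ⟨
              ((q ℕ.* suc K) · el t ∙ comb T c) ∙ (M ℕ.* q) · (suc K · el t ∙ comb T c₀)
                ≈⟨ ~-∙-cong (∈⇒~ε y) (·-~ε (M ℕ.* q) (∈⇒~ε relation)) ⟩
              ε ∙ ε
                ≈⟨ ≈⇒~ (identityˡ ε) ⟩
              ε ∎)
            total : q ℕ.* (suc K ℕ.* toℕ x ℕ.+ dot c₀ v) ℕ.+ dot c′ v ≡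
                    N ℕ.* (q ℕ.* dot c₀ v) ℕ.+ (q ℕ.* suc K ℕ.* toℕ x ℕ.+ dot c v)
            total = ≡.trans (cong (q ℕ.* (suc K ℕ.* toℕ x ℕ.+ dot c₀ v) ℕ.+_) (dot-axpy (M ℕ.* q) c c₀ v))
              (solve 6 (λ q k x s m p → q :* (k :* x :+ s) :+ (p :+ m :* q :* s) :=
                 (con 1 :+ m) :* (q :* s) :+ (q :* k :* x :+ p)) ≡.refl q (suc K) (toℕ x) (dot c₀ v) M (dot c v))

        order∣N : suc K ∣ N
        order∣N = order∣ N (⟪⟫-⊑ (⊑.xs⊆ys++xs A T) Nt∈)

        -- With N = (L + 1)(K + 1) and N t = 0 modulo A, (L + 1) c₀ is a relation among T. Hence N
        -- divides (L + 1) times the value of v at c₀, so K + 1 divides that value, and the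
        -- congruence for x is solvable.
        count-extensions : ∀ {v} → Character A T v →
          sum {N} (λ x → 𝟙 (N ∣? suc K ℕ.* toℕ x ℕ.+ dot c₀ v)) ≡ suc K
        count-extensions {v} χ = from order∣N
          where
          from : suc K ∣ N → sum {N} (λ x → 𝟙 (N ∣? suc K ℕ.* toℕ x ℕ.+ dot c₀ v)) ≡ suc K
          from (divides (suc L) N≡LK) = count-solutions (suc K) L (dot c₀ v) N≡KL
            (*-cancelˡ-∣ (suc L) (subst (_∣ suc L ℕ.* dot c₀ v) N≡LK
              (subst (N ∣_) dot-Lc₀ (χ Lc₀ Lc₀∈))))
            where
            N≡KL : N ≡ suc K ℕ.* suc L
            N≡KL = ≡.trans N≡LK (ℕₚ.*-comm (suc L) (suc K))
            Lc₀ = axpy (suc L) (replicate _ 0) c₀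
            dot-Lc₀ : dot Lc₀ v ≡ suc L ℕ.* dot c₀ v
            dot-Lc₀ = ≡.trans (dot-axpy (suc L) (replicate _ 0) c₀ v) (cong (ℕ._+ suc L ℕ.* dot c₀ v) (dot-0 v))
            Lc₀∈ : ⟪ A ⟫ (comb T Lc₀)
            Lc₀∈ = ~ε⇒∈ (begin
              comb T Lc₀                                      ≈⟨ ≈⇒~ (comb-axpy T (suc L) (replicate _ 0) c₀) ⟩
              comb T (replicate _ 0) ∙ suc L · comb T c₀      ≈⟨ ≈⇒~ (∙-congʳ (comb-0 T)) ⟩
              ε ∙ suc L · comb T c₀                           ≈⟨ ~-∙-congʳ {suc L · comb T c₀} (N·~ε 1) ⟨
              (1 ℕ.* N) · el t ∙ suc L · comb T c₀            ≡⟨ cong (λ n → n · el t ∙ suc L · comb T c₀) (≡.trans (ℕₚ.*-identityˡ N) N≡LK) ⟩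
              (suc L ℕ.* suc K) · el t ∙ suc L · comb T c₀    ≈⟨ ≈⇒~ (∙-congʳ (×-assocˡ (el t) (suc L) (suc K))) ⟨
              suc L · (suc K · el t) ∙ suc L · comb T c₀      ≈⟨ ≈⇒~ (×-distrib-+ (suc K · el t) (comb T c₀) (suc L)) ⟨
              suc L · (suc K · el t ∙ comb T c₀)              ≈⟨ ·-~ε (suc L) (∈⇒~ε relation) ⟩
              ε                                               ∎)

      abstract
        -- The definition ranges over infinitely many relations; recursion on T leaves one
        -- congruence for each generator, that of its minimal relation.
        character? : ∀ {A} T → Annihilated A T → ∀ v → Dec (Character A T v)
        character? []      ann []      = yes λ { [] _ → N ∣0 }
        character? {A} (t ∷ T) ann (x ∷ v) =
          map′ (λ (χ , N∣) → character-∷⁺ χ N∣) character-∷⁻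
            (character? T (ann ∘ there) v ×-dec (N ∣? suc K ℕ.* toℕ x ℕ.+ dot c₀ v))
          where
          X : Relation A t T
          X = minimal-relation ann
          open Relation X
          open Extensions (ann (here ≡.refl)) X

      sumVec : ∀ k → (Vec (Fin N) k → ℕ) → ℕ
      sumVec zero    f = f []
      sumVec (suc k) f = sum (λ x → sumVec k (f ∘ (x ∷_)))

      sumVec-cong : ∀ k {f g} → (∀ v → f v ≡ g v) → sumVec k f ≡ sumVec k g
      sumVec-cong zero    f≡g = f≡g []
      sumVec-cong (suc k) f≡g = sum-cong-≋ {N} λ x → sumVec-cong k λ v → f≡g (x ∷ v)

      sumVec-*ˡ : ∀ k m f → sumVec k (λ v → m ℕ.* f v) ≡ m ℕ.* sumVec k f
      sumVec-*ˡ zero    m f = ≡.refl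
      sumVec-*ˡ (suc k) m f = ≡.trans (sum-cong-≋ {N} λ x → sumVec-*ˡ k m (f ∘ (x ∷_)))
        (≡.sym (*-distribˡ-sum {N} m (λ x → sumVec k (f ∘ (x ∷_)))))

      sumVec-0 : ∀ k {f} → (∀ v → f v ≡ 0) → sumVec k f ≡ 0
      sumVec-0 zero    f≡0 = f≡0 []
      sumVec-0 (suc k) f≡0 = sum-0 {N} λ x → sumVec-0 k λ v → f≡0 (x ∷ v)

      sum-sumVec : ∀ k {n} (f : Fin n → Vec (Fin N) k → ℕ) →
        sum (λ x → sumVec k (f x)) ≡ sumVec k (λ v → sum (λ x → f x v))
      sum-sumVec zero    f = ≡.refl
      sum-sumVec (suc k) {n} f = ≡.trans (∑-comm {n} {N} (λ x y → sumVec k (f x ∘ (y ∷_))))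
        (sum-cong-≋ {N} λ y → sum-sumVec k λ x → f x ∘ (y ∷_))

      zeros : ∀ {k} → Vec (Fin N) k → ℕ
      zeros []          = 0
      zeros (zero  ∷ v) = suc (zeros v)
      zeros (suc _ ∷ v) = zeros v

      -- This is the coefficient of yʲ in the sum of y to the number of zeros on T, taken over all
      -- characters.
      #characters : ∀ A T → Annihilated A T → ℕ → ℕ
      #characters A T ann j = sumVec (length T) λ v → 𝟙 (character? T ann v) ℕ.* 𝟙 (zeros v ℕₚ.≟ j)

      shiftℕ : (ℕ → ℕ) → ℕ → ℕ
      shiftℕ f zero    = 0
      shiftℕ f (suc j) = f j

      -- For the generating functions, Z(A, t ∷ T) = (y - 1) Z(t ∷ A, T) + (K + 1) Z(A, T), written
      -- without subtraction: characters that vanish at t are those modulo `t ∷ A`, and each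
      -- character on T has K + 1 extensions to t.
      #characters-step : ∀ {A t T} (X : Relation A t T)
        (ann : Annihilated A (t ∷ T)) (ann′ : Annihilated (t ∷ A) T) j →
        #characters A (t ∷ T) ann j ℕ.+ #characters (t ∷ A) T ann′ j ≡
        shiftℕ (#characters (t ∷ A) T ann′) j ℕ.+ suc (Relation.K X) ℕ.* #characters A T (ann ∘ there) j
      #characters-step {A} {t} {T} X ann ann′ j = begin
        #zero ℕ.+ #nonzero ℕ.+ #characters (t ∷ A) T ann′ j
          ≡⟨ cong₂ (λ m n → m ℕ.+ #nonzero ℕ.+ n) (shifted j) (vanishing (λ z → 𝟙 (z ℕₚ.≟ j))) ⟩
        shiftℕ (#characters (t ∷ A) T ann′) j ℕ.+ #nonzero ℕ.+ sumVec k (λ v → χ zero v ℕ.* 𝟙 (zeros v ℕₚ.≟ j))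
          ≡⟨ rearrange (shiftℕ (#characters (t ∷ A) T ann′) j) #nonzero _ ⟩
        shiftℕ (#characters (t ∷ A) T ann′) j ℕ.+ sum {N} (λ x → sumVec k (λ v → χ x v ℕ.* 𝟙 (zeros v ℕₚ.≟ j)))
          ≡⟨ cong (shiftℕ (#characters (t ∷ A) T ann′) j ℕ.+_) all-values ⟩
        shiftℕ (#characters (t ∷ A) T ann′) j ℕ.+ suc K ℕ.* #characters A T (ann ∘ there) j ∎
        where
        open ≡.≡-Reasoning
        open Relation X
        open Extensions (ann (here ≡.refl)) X
        k = length T
        χ : Fin N → Values T → ℕ
        χ x v = 𝟙 (character? (t ∷ T) ann (x ∷ v))
        χ′ : Values T → ℕ
        χ′ v = 𝟙 (character? T (ann ∘ there) v)
        #zero = sumVec k (λ v → χ zero v ℕ.* 𝟙 (suc (zeros v) ℕₚ.≟ j))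
        #nonzero = sum (λ x → sumVec k (λ v → χ (suc x) v ℕ.* 𝟙 (zeros v ℕₚ.≟ j)))
        rearrange : ∀ x y z → x ℕ.+ y ℕ.+ z ≡ x ℕ.+ (z ℕ.+ y)
        rearrange x y z = ≡.trans (ℕₚ.+-assoc x y z) (cong (x ℕ.+_) (ℕₚ.+-comm y z))
        vanishing : ∀ (w : ℕ → ℕ) → sumVec k (λ v → 𝟙 (character? T ann′ v) ℕ.* w (zeros v)) ≡
                                    sumVec k (λ v → χ zero v ℕ.* w (zeros v))
        vanishing w = sumVec-cong k λ v → cong (ℕ._* w (zeros v))
          (𝟙-⇔ character-0∷⁺ (λ χ → character-0∷⁻ χ (ann (here ≡.refl)))
            (character? T ann′ v) (character? (t ∷ T) ann (zero ∷ v)))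
        shifted : ∀ j → sumVec k (λ v → χ zero v ℕ.* 𝟙 (suc (zeros v) ℕₚ.≟ j)) ≡ shiftℕ (#characters (t ∷ A) T ann′) j
        shifted zero    = sumVec-0 k λ v → ℕₚ.*-zeroʳ (χ zero v)
        shifted (suc j) = ≡.trans
          (sumVec-cong k λ v → cong (χ zero v ℕ.*_)
            (𝟙-⇔ ℕₚ.suc-injective (cong suc) (suc (zeros v) ℕₚ.≟ suc j) (zeros v ℕₚ.≟ j)))
          (≡.sym (vanishing (λ z → 𝟙 (z ℕₚ.≟ j))))
        extensions : ∀ v (d : Dec (Character A T v)) → sum {N} (λ x → χ x v) ≡ suc K ℕ.* 𝟙 d
        extensions v (yes χ) = ≡.trans
          (sum-cong-≋ {N} λ x → 𝟙-⇔ (proj₂ ∘ character-∷⁻) (character-∷⁺ χ)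
            (character? (t ∷ T) ann (x ∷ v)) (N ∣? suc K ℕ.* toℕ x ℕ.+ dot c₀ v))
          (≡.trans (count-extensions χ) (≡.sym (ℕₚ.*-identityʳ (suc K))))
        extensions v (no ¬χ) = ≡.trans
          (sum-0 {N} λ x → 𝟙-no (¬χ ∘ proj₁ ∘ character-∷⁻) (character? (t ∷ T) ann (x ∷ v)))
          (≡.sym (ℕₚ.*-zeroʳ (suc K)))
        all-values : sum {N} (λ x → sumVec k (λ v → χ x v ℕ.* 𝟙 (zeros v ℕₚ.≟ j))) ≡
                     suc K ℕ.* #characters A T (ann ∘ there) j
        all-values = ≡.trans (sum-sumVec k {N} (λ x v → χ x v ℕ.* 𝟙 (zeros v ℕₚ.≟ j)))
          (≡.trans (sumVec-cong k λ v → ≡.trans (≡.sym (*-distribʳ-sum {N} (𝟙 (zeros v ℕₚ.≟ j)) (λ x → χ x v)))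
              (≡.trans (cong (ℕ._* 𝟙 (zeros v ℕₚ.≟ j)) (extensions v (character? T (ann ∘ there) v)))
                (ℕₚ.*-assoc (suc K) (χ′ v) (𝟙 (zeros v ℕₚ.≟ j)))))
            (sumVec-*ˡ k (suc K) (λ v → χ′ v ℕ.* 𝟙 (zeros v ℕₚ.≟ j))))

      -- Both sides obey the recurrence of `#characters-step`: the sets C containing t give y - 1
      -- times the sum for `t ∷ A`, and μ (T ++ A) is K + 1 times μ (t ∷ T ++ A).
      loop-sum : ∀ {A} T (ann : Annihilated A T) j →
        sumSub T (λ C → ℤ.+ μ (C ++ A) ℤ.* e (length C) j) ≡ ℤ.+ (μ (T ++ A) ℕ.* #characters A T ann j)
      loop-sum {A} [] ann j = ≡.trans (cong (ℤ.+ μ A ℤ.*_) (e₀ j))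
        (≡.trans (≡.sym (ℤₚ.pos-* (μ A) (𝟙 (0 ℕₚ.≟ j)))) (cong (λ n → ℤ.+ (μ A ℕ.* n))
          (≡.trans (≡.sym (ℕₚ.*-identityˡ (𝟙 (0 ℕₚ.≟ j))))
                   (cong (ℕ._* 𝟙 (0 ℕₚ.≟ j)) (≡.sym (𝟙-yes (λ { [] _ → N ∣0 }) (character? [] ann [])))))))
        where
        e₀ : ∀ j → e 0 j ≡ ℤ.+ 𝟙 (0 ℕₚ.≟ j)
        e₀ zero    = ≡.refl
        e₀ (suc j) = ≡.refl
      loop-sum {A} (t ∷ T) ann j = begin
        sumSub T (λ C → ℤ.+ μ (t ∷ C ++ A) ℤ.* e (suc (length C)) j) ℤ.+ sumSub T (λ C → ℤ.+ μ (C ++ A) ℤ.* e (length C) j)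
          ≡⟨ cong₂ ℤ._+_ (contracted j) (loop-sum T (ann ∘ there) j) ⟩
        (ℤ.+ (m ℕ.* shiftℕ #tA j) ℤ.- ℤ.+ (m ℕ.* #tA j)) ℤ.+ ℤ.+ (μ (T ++ A) ℕ.* #A)
          ≡⟨ cong (λ n → (ℤ.+ (m ℕ.* shiftℕ #tA j) ℤ.- ℤ.+ (m ℕ.* #tA j)) ℤ.+ ℤ.+ (n ℕ.* #A)) (μ-step {T ++ A} {t} {K} Kt∈ order∣) ⟩
        (ℤ.+ (m ℕ.* shiftℕ #tA j) ℤ.- ℤ.+ (m ℕ.* #tA j)) ℤ.+ ℤ.+ (m ℕ.* suc K ℕ.* #A)
          ≡⟨ cong (λ n → (ℤ.+ (m ℕ.* shiftℕ #tA j) ℤ.- ℤ.+ (m ℕ.* #tA j)) ℤ.+ ℤ.+ n) (ℕₚ.*-assoc m (suc K) #A) ⟩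
        (ℤ.+ (m ℕ.* shiftℕ #tA j) ℤ.- ℤ.+ (m ℕ.* #tA j)) ℤ.+ ℤ.+ (m ℕ.* (suc K ℕ.* #A))
          ≡⟨ collect m (#characters A (t ∷ T) ann j) (#tA j) (shiftℕ #tA j) (suc K ℕ.* #A) (#characters-step X ann ann′ j) ⟩
        ℤ.+ (m ℕ.* #characters A (t ∷ T) ann j) ∎
        where
        open ≡.≡-Reasoning
        X : Relation A t T
        X = minimal-relation ann
        open Relation X
        m = μ (t ∷ T ++ A)
        ann′ : Annihilated (t ∷ A) T
        ann′ t′∈T = ⟪⟫-⊑ there (ann (there t′∈T))
        #tA = #characters (t ∷ A) T ann′
        #A = #characters A T (ann ∘ there) j
        tC : ∀ C → t ∷ C ++ A ↭ C ++ t ∷ A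
        tC C = ↭-sym (shift t C A)
        S : ℕ → ℤ
        S j = sumSub T (λ C → ℤ.+ μ (C ++ t ∷ A) ℤ.* e (length C) j)
        S≡ : ∀ j → S j ≡ ℤ.+ (m ℕ.* #tA j)
        S≡ j = ≡.trans (loop-sum T ann′ j) (cong (λ n → ℤ.+ (n ℕ.* #tA j)) (μ-↭ (shift t T A)))
        shifted-sum : ∀ j → sumSub T (λ C → ℤ.+ μ (C ++ t ∷ A) ℤ.* shiftℤ (e (length C)) j) ≡ shiftℤ S j
        shifted-sum zero    = ≡.trans (sumSub-cong T λ C _ → ℤₚ.*-zeroʳ (ℤ.+ μ (C ++ t ∷ A))) (sumSub-0 T)
        shifted-sum (suc j) = ≡.refl
        shift-S : ∀ j → shiftℤ S j ≡ ℤ.+ (m ℕ.* shiftℕ #tA j)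
        shift-S zero    = cong ℤ.+_ (≡.sym (ℕₚ.*-zeroʳ m))
        shift-S (suc j) = S≡ j
        distribute : ∀ x y z → x ℤ.* (y ℤ.- z) ≡ x ℤ.* y ℤ.+ ℤ.-1ℤ ℤ.* (x ℤ.* z)
        distribute = ℤ-Solver.solve-∀
        contracted : ∀ j → sumSub T (λ C → ℤ.+ μ (t ∷ C ++ A) ℤ.* e (suc (length C)) j) ≡
                     ℤ.+ (m ℕ.* shiftℕ #tA j) ℤ.- ℤ.+ (m ℕ.* #tA j)
        contracted j = begin
          sumSub T (λ C → ℤ.+ μ (t ∷ C ++ A) ℤ.* e (suc (length C)) j)
            ≡⟨ sumSub-cong T (λ C _ → ≡.trans (cong₂ (λ n z → ℤ.+ n ℤ.* z) (μ-↭ (tC C)) (e-suc (length C) j))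
                 (distribute (ℤ.+ μ (C ++ t ∷ A)) (shiftℤ (e (length C)) j) (e (length C) j))) ⟩
          sumSub T (λ C → ℤ.+ μ (C ++ t ∷ A) ℤ.* shiftℤ (e (length C)) j ℤ.+ ℤ.-1ℤ ℤ.* (ℤ.+ μ (C ++ t ∷ A) ℤ.* e (length C) j))
            ≡⟨ sumSub-+ T (λ C → ℤ.+ μ (C ++ t ∷ A) ℤ.* shiftℤ (e (length C)) j) (λ C → ℤ.-1ℤ ℤ.* (ℤ.+ μ (C ++ t ∷ A) ℤ.* e (length C) j)) ⟩
          sumSub T (λ C → ℤ.+ μ (C ++ t ∷ A) ℤ.* shiftℤ (e (length C)) j) ℤ.+ sumSub T (λ C → ℤ.-1ℤ ℤ.* (ℤ.+ μ (C ++ t ∷ A) ℤ.* e (length C) j))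
            ≡⟨ cong₂ ℤ._+_ (≡.trans (shifted-sum j) (shift-S j))
                 (≡.trans (sumSub-*ˡ T ℤ.-1ℤ (λ C → ℤ.+ μ (C ++ t ∷ A) ℤ.* e (length C) j))
                   (≡.trans (ℤₚ.-1*i≡-i (S j)) (cong ℤ.-_ (S≡ j)))) ⟩
          ℤ.+ (m ℕ.* shiftℕ #tA j) ℤ.- ℤ.+ (m ℕ.* #tA j) ∎
        collect : ∀ m u v x y → u ℕ.+ v ≡ x ℕ.+ y →
          (ℤ.+ (m ℕ.* x) ℤ.- ℤ.+ (m ℕ.* v)) ℤ.+ ℤ.+ (m ℕ.* y) ≡ ℤ.+ (m ℕ.* u)
        collect m u v x y eq = begin
          (ℤ.+ (m ℕ.* x) ℤ.- ℤ.+ (m ℕ.* v)) ℤ.+ ℤ.+ (m ℕ.* y)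
            ≡⟨ rearrange (ℤ.+ (m ℕ.* x)) (ℤ.+ (m ℕ.* v)) (ℤ.+ (m ℕ.* y)) ⟩
          (ℤ.+ (m ℕ.* x) ℤ.+ ℤ.+ (m ℕ.* y)) ℤ.- ℤ.+ (m ℕ.* v)
            ≡⟨ cong (ℤ._- ℤ.+ (m ℕ.* v)) (≡.trans (≡.sym (ℤₚ.pos-+ (m ℕ.* x) (m ℕ.* y)))
                 (≡.trans (cong ℤ.+_ (≡.trans (≡.sym (ℕₚ.*-distribˡ-+ m x y)) (≡.trans (cong (m ℕ.*_) (≡.sym eq)) (ℕₚ.*-distribˡ-+ m u v))))
                   (ℤₚ.pos-+ (m ℕ.* u) (m ℕ.* v)))) ⟩
          (ℤ.+ (m ℕ.* u) ℤ.+ ℤ.+ (m ℕ.* v)) ℤ.- ℤ.+ (m ℕ.* v)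
            ≡⟨ cancel (ℤ.+ (m ℕ.* u)) (ℤ.+ (m ℕ.* v)) ⟩
          ℤ.+ (m ℕ.* u) ∎
          where
          rearrange : ∀ x y z → (x ℤ.- y) ℤ.+ z ≡ (x ℤ.+ z) ℤ.- y
          rearrange = ℤ-Solver.solve-∀
          cancel : ∀ x y → (x ℤ.+ y) ℤ.- y ≡ x
          cancel = ℤ-Solver.solve-∀

    loops-nonneg : ∀ R T → (∀ {t} → t ∈ T → √⟪ R ⟫ (el t)) → ∀ j →
      0ℤ ℤ.≤ sumSub T (λ C → ℤ.+ μ (C ++ R) ℤ.* e (length C) j)
    loops-nonneg R T T⊆ j = from (annihilator T T⊆)
      where
      annihilator : ∀ T → (∀ {t} → t ∈ T → √⟪ R ⟫ (el t)) → ∃ λ M → ∀ {t} → t ∈ T → ⟪ R ⟫ (suc M · el t)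
      annihilator []      T⊆ = 0 , λ ()
      annihilator (t ∷ T) T⊆ with T⊆ (here ≡.refl) | annihilator T (T⊆ ∘ there)
      -- The successor of this number is (k + 1)(M + 1), a multiple of both exponents.
      ... | k , kt∈ | M , ann = M ℕ.+ k ℕ.* suc M , λ
        { (here ≡.refl) → subst (λ n → ⟪ R ⟫ (n · el t)) (ℕₚ.*-comm (suc M) (suc k))
                            (respects (×-assocˡ (el t) (suc M) (suc k)) (⟪⟫-· (suc M) kt∈))
        ; (there t′∈T) → respects (×-assocˡ _ (suc k) (suc M)) (⟪⟫-· (suc k) (ann t′∈T)) }
      from : (∃ λ M → ∀ {t} → t ∈ T → ⟪ R ⟫ (suc M · el t)) → _
      from (M , ann) = subst (0ℤ ℤ.≤_) (≡.sym (loop-sum T ann j)) (ℤ.+≤+ ℕ.z≤n)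
        where open Characters M

    -- Coloops and classes of the saturation

    independent-swap : ∀ {R f} F → Independent R (f ∷ F) → Independent (f ∷ R) F
    independent-swap []       _ = _
    independent-swap {R} {f} (g ∷ F) (f∉ , g∉ , indep) =
      -- f has infinite order modulo the saturation of g ∷ F ++ R, so it cannot help to produce a
      -- multiple of g and may be dropped.
      (λ x → g∉ (√-free-drop there f∉ (∈⇒√ (generator (here ≡.refl))) (√⟪⟫-⊑ (⊑.⊆-reflexive-↭ (shift f F R)) x)))
      , independent-swap F (f∉ ∘ √⟪⟫-⊑ there , indep)

    -- Meets F R t A: the class of t in √⟪ F ++ R ⟫ / ⟪ F ++ R ⟫ comes from √⟪ A ++ R ⟫.
    rep : ∀ A → Fin (μ A) → Carrier
    rep A = proj₁ (index A)

    rep∈ : ∀ A i → √⟪ A ⟫ (rep A i)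
    rep∈ A = proj₁ (proj₂ (index A))

    record Meets (F R : List E) (t : Carrier) (A : List E) : Set (c ⊔ ℓ) where
      constructor _because_
      field
        class     : Fin (μ (A ++ R))
        congruent : ⟪ F ++ R ⟫ (rep (A ++ R) class ∙ t ⁻¹)

    abstract
      -- Because `Meets` stores the number of a representative instead of an arbitrary element, a
      -- finite search decides it.
      meets? : ∀ F R t A → Dec (Meets F R t A)
      meets? F R t A = map′ (λ (i , x) → i because x) (λ (i because x) → i , x)
        (Finₚ.any? λ i → ∈? (F ++ R) (rep (A ++ R) i ∙ t ⁻¹))

    meets : ∀ {F R t A} → A ⊑ F → ∀ {g} → √⟪ A ++ R ⟫ g → ⟪ F ++ R ⟫ (g ∙ t ⁻¹) → Meets F R t A
    meets {F} {R} {t} {A} A⊑F {g} g∈√ g~t = from (proj₂ (proj₂ (proj₂ (index (A ++ R)))) g g∈√)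
      where
      open ⟪Mod⟫ (F ++ R)
      from : (∃ λ i → ⟪ A ++ R ⟫ (g ∙ rep (A ++ R) i ⁻¹)) → Meets F R t A
      from (i , g~rᵢ) = i because ~-trans (~-sym (⟪⟫-⊑ (⊑.++⁺ˡ R A⊑F) g~rᵢ)) g~t

    meets⁻ : ∀ {F R t A} → Meets F R t A → ∃ λ g → √⟪ A ++ R ⟫ g × ⟪ F ++ R ⟫ (g ∙ t ⁻¹)
    meets⁻ {R = R} {A = A} (i because x) = rep (A ++ R) i , rep∈ (A ++ R) i , x

    meets-contract : ∀ {F R t f A} → A ⊑ F → Meets (f ∷ F) R t (f ∷ A) → Meets F (f ∷ R) t A
    meets-contract {F} {R} {t} {f} {A} A⊑F m with meets⁻ m
    ... | g , g∈√ , g~t = meets A⊑F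
      (√⟪⟫-⊑ (⊑.⊆-reflexive-↭ (↭-sym (shift f A R))) g∈√)
      (⟪⟫-⊑ (⊑.⊆-reflexive-↭ (↭-sym (shift f F R))) g~t)

    meets-contract⁻ : ∀ {F R t f A} → A ⊑ F → Meets F (f ∷ R) t A → Meets (f ∷ F) R t (f ∷ A)
    meets-contract⁻ {F} {R} {t} {f} {A} A⊑F m with meets⁻ m
    ... | g , g∈√ , g~t = meets (⊑.∷⁺ʳ f A⊑F)
      (√⟪⟫-⊑ (⊑.⊆-reflexive-↭ (shift f A R)) g∈√)
      (⟪⟫-⊑ (⊑.⊆-reflexive-↭ (shift f F R)) g~t)

    meets-mono : ∀ {F R t A B} → A ⊑ B → B ⊑ F → Meets F R t A → Meets F R t B
    meets-mono {R = R} A⊑B B⊑F m with meets⁻ m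
    ... | g , g∈√ , g~t = meets B⊑F (√⟪⟫-⊑ (⊑.++⁺ˡ R A⊑B) g∈√) g~t

    module Delete {F R t f t′} (f∉ : ¬ √⟪ F ++ R ⟫ (el f))
      (t′∈√ : √⟪ F ++ R ⟫ t′) (t′~t : ⟪ f ∷ F ++ R ⟫ (t′ ∙ t ⁻¹)) where
      open ⟪Mod⟫ (f ∷ F ++ R)

      meets-delete : ∀ {A} → A ⊑ F → Meets F R t′ A → Meets (f ∷ F) R t A
      meets-delete A⊑F m with meets⁻ m
      ... | g , g∈√ , g~t′ = meets (there ∘ A⊑F) g∈√ (~-trans (⟪⟫-⊑ there g~t′) t′~t)

      meets-delete⁻ : ∀ {A} → A ⊑ F → Meets (f ∷ F) R t (f ∷ A) → Meets F R t′ A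
      meets-delete⁻ {A} A⊑F m with meets⁻ m
      ... | g , g∈√ , g~t with split (~-trans g~t (~-sym t′~t))
      ...   | p , q , eq = meets A⊑F
        (√-free-drop (⊑.map⁺ el (⊑.++⁺ˡ R A⊑F)) f∉ (√-resp-~ h~t′ t′∈√) h∈√fA) h~t′
        where
        module FR = ⟪Mod⟫ (F ++ R)
        open FR.~-Reasoning
        h = (g ∙ q · el f) ∙ (p · el f) ⁻¹
        f∈√ : √⟪ f ∷ A ++ R ⟫ (el f)
        f∈√ = ∈⇒√ (generator (here ≡.refl))
        h∈√fA : √⟪ f ∷ A ++ R ⟫ h
        h∈√fA = √-∙ (√-∙ g∈√ (√-· q f∈√)) (√-⁻¹ (√-· p f∈√))
        h~t′ : h FR.~ t′
        h~t′ = FR.~-cancelʳ (t′ ⁻¹) h t′ (begin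
          (g ∙ q · el f) ∙ (p · el f) ⁻¹ ∙ t′ ⁻¹      ≈⟨ FR.≈⇒~ (reorder g (q · el f) ((p · el f) ⁻¹) (t′ ⁻¹)) ⟩
          (g ∙ t′ ⁻¹ ∙ q · el f) ∙ (p · el f) ⁻¹      ≈⟨ FR.~-∙-congʳ {(p · el f) ⁻¹} eq ⟩
          p · el f ∙ (p · el f) ⁻¹                    ≈⟨ FR.≈⇒~ (inverseʳ (p · el f)) ⟩
          ε                                           ≈⟨ FR.≈⇒~ (inverseʳ t′) ⟨
          t′ ∙ t′ ⁻¹                                  ∎)
          where
          reorder : ∀ w x y z → (w ∙ x) ∙ y ∙ z ≈ (w ∙ z ∙ x) ∙ y
          reorder w x y z = trans (trans (assoc (w ∙ x) y z) (trans (∙-congˡ (comm y z)) (sym (assoc (w ∙ x) z y))))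
            (∙-congʳ (trans (assoc w x z) (trans (∙-congˡ (comm x z)) (sym (assoc w z x)))))

    -- For fixed t the sets A which meet t form a filter closed under intersection:
    -- either all of them contain f, or f plays no role and t may be moved into √⟪ F ++ R ⟫.
    coloop-fibre-nonneg : ∀ F {R} t → Independent R F → ∀ i →
      0ℤ ℤ.≤ sumSub F (λ A → ℤ.+ 𝟙 (meets? F R t A) ℤ.* e (length F ∸ length A) i)
    coloop-fibre-nonneg [] {R} t _ i = subst (0ℤ ℤ.≤_) (e₀ i) (ℤ.+≤+ ℕ.z≤n)
      where
      e₀ : ∀ i → ℤ.+ (𝟙 (meets? [] R t []) ℕ.* 𝟙 (0 ℕₚ.≟ i)) ≡ ℤ.+ 𝟙 (meets? [] R t []) ℤ.* e 0 i
      e₀ zero    = ℤₚ.pos-* (𝟙 (meets? [] R t [])) 1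
      e₀ (suc i) = ℤₚ.pos-* (𝟙 (meets? [] R t [])) 0
    coloop-fibre-nonneg (f ∷ F) {R} t (f∉ , indep) i = from (meets? (f ∷ F) R t F)
      where
      Claim = 0ℤ ℤ.≤ sumSub F (λ A → ℤ.+ 𝟙 (meets? (f ∷ F) R t (f ∷ A)) ℤ.* e (length F ∸ length A) i) ℤ.+
                     sumSub F (λ A → ℤ.+ 𝟙 (meets? (f ∷ F) R t A) ℤ.* e (suc (length F) ∸ length A) i)
      from : Dec (Meets (f ∷ F) R t F) → Claim
      -- If a set avoiding f met t, so would F. The second sum therefore vanishes, and the first is
      -- the sum for the contraction by f.
      from (no ¬m) = subst (0ℤ ℤ.≤_) (≡.sym (≡.trans (cong₂ ℤ._+_ containing-f avoiding-f) (ℤₚ.+-identityʳ _)))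
        (coloop-fibre-nonneg F {f ∷ R} t (independent-swap F (f∉ , indep)) i)
        where
        containing-f = sumSub-cong F λ A A⊆F → cong (λ n → ℤ.+ n ℤ.* e (length F ∸ length A) i)
          (𝟙-⇔ (meets-contract (lookup A⊆F)) (meets-contract⁻ (lookup A⊆F))
            (meets? (f ∷ F) R t (f ∷ A)) (meets? F (f ∷ R) t A))
        avoiding-f = ≡.trans
          (sumSub-cong F λ A A⊆F → cong (λ n → ℤ.+ n ℤ.* e (suc (length F) ∸ length A) i)
            (𝟙-no (λ m → ¬m (meets-mono (lookup A⊆F) there m)) (meets? (f ∷ F) R t A)))
          (≡.trans (sumSub-cong F λ A _ → ℤₚ.*-zeroˡ (e (suc (length F) ∸ length A) i)) (sumSub-0 F))
      from (yes m) = move (meets⁻ m)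
        where
        move : (∃ λ t′ → √⟪ F ++ R ⟫ t′ × ⟪ f ∷ F ++ R ⟫ (t′ ∙ t ⁻¹)) → Claim
        move (t′ , t′∈√ , t′~t) = subst (0ℤ ℤ.≤_) (≡.sym merged) (shifted-nonneg i)
          where
          open Delete {F} {R} {t} {f} {t′} f∉ t′∈√ t′~t
          ι : List E → ℤ
          ι A = ℤ.+ 𝟙 (meets? F R t′ A)
          ι-with : ∀ {A} → A ⊆ F → 𝟙 (meets? (f ∷ F) R t (f ∷ A)) ≡ 𝟙 (meets? F R t′ A)
          ι-with {A} A⊆F = 𝟙-⇔ (meets-delete⁻ (lookup A⊆F))
            (meets-mono there (⊑.∷⁺ʳ f (lookup A⊆F)) ∘ meets-delete (lookup A⊆F)) (meets? (f ∷ F) R t (f ∷ A)) (meets? F R t′ A)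
          ι-without : ∀ {A} → A ⊆ F → 𝟙 (meets? (f ∷ F) R t A) ≡ 𝟙 (meets? F R t′ A)
          ι-without {A} A⊆F = 𝟙-⇔ (meets-delete⁻ (lookup A⊆F) ∘ meets-mono there (⊑.∷⁺ʳ f (lookup A⊆F)))
            (meets-delete (lookup A⊆F)) (meets? (f ∷ F) R t A) (meets? F R t′ A)
          add : ∀ x y z → x ℤ.* y ℤ.+ x ℤ.* (z ℤ.- y) ≡ x ℤ.* z
          add = ℤ-Solver.solve-∀
          merged : sumSub F (λ A → ℤ.+ 𝟙 (meets? (f ∷ F) R t (f ∷ A)) ℤ.* e (length F ∸ length A) i) ℤ.+
                   sumSub F (λ A → ℤ.+ 𝟙 (meets? (f ∷ F) R t A) ℤ.* e (suc (length F) ∸ length A) i) ≡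
                   sumSub F (λ A → ι A ℤ.* shiftℤ (e (length F ∸ length A)) i)
          -- A set A meets t with f exactly when it does without f, and (x - 1)ᵏ + (x - 1)ᵏ⁺¹ = x (x
          -- - 1)ᵏ shifts the coefficients by one.
          merged = ≡.trans (≡.sym (sumSub-+ F _ _)) (sumSub-cong F λ A A⊆F → ≡.trans
            (cong₂ ℤ._+_
              (cong (λ n → ℤ.+ n ℤ.* e (length F ∸ length A) i) (ι-with A⊆F))
              (cong₂ (λ n z → ℤ.+ n ℤ.* z) (ι-without A⊆F)
                (≡.trans (cong (λ k → e k i) (ℕₚ.+-∸-assoc 1 (⊆.length-mono-≤ A⊆F))) (e-suc (length F ∸ length A) i))))
            (add (ι A) (e (length F ∸ length A) i) (shiftℤ (e (length F ∸ length A)) i)))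
          shifted-nonneg : ∀ i → 0ℤ ℤ.≤ sumSub F (λ A → ι A ℤ.* shiftℤ (e (length F ∸ length A)) i)
          shifted-nonneg zero    = ℤₚ.≤-reflexive (≡.sym
            (≡.trans (sumSub-cong F λ A _ → ℤₚ.*-zeroʳ (ι A)) (sumSub-0 F)))
          shifted-nonneg (suc i) = coloop-fibre-nonneg F t′ indep i

    -- As F is independent, the classes of √⟪ A ++ R ⟫ inject into those of √⟪ F ++ R ⟫, and the
    -- image consists of the classes that meet A.
    μ-fibres : ∀ {F R A} → Independent R F → A ⊆ F →
      sum (λ h → 𝟙 (meets? F R (rep (F ++ R) h) A)) ≡ μ (A ++ R)
    μ-fibres {F} {R} {A} indep A⊆F = count-image (λ h → meets? F R (rep (F ++ R) h) A) class
      (λ {i} {j} eq → proj₁ (proj₂ (proj₂ (index (A ++ R)))) i j (separate A⊆F indep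
        (√-∙ (rep∈ (A ++ R) i) (√-⁻¹ (rep∈ (A ++ R) j)))
        (~-trans (class-~ i) (subst (λ h → rep (F ++ R) h ~ rep (A ++ R) j) (≡.sym eq) (~-sym (class-~ j))))))
      (λ i → i because class-~ i)
      (λ h (i because rᵢ~h) → i , proj₁ (proj₂ (proj₂ (index (F ++ R)))) (class i) h (~-trans (~-sym (class-~ i)) rᵢ~h))
      where
      open ⟪Mod⟫ (F ++ R)
      cover : ∀ i → ∃ λ h → rep (A ++ R) i ~ rep (F ++ R) h
      cover i = proj₂ (proj₂ (proj₂ (index (F ++ R)))) (rep (A ++ R) i)
        (√⟪⟫-⊑ (⊑.++⁺ˡ R (lookup A⊆F)) (rep∈ (A ++ R) i))
      class = proj₁ ∘ cover
      class-~ = proj₂ ∘ cover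
      -- This is the injectivity on classes. Members of F outside A drop out by `free-drop`; for f
      -- in A, its multiple is first removed from g.
      separate : ∀ {A F} → A ⊆ F → Independent R F → ∀ {g} → √⟪ A ++ R ⟫ g → ⟪ F ++ R ⟫ g → ⟪ A ++ R ⟫ g
      separate [] _ _ x = x
      separate {A} {f ∷ F} (.f ∷ʳ A⊆F) (f∉ , indep) g∈√ x = separate A⊆F indep g∈√
        (free-drop (λ y → y) f∉ (√⟪⟫-⊑ (⊑.++⁺ˡ R (lookup A⊆F)) g∈√) x)
      separate {f ∷ A} {.f ∷ F} (≡.refl ∷ A⊆F) (f∉ , indep) {g} g∈√ x with split x
      ... | p , q , h∈FR = fA.~ε⇒∈ (fA.~-cancelʳ (q · el f) g ε (begin
        g ∙ q · el f    ≈⟨ ⟪⟫-⊑ there h∈AR ⟩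
        p · el f        ≈⟨ fA.·-~ε p f~ε ⟩
        ε               ≈⟨ fA.·-~ε q f~ε ⟨
        q · el f        ≈⟨ fA.≈⇒~ (identityˡ (q · el f)) ⟨
        ε ∙ q · el f    ∎))
        where
        module fA = ⟪Mod⟫ (f ∷ A ++ R)
        open fA.~-Reasoning
        f∈ : ⟪ f ∷ A ++ R ⟫ (el f)
        f∈ = generator (here ≡.refl)
        f~ε : el f fA.~ ε
        f~ε = fA.∈⇒~ε f∈
        h∈AR : ⟪ A ++ R ⟫ (g ∙ q · el f ∙ (p · el f) ⁻¹)
        h∈AR = separate A⊆F indep (√-free-drop (⊑.map⁺ el (⊑.++⁺ˡ R (lookup A⊆F))) f∉ (∈⇒√ h∈FR)
          (√-∙ (√-∙ g∈√ (√-· q (∈⇒√ f∈))) (√-⁻¹ (√-· p (∈⇒√ f∈))))) h∈FR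

    sumSub-sum-nonneg : ∀ {n} xs (ι : Fin n → List E → ℕ) (w : List E → ℤ) →
      (∀ h → 0ℤ ℤ.≤ sumSub xs (λ A → ℤ.+ ι h A ℤ.* w A)) →
      0ℤ ℤ.≤ sumSub xs (λ A → ℤ.+ sum (λ h → ι h A) ℤ.* w A)
    sumSub-sum-nonneg {zero}  xs ι w nonneg = ℤₚ.≤-reflexive (≡.sym
      (≡.trans (sumSub-cong xs λ A _ → ℤₚ.*-zeroˡ (w A)) (sumSub-0 xs)))
    sumSub-sum-nonneg {suc n} xs ι w nonneg = subst (0ℤ ℤ.≤_)
      (≡.trans (≡.sym (sumSub-+ xs (λ A → ℤ.+ ι zero A ℤ.* w A) (λ A → ℤ.+ sum (λ h → ι (suc h) A) ℤ.* w A)))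
        (sumSub-cong xs λ A _ → ≡.sym (ℤₚ.*-distribʳ-+ (w A) (ℤ.+ ι zero A) (ℤ.+ sum (λ h → ι (suc h) A)))))
      (ℤₚ.+-mono-≤ (nonneg zero) (sumSub-sum-nonneg xs (ι ∘ suc) w (nonneg ∘ suc)))

    coloops-nonneg : ∀ R F → Independent R F → ∀ i →
      0ℤ ℤ.≤ sumSub F (λ A → ℤ.+ μ (A ++ R) ℤ.* e (length F ∸ length A) i)
    coloops-nonneg R F indep i = subst (0ℤ ℤ.≤_)
      (sumSub-cong F λ A A⊆F → cong (λ n → ℤ.+ n ℤ.* e (length F ∸ length A) i) (μ-fibres indep A⊆F))
      (sumSub-sum-nonneg F (λ h A → 𝟙 (meets? F R (rep (F ++ R) h) A)) (λ A → e (length F ∸ length A) i)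
        λ h → coloop-fibre-nonneg F (rep (F ++ R) h) indep i)

    -- Deletion and contraction

    -- The indices i and j stay fixed: deletion and contraction never mix coefficients, so each one
    -- is treated by itself.
    module Positivity (ρ : List E → ℕ) (ρ-↭ : ∀ {A B} → A ↭ B → ρ A ≡ ρ B)
      (ρ-step : ∀ A a → (√⟪ A ⟫ (el a) × ρ (a ∷ A) ≡ ρ A) ⊎ (¬ √⟪ A ⟫ (el a) × ρ (a ∷ A) ≡ suc (ρ A)))
      (i j : ℕ)
      where

      ρ-dependent : ∀ {A a} → √⟪ A ⟫ (el a) → ρ (a ∷ A) ≡ ρ A
      ρ-dependent {A} {a} a∈√ with ρ-step A a
      ... | inj₁ (_ , eq)   = eq
      ... | inj₂ (a∉√ , _)  = contradiction a∈√ a∉√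

      ρ-independent : ∀ {A a} → ¬ √⟪ A ⟫ (el a) → ρ (a ∷ A) ≡ suc (ρ A)
      ρ-independent {A} {a} a∉√ with ρ-step A a
      ... | inj₁ (a∈√ , _)  = contradiction a∈√ a∉√
      ... | inj₂ (_ , eq)   = eq

      ρ-loops : ∀ {A} T → (∀ {t} → t ∈ T → √⟪ A ⟫ (el t)) → ρ (T ++ A) ≡ ρ A
      ρ-loops []      T⊆ = ≡.refl
      ρ-loops {A} (t ∷ T) T⊆ = ≡.trans (ρ-dependent (√⟪⟫-⊑ (⊑.xs⊆ys++xs A T) (T⊆ (here ≡.refl))))
        (ρ-loops T (T⊆ ∘ there))

      ρ-∷-≤ : ∀ A a → ρ (a ∷ A) ≤ suc (ρ A)
      ρ-∷-≤ A a with ρ-step A a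
      ... | inj₁ (_ , eq) = ℕₚ.≤-trans (ℕₚ.≤-reflexive eq) (ℕₚ.n≤1+n _)
      ... | inj₂ (_ , eq) = ℕₚ.≤-reflexive eq

      ρ-≤-∷ : ∀ A a → ρ A ≤ ρ (a ∷ A)
      ρ-≤-∷ A a with ρ-step A a
      ... | inj₁ (_ , eq) = ℕₚ.≤-reflexive (≡.sym eq)
      ... | inj₂ (_ , eq) = ℕₚ.≤-trans (ℕₚ.n≤1+n _) (ℕₚ.≤-reflexive (≡.sym eq))

      ρ-++-≤ : ∀ F R → ρ (F ++ R) ≤ length F ℕ.+ ρ R
      ρ-++-≤ []      R = ℕₚ.≤-refl
      ρ-++-≤ (f ∷ F) R = ℕₚ.≤-trans (ρ-∷-≤ (F ++ R) f) (ℕ.s≤s (ρ-++-≤ F R))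

      -- Each element raises the rank by at most 1, so a rise by the full length forces each of them
      -- to raise it.
      independent⁺ : ∀ {R} F → ρ (F ++ R) ≡ length F ℕ.+ ρ R → Independent R F
      independent⁺ []      _ = _
      independent⁺ {R} (f ∷ F) eq with ρ-step (F ++ R) f
      ... | inj₁ (_ , eq′)   = contradiction (ρ-++-≤ F R) (ℕₚ.<⇒≱ (ℕₚ.≤-reflexive (≡.trans (≡.sym eq) eq′)))
      ... | inj₂ (f∉√ , eq′) = f∉√ , independent⁺ F (ℕₚ.suc-injective (≡.trans (≡.sym eq′) eq))

      independent⁻ : ∀ {R F A} → Independent R F → A ⊆ F → ρ (A ++ R) ≡ length A ℕ.+ ρ R
      independent⁻ _               []           = ≡.refl
      independent⁻ (_ , indep)     (_ ∷ʳ A⊆F)   = independent⁻ indep A⊆F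
      independent⁻ {R} (f∉ , indep) (≡.refl ∷ A⊆F) = ≡.trans
        (ρ-independent (f∉ ∘ √⟪⟫-⊑ (⊑.++⁺ˡ R (lookup A⊆F)))) (cong suc (independent⁻ indep A⊆F))

      -- The second exponent is the nullity |A| - (ρ (A ++ R) - ρ R) in the contraction, arranged to
      -- need a single truncated subtraction. In the first exponent ρ R cancels.
      weight : (rank : ℕ) (R A : List E) → ℤ
      weight rank R A = ℤ.+ μ (A ++ R) ℤ.*
        (e (rank ∸ ρ (A ++ R)) i ℤ.* e (length A ℕ.+ ρ R ∸ ρ (A ++ R)) j)

      -- The (i, j) coefficient of the multiplicity Tutte polynomial of L in the contraction by R.
      coefficientOf : (R L : List E) → ℤ
      coefficientOf R L = sumSub L (weight (ρ (L ++ R)) R)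

      weight-↭ : ∀ rank R {A B} → A ↭ B → weight rank R A ≡ weight rank R B
      weight-↭ rank R {A} {B} A↭B = ≡.trans
        (cong₂ (λ m n → ℤ.+ m ℤ.* (e (rank ∸ n) i ℤ.* e (length A ℕ.+ ρ R ∸ n) j))
          (μ-↭ (++⁺ʳ R A↭B)) (ρ-↭ (++⁺ʳ R A↭B)))
        (cong (λ k → ℤ.+ μ (B ++ R) ℤ.* (e (rank ∸ ρ (B ++ R)) i ℤ.* e (k ℕ.+ ρ R ∸ ρ (B ++ R)) j)) (↭-length A↭B))

      coefficientOf-↭ : ∀ {R L L′} → L ↭ L′ → coefficientOf R L ≡ coefficientOf R L′
      coefficientOf-↭ {R} {L} {L′} L↭L′ = ≡.trans
        (cong (λ k → sumSub L (weight k R)) (ρ-↭ (++⁺ʳ R L↭L′)))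
        (sumSub-↭ (weight (ρ (L′ ++ R)) R) (weight-↭ (ρ (L′ ++ R)) R) L↭L′)

      -- For sets containing a, ρ R grows by one under contraction and absorbs the lost element in
      -- the nullity; for the others, the total rank survives the deletion of a.
      deletion-contraction : ∀ {R L a} → ρ (a ∷ R) ≡ suc (ρ R) → ρ (a ∷ L ++ R) ≡ ρ (L ++ R) →
        coefficientOf R (a ∷ L) ≡ coefficientOf (a ∷ R) L ℤ.+ coefficientOf R L
      deletion-contraction {R} {L} {a} not-loop not-coloop = cong₂ ℤ._+_
        (sumSub-cong L λ A _ → cong₄ (μ-↭ (past A)) (ρ-↭ (past L)) (ρ-↭ (past A))
          (≡.trans (≡.sym (ℕₚ.+-suc (length A) (ρ R))) (cong (length A ℕ.+_) (≡.sym not-loop))))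
        (cong (λ k → sumSub L (weight k R)) not-coloop)
        where
        past : ∀ A → a ∷ A ++ R ↭ A ++ a ∷ R
        past A = ↭-sym (shift a A R)
        cong₄ : ∀ {m m′ k k′ n n′ l l′} → m ≡ m′ → k ≡ k′ → n ≡ n′ → l ≡ l′ →
          ℤ.+ m ℤ.* (e (k ∸ n) i ℤ.* e (l ∸ n) j) ≡ ℤ.+ m′ ℤ.* (e (k′ ∸ n′) i ℤ.* e (l′ ∸ n′) j)
        cong₄ ≡.refl ≡.refl ≡.refl ≡.refl = ≡.refl

      molecule-nonneg : ∀ {R} T F → (∀ {t} → t ∈ T → √⟪ R ⟫ (el t)) → Independent R F →
        0ℤ ℤ.≤ coefficientOf R (T ++ F)
      -- μ R is positive because ε lies in some class, so it can be cancelled from the inequality.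
      molecule-nonneg {R} T F T⊆ indep = ℤₚ.*-cancelˡ-≤-pos 0ℤ (coefficientOf R (T ++ F)) (ℤ.+ μ R)
        {{ℤ.positive (ℤ.+<+ (index-positive (index R)))}}
        (subst₂ ℤ._≤_ (≡.sym (ℤₚ.*-zeroʳ (ℤ.+ μ R))) (≡.sym factorised)
          (nonneg-* (coloops-nonneg R F indep i) (loops-nonneg R T T⊆ j)))
        where
        open ≡.≡-Reasoning
        open ≡ using (subst₂)
        nonneg-* : ∀ {x y} → 0ℤ ℤ.≤ x → 0ℤ ℤ.≤ y → 0ℤ ℤ.≤ x ℤ.* y
        nonneg-* {x} {y} 0≤x 0≤y = subst (ℤ._≤ x ℤ.* y) (ℤₚ.*-zeroʳ x)
          (ℤₚ.*-monoˡ-≤-nonNeg x {{ℤ.nonNegative 0≤x}} 0≤y)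
        u v : List E → ℤ
        u A = ℤ.+ μ (A ++ R) ℤ.* e (length F ∸ length A) i
        v C = ℤ.+ μ (C ++ R) ℤ.* e (length C) j
        -- Loops leave the rank unchanged and F is independent. Hence the first exponent depends on
        -- A alone and the second on C alone, which separates the sums.
        ρ-molecule : ∀ C A → C ⊆ T → A ⊆ F → ρ ((C ++ A) ++ R) ≡ length A ℕ.+ ρ R
        ρ-molecule C A C⊆T A⊆F = ≡.trans (cong ρ (++-assoc C A R))
          (≡.trans (ρ-loops C (√⟪⟫-⊑ (⊑.xs⊆ys++xs R A) ∘ T⊆ ∘ lookup C⊆T)) (independent⁻ indep A⊆F))
        cancelʳ : ∀ m n o → (m ℕ.+ o) ∸ (n ℕ.+ o) ≡ m ∸ n
        cancelʳ m n o = ≡.trans (cong₂ _∸_ (ℕₚ.+-comm m o) (ℕₚ.+-comm n o)) (ℕₚ.[m+n]∸[m+o]≡n∸o o m n)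
        weight-molecule : ∀ C A → C ⊆ T → A ⊆ F →
          ℤ.+ μ R ℤ.* weight (ρ ((T ++ F) ++ R)) R (C ++ A) ≡ u A ℤ.* v C
        weight-molecule C A C⊆T A⊆F = begin
          ℤ.+ μ R ℤ.* weight (ρ ((T ++ F) ++ R)) R (C ++ A)
            ≡⟨ cong (λ r → ℤ.+ μ R ℤ.* (ℤ.+ μ ((C ++ A) ++ R) ℤ.* (e (ρ ((T ++ F) ++ R) ∸ r) i ℤ.* e (length (C ++ A) ℕ.+ ρ R ∸ r) j)))
                 (ρ-molecule C A C⊆T A⊆F) ⟩
          ℤ.+ μ R ℤ.* (ℤ.+ μ ((C ++ A) ++ R) ℤ.* (e (ρ ((T ++ F) ++ R) ∸ (length A ℕ.+ ρ R)) i ℤ.* e (length (C ++ A) ℕ.+ ρ R ∸ (length A ℕ.+ ρ R)) j))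
            ≡⟨ cong₂ (λ k l → ℤ.+ μ R ℤ.* (ℤ.+ μ ((C ++ A) ++ R) ℤ.* (e k i ℤ.* e l j)))
                 (≡.trans (cong (_∸ (length A ℕ.+ ρ R)) (ρ-molecule T F (⊆-refl {x = T}) ⊆-refl)) (cancelʳ (length F) (length A) (ρ R)))
                 (≡.trans (cancelʳ (length (C ++ A)) (length A) (ρ R))
                   (≡.trans (cong (_∸ length A) (length-++ C)) (ℕₚ.m+n∸n≡m (length C) (length A)))) ⟩
          ℤ.+ μ R ℤ.* (ℤ.+ μ ((C ++ A) ++ R) ℤ.* (e (length F ∸ length A) i ℤ.* e (length C) j))
            ≡⟨ regroup (ℤ.+ μ R) (ℤ.+ μ ((C ++ A) ++ R)) (e (length F ∸ length A) i) (e (length C) j) ⟩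
          (ℤ.+ μ ((C ++ A) ++ R) ℤ.* ℤ.+ μ R) ℤ.* (e (length F ∸ length A) i ℤ.* e (length C) j)
            ≡⟨ cong (ℤ._* (e (length F ∸ length A) i ℤ.* e (length C) j)) modular ⟩
          (ℤ.+ μ (A ++ R) ℤ.* ℤ.+ μ (C ++ R)) ℤ.* (e (length F ∸ length A) i ℤ.* e (length C) j)
            ≡⟨ interchange-* (ℤ.+ μ (A ++ R)) (ℤ.+ μ (C ++ R)) (e (length F ∸ length A) i) (e (length C) j) ⟩
          u A ℤ.* v C ∎
          where
          modular : ℤ.+ μ ((C ++ A) ++ R) ℤ.* ℤ.+ μ R ≡ ℤ.+ μ (A ++ R) ℤ.* ℤ.+ μ (C ++ R)
          modular = ≡.trans (≡.sym (ℤₚ.pos-* (μ ((C ++ A) ++ R)) (μ R)))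
            (≡.trans (cong ℤ.+_ (≡.trans (cong (λ B → μ B ℕ.* μ R) (++-assoc C A R))
                (μ-modular A C (independent-⊆ A⊆F indep) (T⊆ ∘ lookup C⊆T))))
              (ℤₚ.pos-* (μ (A ++ R)) (μ (C ++ R))))
            where
            independent-⊆ : ∀ {A F} → A ⊆ F → Independent R F → Independent R A
            independent-⊆ []             _            = _
            independent-⊆ (_ ∷ʳ A⊆F)     (_ , indep)  = independent-⊆ A⊆F indep
            independent-⊆ (≡.refl ∷ A⊆F) (f∉ , indep) = f∉ ∘ √⟪⟫-⊑ (⊑.++⁺ˡ R (lookup A⊆F)) , independent-⊆ A⊆F indep
          regroup : ∀ p q x y → p ℤ.* (q ℤ.* (x ℤ.* y)) ≡ (q ℤ.* p) ℤ.* (x ℤ.* y)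
          regroup = ℤ-Solver.solve-∀
          interchange-* : ∀ p q x y → (p ℤ.* q) ℤ.* (x ℤ.* y) ≡ (p ℤ.* x) ℤ.* (q ℤ.* y)
          interchange-* = ℤ-Solver.solve-∀
        factorised : ℤ.+ μ R ℤ.* coefficientOf R (T ++ F) ≡ sumSub F u ℤ.* sumSub T v
        factorised = begin
          ℤ.+ μ R ℤ.* coefficientOf R (T ++ F)
            ≡⟨ cong (ℤ.+ μ R ℤ.*_) (sumSub-++ T F w) ⟩
          ℤ.+ μ R ℤ.* sumSub T (λ C → sumSub F (λ A → w (C ++ A)))
            ≡⟨ sumSub-*ˡ T (ℤ.+ μ R) (λ C → sumSub F (λ A → w (C ++ A))) ⟨
          sumSub T (λ C → ℤ.+ μ R ℤ.* sumSub F (λ A → w (C ++ A)))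
            ≡⟨ sumSub-cong T (λ C C⊆T → ≡.trans (≡.sym (sumSub-*ˡ F (ℤ.+ μ R) (λ A → w (C ++ A))))
                 (≡.trans (sumSub-cong F (λ A A⊆F → weight-molecule C A C⊆T A⊆F)) (sumSub-*ʳ F (v C) u))) ⟩
          sumSub T (λ C → sumSub F u ℤ.* v C)
            ≡⟨ sumSub-*ˡ T (sumSub F u) v ⟩
          sumSub F u ℤ.* sumSub T v ∎
          where w = weight (ρ ((T ++ F) ++ R)) R

      -- The elements of T and F have been recognised as loops and coloops; both
      -- notions are stable under deletion and contraction of the other elements.
      coefficient-nonneg : ∀ S T F R → (∀ {t} → t ∈ T → √⟪ R ⟫ (el t)) →
        ρ ((S ++ T ++ F) ++ R) ≡ length F ℕ.+ ρ ((S ++ T) ++ R) →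
        0ℤ ℤ.≤ coefficientOf R (S ++ T ++ F)
      coefficient-nonneg [] T F R T⊆ coloops = molecule-nonneg T F T⊆ (independent⁺ F (≡.trans
        (≡.sym (ρ-loops T (√⟪⟫-⊑ (⊑.xs⊆ys++xs R F) ∘ T⊆)))
        (≡.trans (cong ρ (≡.sym (++-assoc T F R)))
          (≡.trans coloops (cong (length F ℕ.+_) (ρ-loops T T⊆))))))
      coefficient-nonneg (a ∷ S) T F R T⊆ coloops with ρ-step R a
      ... | inj₁ (a∈√R , _) = subst (0ℤ ℤ.≤_) (coefficientOf-↭ (shift a S (T ++ F)))
        (coefficient-nonneg S (a ∷ T) F R
          (λ { (here ≡.refl) → a∈√R ; (there t∈T) → T⊆ t∈T })
          (≡.trans (ρ-↭ (++⁺ʳ R (shift a S (T ++ F))))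
            (≡.trans coloops (cong (length F ℕ.+_) (ρ-↭ (++⁺ʳ R (↭-sym (shift a S T))))))))
      ... | inj₂ (_ , not-loop) with ρ-step ((S ++ T ++ F) ++ R) a
      ...   | inj₂ (a∉√ , eq) = subst (0ℤ ℤ.≤_) (coefficientOf-↭ to-back)
        (coefficient-nonneg S T (a ∷ F) R T⊆ (≡.trans (ρ-↭ (++⁺ʳ R to-back))
          (≡.trans coloops (≡.trans (cong (length F ℕ.+_) (ρ-independent (a∉√ ∘ √⟪⟫-⊑ (⊑.++⁺ˡ R ST⊑))))
            (ℕₚ.+-suc (length F) (ρ ((S ++ T) ++ R)))))))
        where
        to-back : S ++ T ++ a ∷ F ↭ a ∷ S ++ T ++ F
        to-back = ↭-trans (++⁺ˡ S (shift a T F)) (shift a S (T ++ F))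
        ST⊑ : S ++ T ⊑ S ++ T ++ F
        ST⊑ = ⊑.++⁺ʳ S (⊑.xs⊆xs++ys T F)
      ...   | inj₁ (_ , not-coloop) = subst (0ℤ ℤ.≤_) (≡.sym (deletion-contraction not-loop not-coloop))
        (ℤₚ.+-mono-≤
          (coefficient-nonneg S T F (a ∷ R) (√⟪⟫-⊑ there ∘ T⊆)
            (≡.trans (ρ-↭ (shift a (S ++ T ++ F) R))
              (≡.trans coloops (cong (length F ℕ.+_) (ρ-↭ (↭-sym (shift a (S ++ T) R)))))))
          -- The rank equation for F survives the deletion of a: adding F gains at most its length,
          -- and at least that much, since the total rank is unchanged while the rank without F can
          -- only drop.
          (coefficient-nonneg S T F R T⊆ (ℕₚ.≤-antisym
            (subst (_≤ length F ℕ.+ ρ ((S ++ T) ++ R)) (ρ-↭ F-front) (ρ-++-≤ F ((S ++ T) ++ R)))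
            (ℕₚ.≤-trans (ℕₚ.+-monoʳ-≤ (length F) (ρ-≤-∷ ((S ++ T) ++ R) a))
              (ℕₚ.≤-reflexive (≡.trans (≡.sym coloops) not-coloop))))))
        where
        F-front : F ++ (S ++ T) ++ R ↭ (S ++ T ++ F) ++ R
        F-front = ↭-trans (shifts F (S ++ T)) (↭-reflexive
          (≡.trans (≡.sym (++-assoc (S ++ T) F R)) (cong (_++ R) (++-assoc S T F))))

-- Arbitrary lists over X and its sublists

insert : ∀ {a} {A : Set a} {xs ys : List A} {x} → ys ⊆ xs → x ∈ xs →
  ∃ λ zs → zs ⊆ xs × zs ⊑ x ∷ ys × x ∷ ys ⊑ zs
insert {ys = ys} {x} (x ∷ʳ ys⊆xs)     (here ≡.refl) = x ∷ ys , ≡.refl ∷ ys⊆xs , (λ z → z) , (λ z → z)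
-- The position of x is already taken in `ys`, so nothing is inserted: members are preserved,
-- repetitions are not.
insert {ys = ys}     (≡.refl ∷ ys⊆xs) (here ≡.refl) = ys , ≡.refl ∷ ys⊆xs , there , ⊑.∈-∷⁺ʳ (here ≡.refl) (λ z → z)
insert (y ∷ʳ ys⊆xs) (there x∈xs) with insert ys⊆xs x∈xs
... | zs , zs⊆xs , zs⊑ , ⊑zs = zs , y ∷ʳ zs⊆xs , zs⊑ , ⊑zs
insert {ys = y ∷ ys} {x} (≡.refl ∷ ys⊆xs) (there x∈xs) with insert ys⊆xs x∈xs
... | zs , zs⊆xs , zs⊑ , ⊑zs = y ∷ zs , ≡.refl ∷ zs⊆xs
  , ⊑.⊆-trans (⊑.∷⁺ʳ y zs⊑) (⊑.⊆-reflexive-↭ (swap y x ↭-refl))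
  , ⊑.⊆-trans (⊑.⊆-reflexive-↭ (swap x y ↭-refl)) (⊑.∷⁺ʳ y ⊑zs)

-- This finds, for any list over X, a sublist generating the same subgroup, where a multiplicity is
-- given.
as-sublist : ∀ {a} {A : Set a} {xs : List A} ys → (∀ {y} → y ∈ ys → y ∈ xs) →
  ∃ λ zs → zs ⊆ xs × zs ⊑ ys × ys ⊑ zs
as-sublist {xs = xs} []       ys⊑xs = [] , minimum xs , (λ z → z) , (λ z → z)
as-sublist (y ∷ ys) ys⊑xs with as-sublist ys (ys⊑xs ∘ there)
... | zs , zs⊆xs , zs⊑ys , ys⊑zs with insert zs⊆xs (ys⊑xs (here ≡.refl))
...   | ws , ws⊆xs , ws⊑ , ⊑ws = ws , ws⊆xs , ⊑.⊆-trans ws⊑ (⊑.∷⁺ʳ y zs⊑ys) , ⊑.⊆-trans (⊑.∷⁺ʳ y ys⊑zs) ⊑ws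

complement : ∀ {a} {A : Set a} {xs ys : List A} → ys ⊆ xs → ∃ λ zs → xs ↭ zs ++ ys
complement []               = [] , ↭-refl
complement (x ∷ʳ ys⊆xs)     with complement ys⊆xs
... | zs , xs↭ = x ∷ zs , prep x xs↭
complement {ys = y ∷ ys} (≡.refl ∷ ys⊆xs) with complement ys⊆xs
... | zs , xs↭ = zs , ↭-trans (prep y xs↭) (↭-sym (shift y zs ys))

-- Application to Γ and X

fromℤ-1 : CommutativeRing._≈_ ℝ-commutativeRing (fromℤ 1ℤ) (CommutativeRing.1# ℝ-commutativeRing)
fromℤ-1 = TendsTo0-0 λ _ → ≡.refl

module ℝ-Rank = Rank ℝ-commutativeRing fromℤ fromℤ-1 fromℤ-+ fromℤ-* fromℤ-injective fromℤ-invertible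
module ℝ-Combinations = Combinations ℝ-commutativeRing

-- The two notions of span coincide by definition, but comparing them with
-- rational vectors in place of variables unfolds the proofs of the Cauchy property.
module _ {n k} (v : Vector (ℝ^ n) k) where

  span⁺ : ∀ u → InSpan v u → ℝ-Combinations.Spanned v u
  span⁺ u (λs , u≈) = record { coefficients = λs; expansion = u≈ }

  span⁻ : ∀ u → ℝ-Combinations.Spanned v u → InSpan v u
  span⁻ u u∈v = coefficients u∈v , expansion u∈v
    where open ℝ-Combinations.Spanned

dimension⁺ : ∀ {n k} (v : Vector (ℝ^ n) k) d → SpanHasDimension v d → ℝ-Combinations.HasDimension v d
dimension⁺ v d (b , independent , v⇔b) = record
  { basis = b
  ; independent = independent
  ; spans = λ u → mk⇔ (span⁺ b u ∘ Equivalence.to (v⇔b u) ∘ span⁻ v u)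
                      (span⁺ v u ∘ Equivalence.from (v⇔b u) ∘ span⁻ b u)
  }

module SplitGroup {c ℓ} {Γ : AbelianGroup c ℓ} (S : Splitting Γ) where
  open AbelianGroup Γ using (Carrier; _≈_; _∙_; ε; _⁻¹)
  open Splitting S
  open GroupMorphisms.IsGroupIsomorphism isIsomorphism using (∙-homo; ε-homo; ⁻¹-homo; ⟦⟧-cong)
  open GeneratedSubgroups Γ
  open ℝ-Rank
  open ℝ-Combinations using (span-member; span-trans)

  πℤ[_] : (A : List Carrier) → Vector (Vector ℤ n) (length A)
  πℤ[ A ] i = π (lookupᴸ A i)

  dim : List Carrier → ℕ
  dim A = Frame.dim (frame πℤ[ A ])

  Saturated : List Carrier → Carrier → Set
  Saturated A g = ℝ-Combinations.Spanned πℝ[ A ] (πℝ g)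

  frame-has-dim : ∀ A → ℝ-Combinations.HasDimension πℝ[ A ] (dim A)
  frame-has-dim A = frame-dimension (frame πℤ[ A ])

  member-saturated : ∀ {A g} → g ∈ A → Saturated A g
  member-saturated {A} {g} g∈A = subst (Saturated A) (≡.sym (lookup-index g∈A)) (span-member (Any.index g∈A))

  ⊑-saturated : ∀ {A B} → A ⊑ B → ∀ i → Saturated B (lookupᴸ A i)
  ⊑-saturated {A} A⊑B i = member-saturated (A⊑B (∈-lookup {xs = A} i))

  saturated-⊑ : ∀ {A B g} → A ⊑ B → Saturated A g → Saturated B g
  saturated-⊑ {A} {B} A⊑B = span-trans (⊑-saturated A⊑B)

  dim-⊑ : ∀ {A B} → A ⊑ B → B ⊑ A → dim A ≡ dim B
  dim-⊑ {A} {B} A⊑B B⊑A = dimension-unique (⊑-saturated A⊑B) (⊑-saturated B⊑A) (frame-has-dim A) (frame-has-dim B)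

  -- Uniqueness of dimension replaces the given ranks by those computed by elimination, whose growth
  -- under adding an element is known.
  rank-dim : ∀ {A d} → HasRank A d → d ≡ dim A
  rank-dim {A} {d} r = dimension-unique (λ i → span-member i) (λ i → span-member i)
    (dimension⁺ πℝ[ A ] d r) (frame-has-dim A)

  dim-∷ : ∀ A a → (Saturated A a × dim (a ∷ A) ≡ dim A) ⊎ (¬ Saturated A a × dim (a ∷ A) ≡ suc (dim A))
  dim-∷ A a = dim-step πℤ[ a ∷ A ]

  -- One elimination step, with g adjoined to A, decides whether π(g) lies in the real span.
  saturated? : ∀ A g → Dec (Saturated A g)
  saturated? A g with dim-∷ A g
  ... | inj₁ (g∈ , _) = yes g∈
  ... | inj₂ (g∉ , _) = no g∉

  dim-≤-length : ∀ A → dim A ≤ length A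
  dim-≤-length []      = ℕ.z≤n
  dim-≤-length (a ∷ A) with dim-∷ A a
  ... | inj₁ (_ , eq) = ℕₚ.≤-trans (ℕₚ.≤-reflexive eq) (ℕₚ.m≤n⇒m≤1+n (dim-≤-length A))
  ... | inj₂ (_ , eq) = ℕₚ.≤-trans (ℕₚ.≤-reflexive eq) (ℕ.s≤s (dim-≤-length A))

  dim-≤-++ : ∀ B A → dim A ≤ dim (B ++ A)
  dim-≤-++ []      A = ℕₚ.≤-refl
  dim-≤-++ (b ∷ B) A with dim-∷ (B ++ A) b
  ... | inj₁ (_ , eq) = ℕₚ.≤-trans (dim-≤-++ B A) (ℕₚ.≤-reflexive (≡.sym eq))
  ... | inj₂ (_ , eq) = ℕₚ.≤-trans (ℕₚ.m≤n⇒m≤1+n (dim-≤-++ B A)) (ℕₚ.≤-reflexive (≡.sym eq))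

  dim-⊆ : ∀ {A B} → A ⊆ B → dim A ≤ dim B
  dim-⊆ {A} {B} A⊆B with complement A⊆B
  ... | C , B↭CA = ℕₚ.≤-trans (dim-≤-++ C A)
    (ℕₚ.≤-reflexive (dim-⊑ (⊑.⊆-reflexive-↭ (↭-sym B↭CA)) (⊑.⊆-reflexive-↭ B↭CA)))

  π-· : ∀ k g j → π (k · g) j ≡ ℤ.+ k ℤ.* π g j
  π-· zero    g j = proj₁ ε-homo j
  π-· (suc k) g j = ≡.trans (proj₁ (∙-homo g (k · g)) j)
    (≡.trans (cong (λ z → π g j ℤ.+ z) (π-· k g j)) (≡.sym (ℤₚ.suc-* (ℤ.+ k) (π g j))))

  generated⇒saturated : ∀ {A g} → ⟨ A ⟩ g → Saturated A g
  generated⇒saturated (generator g∈A) = member-saturated g∈A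
  generated⇒saturated identity        = span-ι-0 {x = π ε} (proj₁ ε-homo)
  generated⇒saturated {A} (product {g} {h} p q) = span-ι-+ {x = π g} {π h} {π (g ∙ h)} (proj₁ (∙-homo g h))
    (generated⇒saturated {A} {g} p) (generated⇒saturated {A} {h} q)
  generated⇒saturated {A} (inverse {g} p) =
    span-ι-neg {x = π g} {π (g ⁻¹)} (proj₁ (⁻¹-homo g)) (generated⇒saturated {A} {g} p)
  generated⇒saturated {A} (respects {g} {h} g≈h p) =
    span-ι-resp {x = π g} {π h} (proj₁ (⟦⟧-cong g≈h)) (generated⇒saturated {A} {g} p)

  √⇒saturated : ∀ {A g} → √⟨ A ⟩ g → Saturated A g
  √⇒saturated {A} {g} (k , x) = span-ι-divide {z = ℤ.+ suc k} {π g} {π (suc k · g)} (λ ()) (π-· (suc k) g)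
    (generated⇒saturated {A} {suc k · g} x)

  saturated-· : ∀ {A g} k → Saturated A g → Saturated A (k · g)
  saturated-· {A} zero x = generated⇒saturated {A} {ε} identity
  saturated-· {A} {g} (suc k) x = span-ι-+ {x = π g} {π (k · g)} {π (suc k · g)} (proj₁ (∙-homo g (k · g)))
    x (saturated-· {A} {g} k x)

  -- The real saturation is closed under multiples, and the multiplicity says that ⟨ A ⟩ has finite
  -- index in it.
  saturated⇒√ : ∀ {A k} → HasMultiplicity A k → ∀ {g} → Saturated A g → √⟨ A ⟩ g
  saturated⇒√ {A} index {g} x = finite-index⇒√ {K = Saturation A} index
    (λ k → span⁻ πℝ[ A ] (πℝ (k · g)) (saturated-· {A} {g} k x))

module _ {c ℓ} (Γ : AbelianGroup c ℓ) (S : Splitting Γ)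
  (X : List (AbelianGroup.Carrier Γ)) (r m : List (AbelianGroup.Carrier Γ) → ℕ)
  (has-r : ∀ A → A ⊆ X → Splitting.HasRank S A (r A))
  (has-m : ∀ A → A ⊆ X → Splitting.HasMultiplicity S A (m A))
  where
  open AbelianGroup Γ using (Carrier)
  open Splitting S
  open SplitGroup S
  open GeneratedSubgroups Γ

  private
    E = Fin (length X)

    el : E → Carrier
    el = lookupᴸ X

    canonical : (A : List E) → ∃ λ Y → Y ⊆ X × Y ⊑ map el A × map el A ⊑ Y
    canonical A = as-sublist (map el A) (λ y∈ → in-X A y∈)
      where
      in-X : ∀ A {y} → y ∈ map el A → y ∈ X
      in-X (a ∷ A) (here ≡.refl) = ∈-lookup {xs = X} a
      in-X (a ∷ A) (there y∈)    = in-X A y∈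

    μ : List E → ℕ
    μ A = m (proj₁ (canonical A))

    saturated⇒√⟨map⟩ : ∀ A {g} → Saturated (map el A) g → √⟨ map el A ⟩ g
    saturated⇒√⟨map⟩ A {g} x = from (canonical A)
      where
      from : (∃ λ Y → Y ⊆ X × Y ⊑ map el A × map el A ⊑ Y) → √⟨ map el A ⟩ g
      from (Y , Y⊆X , Y⊑A , A⊑Y) = √-⊑ Y⊑A (saturated⇒√ {Y} {m Y} (has-m Y Y⊆X) {g} (saturated-⊑ {map el A} {Y} {g} A⊑Y x))

    index : ∀ A → HasIndex Γ √⟨ map el A ⟩ ⟨ map el A ⟩ (μ A)
    index A = from (canonical A)
      where
      from : ((Y , _) : ∃ λ Y → Y ⊆ X × Y ⊑ map el A × map el A ⊑ Y) → HasIndex Γ √⟨ map el A ⟩ ⟨ map el A ⟩ (m Y)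
      from (Y , Y⊆X , Y⊑A , A⊑Y) = index-transport
        {K = Saturation Y} {√⟨ map el A ⟩} {⟨ Y ⟩} {⟨ map el A ⟩}
        (λ {g} x → √-⊑ Y⊑A (saturated⇒√ {Y} {m Y} (has-m Y Y⊆X) {g} (span⁺ πℝ[ Y ] (πℝ g) x)))
        (λ {g} x → span⁻ πℝ[ Y ] (πℝ g) (√⇒saturated {Y} {g} (√-⊑ A⊑Y x)))
        (⟨⟩-⊑ Y⊑A) (⟨⟩-⊑ A⊑Y) (has-m Y Y⊆X)

    √? : ∀ A g → Dec (√⟨ map el A ⟩ g)
    √? A g = map′ (saturated⇒√⟨map⟩ A {g}) (√⇒saturated {map el A} {g}) (saturated? (map el A) g)

    ρ : List E → ℕ
    ρ A = dim (map el A)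

    ρ-↭ : ∀ {A B} → A ↭ B → ρ A ≡ ρ B
    ρ-↭ A↭B = dim-⊑ (⊑.map⁺ el (⊑.⊆-reflexive-↭ A↭B)) (⊑.map⁺ el (⊑.⊆-reflexive-↭ (↭-sym A↭B)))

    ρ-step : ∀ A a → (√⟨ map el A ⟩ (el a) × ρ (a ∷ A) ≡ ρ A) ⊎ (¬ √⟨ map el A ⟩ (el a) × ρ (a ∷ A) ≡ suc (ρ A))
    ρ-step A a = from (dim-∷ (map el A) (el a))
      where
      from : (Saturated (map el A) (el a) × ρ (a ∷ A) ≡ ρ A) ⊎ (¬ Saturated (map el A) (el a) × ρ (a ∷ A) ≡ suc (ρ A)) →
         (√⟨ map el A ⟩ (el a) × ρ (a ∷ A) ≡ ρ A) ⊎ (¬ √⟨ map el A ⟩ (el a) × ρ (a ∷ A) ≡ suc (ρ A))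
      from (inj₁ (a∈ , eq)) = inj₁ (saturated⇒√⟨map⟩ A {el a} a∈ , eq)
      from (inj₂ (a∉ , eq)) = inj₂ (a∉ ∘ √⇒saturated {map el A} {el a} , eq)

    L : List E
    L = allFin (length X)

    map-L : map el L ≡ X
    map-L = ≡.trans (map-tabulate (λ i → i) el) (tabulate-lookup X)

    map-⊆ : ∀ {A} → A ⊆ L → map el A ⊆ X
    map-⊆ {A} A⊆L = subst (map el A ⊆_) map-L (⊆.map⁺ el A⊆L)

    -- `canonical` may choose a sublist other than `map el A`, but both numbers are the index of the
    -- same pair of subgroups.
    m≡μ : ∀ {A} → A ⊆ L → m (map el A) ≡ μ A
    m≡μ {A} A⊆L = index-unique (index-transport
      {K = Saturation (map el A)} {√⟨ map el A ⟩} {⟨ map el A ⟩} {⟨ map el A ⟩}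
      (λ {g} x → saturated⇒√⟨map⟩ A {g} (span⁺ πℝ[ map el A ] (πℝ g) x))
      (λ {g} x → span⁻ πℝ[ map el A ] (πℝ g) (√⇒saturated {map el A} {g} x)) (λ x → x) (λ x → x) (has-m (map el A) (map-⊆ A⊆L))) (index A)

  rank-bounds : ∀ A → A ⊆ X → r A ≤ r X × r A ≤ length A
  rank-bounds A A⊆X =
      subst₂ _≤_ (≡.sym (rank-dim {A} (has-r A A⊆X))) (≡.sym (rank-dim {X} (has-r X ⊆-refl))) (dim-⊆ A⊆X)
    , subst (_≤ length A) (≡.sym (rank-dim {A} (has-r A A⊆X))) (dim-≤-length A)
    where open ≡ using (subst₂)

  Tutte-nonneg : ∀ i j → 0ℤ ℤ.≤ coefficient (multiplicityTutte r m X) i j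
  Tutte-nonneg i j = subst (0ℤ ℤ.≤_) (≡.sym same)
    -- Initially no loop or coloop has been recognised and nothing is contracted. The empty lists
    -- this leaves behind are removed by `weight≡` and `same`.
    (coefficient-nonneg L [] [] [] (λ ()) ≡.refl)
    where
    open IndexedFamily Γ el μ index √?
    open Positivity ρ ρ-↭ ρ-step i j
    open ≡.≡-Reasoning
    f : List Carrier → ℤ
    f Y = ℤ.+ m Y ℤ.* (e (r X ∸ r Y) i ℤ.* e (length Y ∸ r Y) j)
    weight≡ : ∀ A → A ⊆ L → f (map el A) ≡ weight (ρ ((L ++ []) ++ [])) [] A
    weight≡ A A⊆L = cong₄ (≡.trans (m≡μ A⊆L) (cong μ (≡.sym (++-identityʳ A))))
      (≡.trans (rank-dim {X} (has-r X ⊆-refl)) (cong dim (≡.trans (≡.sym map-L)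
        (cong (map el) (≡.sym (≡.trans (++-identityʳ (L ++ [])) (++-identityʳ L)))))))
      (≡.trans (rank-dim {map el A} (has-r (map el A) (map-⊆ A⊆L))) (cong ρ (≡.sym (++-identityʳ A))))
      (≡.trans (length-map el A) (≡.sym (ℕₚ.+-identityʳ (length A))))
      where
      cong₄ : ∀ {a a′ b b′ c c′ d d′} → a ≡ a′ → b ≡ b′ → c ≡ c′ → d ≡ d′ →
        ℤ.+ a ℤ.* (e (b ∸ c) i ℤ.* e (d ∸ c) j) ≡ ℤ.+ a′ ℤ.* (e (b′ ∸ c′) i ℤ.* e (d′ ∸ c′) j)
      cong₄ ≡.refl ≡.refl ≡.refl ≡.refl = ≡.refl
    same : coefficient (multiplicityTutte r m X) i j ≡ coefficientOf [] (L ++ [] ++ [])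
    same = begin
      coefficient (multiplicityTutte r m X) i j                 ≡⟨ coefficient-Tutte r m X i j ⟩
      sumSub X f                                                ≡⟨ cong (λ Y → sumSub Y f) map-L ⟨
      sumSub (map el L) f                                       ≡⟨ sumSub-map el L f ⟩
      sumSub L (λ A → f (map el A))                             ≡⟨ sumSub-cong L weight≡ ⟩
      sumSub L (weight (ρ ((L ++ []) ++ [])) [])                ≡⟨ cong (λ L′ → sumSub L′ (weight (ρ ((L ++ []) ++ [])) [])) (++-identityʳ L) ⟨
      coefficientOf [] (L ++ [] ++ [])                          ∎

open AbelianGroup using (Carrier)
open Splitting using (HasRank; HasMultiplicity)

theorem3p5 : ∀ {c ℓ} (Γ : AbelianGroup c ℓ) → FinitelyGenerated Γ → (S : Splitting Γ) →
    (X : List (Carrier Γ)) (r m : List (Carrier Γ) → ℕ) →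
    (∀ A → A ⊆ X → HasRank S A (r A)) →
    (∀ A → A ⊆ X → HasMultiplicity S A (m A)) →
    (∀ A → A ⊆ X → r A ≤ r X × r A ≤ length A) ×
    (∀ i j → 0ℤ ℤ.≤ coefficient (multiplicityTutte r m X) i j)
theorem3p5 Γ _ S X r m has-r has-m =
  rank-bounds Γ S X r m has-r has-m , Tutte-nonneg Γ S X r m has-r has-m
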